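{- Let $p:\mathbb{N}\to[0,1]$, $n\mapsto p_n$, be middling of exponent $10$, i.e. $-\liminf_{n\to\infty}\log_n p_n<\tfrac{1}{10}$ and $\lim_{n\to\infty}p_n=0$. Then $$\lim_{n\to\infty}\ \mathbb{P}_{\Gamma\in\Omega^{[n]}_{p_n}}\Big(\kappa^1_{\mathbb{F}_2}(\Gamma)=\delta^1(\Gamma)\Big)=1 .$$
   Context: Graphs are finite and simple, $\Gamma=(V(\Gamma),E(\Gamma))$. $\mathbb{N}=\{1,2,\dots\}$ and $[n]=\{1,\dots,n\}$. $\Omega^{[n]}_{p}$ denotes the Erdős–Rényi probability space of random graphs on vertex set $[n]$ in which each of the $\binom n2$ possible edges is present independently with probability $p$. For $C\subseteq V(\Gamma)$, $\Gamma-C$ is the subgraph of $\Gamma$ induced on $V(\Gamma)\setminus C$. For a vertex $v$, $N_\Gamma(v)=\{u:\{u,v\}\in E(\Gamma)\}$, and for a vertex set $I$, $N_\Gamma(I)=\bigcap_{c\in I}N_\Gamma(c)$ is the set of common neighbors. $\mathrm{Cl}(\Gamma)$ is the clique complex of $\Gamma$: the simplicial complex on $V(\Gamma)$ whose set of $i$-simplices $\mathrm{Cl}(\Gamma)[i]$ consists of the $(i+1)$-element vertex subsets that are pairwise adjacent. For a field $\mathbb{K}$ and an integer $i\ge 0$, $$\kappa^i_{\mathbb{K}}(\Gamma)=\min\{|C| : C\subseteq V(\Gamma),\ \tilde H^i(\mathrm{Cl}(\Gamma-C);\mathbb{K})\ne 0\},$$ $$\delta^i(\Gamma)=\min\{|N_\Gamma(I)|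 : I\in \mathrm{Cl}(\Gamma)[i]\},$$ where $\tilde H^i$ is reduced simplicial cohomology and the minimum over the empty set is $+\infty$. $\mathbb{F}_2$ is the field with two elements. -}

module Defs where

open import Algebra.Bundles using (CommutativeRing)
open import Data.Bool using (Bool; true; false; if_then_else_)
import Data.Bool.Properties as Bool
open import Data.Empty using (⊥-elim)
open import Data.Fin as Fin using (Fin)
import Data.Fin.Properties as Fin
open import Data.Fin.Subset using (Subset; inside; outside; _∈_; _⊆_; _─_; ⋂; ∣_∣) renaming (_-_ to _∸ˢ_; ⊥ to ∅; ⊤ to full)
open import Data.Fin.Subset.Properties using (_∈?_; _⊆?_; anySubset?; ∉⊥; ∈⊤)
open import Data.Integer as ℤ using (+_; -[1+_])
open import Data.List using (List; []; _∷_; _++_; map; filter; foldr; length; allFin; cartesianProduct)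
open import Data.List.Properties using (map-cong)
import Data.List.Membership.DecPropositional as DecMembership
open import Data.List.Membership.Propositional using () renaming (_∈_ to _∈ˡ_)
open import Data.Nat as ℕ using (ℕ; zero; suc)
import Data.Nat.Properties as ℕ
open import Data.Product using (_×_; _,_; ∃; proj₁; proj₂)
open import Data.Product.Properties using () renaming (≡-dec to ×-≡-dec)
open import Data.Rational as ℚ using (ℚ; 0ℚ; 1ℚ; ½; ↥_; ↧ₙ_)
import Data.Rational.Properties as ℚ
open import Data.Rational.Solver using (module +-*-Solver)
open import Data.Sum using (_⊎_; [_,_]′)
import Data.Sum as Sum
open import Data.Vec using ([]; _∷_; tabulate)
open import Function using (_∘_)
open import Level using (0ℓ; _⊔_)
open import Relation.Binary using (Rel)
import Relation.Binary as Binary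
open import Relation.Binary.PropositionalEquality using (_≡_; _≢_; _≗_; refl; sym; trans; cong; cong₂; subst)
open import Relation.Nullary using (Dec; yes; no; ¬_; does)
open import Relation.Nullary.Construct.Add.Supremum using (_⁺; ⊤⁺; [_]; ≡-dec)
open import Relation.Nullary.Decidable using (map′; _×-dec_; _⊎-dec_; _→-dec_; ¬?; decidable-stable)
open import Relation.Unary using (Pred; Decidable)

private
  variable
    n : ℕ

------------------------------------------------------------------------
-- Real numbers, as Cauchy sequences of rationals

record ℝ : Set where
  field
    approx : ℕ → ℚ
    cauchy : ∀ ε → 0ℚ ℚ.< ε →
             ∃ λ N → ∀ {j k} → N ℕ.≤ j → N ℕ.≤ k → ℚ.∣ approx j ℚ.- approx k ∣ ℚ.< ε

open ℝ public using (approx)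

infix 4 _<ᴿ_ _≤ᴿ_

_<ᴿ_ : ℝ → ℝ → Set
x <ᴿ y = ∃ λ ε → 0ℚ ℚ.< ε × (∃ λ N → ∀ k → N ℕ.≤ k → approx x k ℚ.+ ε ℚ.≤ approx y k)

_≤ᴿ_ : ℝ → ℝ → Set
x ≤ᴿ y = ∀ ε → 0ℚ ℚ.< ε → ∃ λ N → ∀ k → N ℕ.≤ k → approx x k ℚ.≤ approx y k ℚ.+ ε

fromℚ : ℚ → ℝ
fromℚ q .approx _ = q
fromℚ q .ℝ.cauchy ε 0<ε = 0 , λ _ _ →
  subst (ℚ._< ε) (cong ℚ.∣_∣ (sym (ℚ.+-inverseʳ q))) 0<ε

0ᴿ 1ᴿ : ℝ
0ᴿ = fromℚ 0ℚ
1ᴿ = fromℚ 1ℚ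

private
  0<½*_ : ∀ {ε} → 0ℚ ℚ.< ε → 0ℚ ℚ.< ½ ℚ.* ε
  0<½*_ {ε} 0<ε = subst (ℚ._< ½ ℚ.* ε) (ℚ.*-zeroʳ ½) (ℚ.*-monoʳ-<-pos ½ 0<ε)

  halves : ∀ ε → ½ ℚ.* ε ℚ.+ ½ ℚ.* ε ≡ ε
  halves ε = trans (sym (ℚ.*-distribʳ-+ ε ½ ½)) (ℚ.*-identityˡ ε)

  -- Convergence of x and y at tolerances δ₁ and δ₂, on a common tail.
  common : ∀ (x y : ℝ) {δ₁ δ₂} → 0ℚ ℚ.< δ₁ → 0ℚ ℚ.< δ₂ →
           ∃ λ N → ∀ {j k} → N ℕ.≤ j → N ℕ.≤ k →
             (ℚ.∣ approx x j ℚ.- approx x k ∣ ℚ.< δ₁) × (ℚ.∣ approx y j ℚ.- approx y k ∣ ℚ.< δ₂)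
  common x y 0<δ₁ 0<δ₂ with ℝ.cauchy x _ 0<δ₁ | ℝ.cauchy y _ 0<δ₂
  ... | M , hx | N , hy = M ℕ.⊔ N , λ p q →
    hx (ℕ.≤-trans (ℕ.m≤m⊔n M N) p) (ℕ.≤-trans (ℕ.m≤m⊔n M N) q) ,
    hy (ℕ.≤-trans (ℕ.m≤n⊔m M N) p) (ℕ.≤-trans (ℕ.m≤n⊔m M N) q)

  eventually-bounded : ∀ (x : ℝ) →
    ∃ λ B → ℚ.Positive B × (∃ λ N → ∀ {k} → N ℕ.≤ k → ℚ.∣ approx x k ∣ ℚ.≤ B)
  eventually-bounded x with ℝ.cauchy x 1ℚ (ℚ.positive⁻¹ 1ℚ)
  ... | N , h = 1ℚ ℚ.+ a , ℚ.positive 0<B , N , bound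
    where
    a = ℚ.∣ approx x N ∣
    open ℚ.≤-Reasoning
    0<B : 0ℚ ℚ.< 1ℚ ℚ.+ a
    0<B = ℚ.+-mono-<-≤ (ℚ.positive⁻¹ 1ℚ) (ℚ.0≤∣p∣ (approx x N))
    split : ∀ u v → u ≡ (u ℚ.- v) ℚ.+ v
    split = solve 2 (λ u v → u := (u :- v) :+ v) refl
      where open +-*-Solver
    bound : ∀ {k} → N ℕ.≤ k → ℚ.∣ approx x k ∣ ℚ.≤ 1ℚ ℚ.+ a
    bound {k} N≤k = begin
      ℚ.∣ approx x k ∣                              ≡⟨ cong ℚ.∣_∣ (split (approx x k) (approx x N)) ⟩
      ℚ.∣ (approx x k ℚ.- approx x N) ℚ.+ approx x N ∣ ≤⟨ ℚ.∣p+q∣≤∣p∣+∣q∣ (approx x k ℚ.- approx x N) (approx x N) ⟩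
      ℚ.∣ approx x k ℚ.- approx x N ∣ ℚ.+ a          ≤⟨ ℚ.+-monoˡ-≤ a (ℚ.<⇒≤ (h N≤k ℕ.≤-refl)) ⟩
      1ℚ ℚ.+ a                                      ∎

  +-close : ∀ {ε} a b c d → ℚ.∣ a ℚ.- c ∣ ℚ.< ½ ℚ.* ε → ℚ.∣ b ℚ.- d ∣ ℚ.< ½ ℚ.* ε →
            ℚ.∣ (a ℚ.+ b) ℚ.- (c ℚ.+ d) ∣ ℚ.< ε
  +-close {ε} a b c d p q = begin-strict
    ℚ.∣ (a ℚ.+ b) ℚ.- (c ℚ.+ d) ∣         ≡⟨ cong ℚ.∣_∣ (rearrange a b c d) ⟩
    ℚ.∣ (a ℚ.- c) ℚ.+ (b ℚ.- d) ∣         ≤⟨ ℚ.∣p+q∣≤∣p∣+∣q∣ (a ℚ.- c) (b ℚ.- d) ⟩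
    ℚ.∣ a ℚ.- c ∣ ℚ.+ ℚ.∣ b ℚ.- d ∣       <⟨ ℚ.+-mono-< p q ⟩
    ½ ℚ.* ε ℚ.+ ½ ℚ.* ε                   ≡⟨ halves ε ⟩
    ε                                     ∎
    where
    open ℚ.≤-Reasoning
    rearrange : ∀ a b c d → (a ℚ.+ b) ℚ.- (c ℚ.+ d) ≡ (a ℚ.- c) ℚ.+ (b ℚ.- d)
    rearrange = solve 4 (λ a b c d → (a :+ b) :- (c :+ d) := (a :- c) :+ (b :- d)) refl
      where open +-*-Solver

  neg-close : ∀ {ε} b d → ℚ.∣ b ℚ.- d ∣ ℚ.< ε → ℚ.∣ (ℚ.- b) ℚ.- (ℚ.- d) ∣ ℚ.< ε
  neg-close b d = subst (ℚ._< _)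
    (trans (sym (ℚ.∣-p∣≡∣p∣ (b ℚ.- d))) (cong ℚ.∣_∣ (ℚ.neg-distrib-+ b (ℚ.- d))))

  *-close : ∀ {A B δ} a b c d → .{{ℚ.Positive A}} → .{{ℚ.Positive B}} →
            ℚ.∣ a ∣ ℚ.≤ A → ℚ.∣ d ∣ ℚ.≤ B → ℚ.∣ a ℚ.- c ∣ ℚ.< δ → ℚ.∣ b ℚ.- d ∣ ℚ.< δ →
            ℚ.∣ a ℚ.* b ℚ.- c ℚ.* d ∣ ℚ.< (A ℚ.+ B) ℚ.* δ
  *-close {A} {B} {δ} a b c d a≤A d≤B p q = begin-strict
    ℚ.∣ a ℚ.* b ℚ.- c ℚ.* d ∣                             ≡⟨ cong ℚ.∣_∣ (rearrange a b c d) ⟩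
    ℚ.∣ a ℚ.* (b ℚ.- d) ℚ.+ d ℚ.* (a ℚ.- c) ∣             ≤⟨ ℚ.∣p+q∣≤∣p∣+∣q∣ (a ℚ.* (b ℚ.- d)) (d ℚ.* (a ℚ.- c)) ⟩
    ℚ.∣ a ℚ.* (b ℚ.- d) ∣ ℚ.+ ℚ.∣ d ℚ.* (a ℚ.- c) ∣       ≡⟨ cong₂ ℚ._+_ (ℚ.∣p*q∣≡∣p∣*∣q∣ a (b ℚ.- d)) (ℚ.∣p*q∣≡∣p∣*∣q∣ d (a ℚ.- c)) ⟩
    ℚ.∣ a ∣ ℚ.* ℚ.∣ b ℚ.- d ∣ ℚ.+ ℚ.∣ d ∣ ℚ.* ℚ.∣ a ℚ.- c ∣ ≤⟨ ℚ.+-mono-≤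
      (ℚ.*-monoʳ-≤-nonNeg ℚ.∣ b ℚ.- d ∣ {{ℚ.∣-∣-nonNeg (b ℚ.- d)}} a≤A)
      (ℚ.*-monoʳ-≤-nonNeg ℚ.∣ a ℚ.- c ∣ {{ℚ.∣-∣-nonNeg (a ℚ.- c)}} d≤B) ⟩
    A ℚ.* ℚ.∣ b ℚ.- d ∣ ℚ.+ B ℚ.* ℚ.∣ a ℚ.- c ∣           <⟨ ℚ.+-mono-< (ℚ.*-monoʳ-<-pos A q) (ℚ.*-monoʳ-<-pos B p) ⟩
    A ℚ.* δ ℚ.+ B ℚ.* δ                                   ≡⟨ ℚ.*-distribʳ-+ δ A B ⟨
    (A ℚ.+ B) ℚ.* δ                                       ∎
    where
    open ℚ.≤-Reasoning
    rearrange : ∀ a b c d → a ℚ.* b ℚ.- c ℚ.* d ≡ a ℚ.* (b ℚ.- d) ℚ.+ d ℚ.* (a ℚ.- c)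
    rearrange = solve 4 (λ a b c d → a :* b :- c :* d := a :* (b :- d) :+ d :* (a :- c)) refl
      where open +-*-Solver

  divide : ∀ C {ε} → ℚ.Positive C → 0ℚ ℚ.< ε → ∃ λ δ → 0ℚ ℚ.< δ × C ℚ.* δ ≡ ε
  divide C {ε} C>0 0<ε =
    r ℚ.* ε ,
    subst (ℚ._< r ℚ.* ε) (ℚ.*-zeroʳ r) (ℚ.*-monoʳ-<-pos r {{ℚ.1/pos⇒pos C {{C>0}}}} 0<ε) ,
    trans (sym (ℚ.*-assoc C r ε)) (trans (cong (ℚ._* ε) (ℚ.*-inverseʳ C {{C≢0}})) (ℚ.*-identityˡ ε))
    where
    C≢0 : ℚ.NonZero C
    C≢0 = ℚ.pos⇒nonZero C {{C>0}}
    r = (ℚ.1/ C) {{C≢0}}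

infixl 6 _+ᴿ_ _-ᴿ_
infixl 7 _*ᴿ_
infixr 8 _^ᴿ_
infix  9 -ᴿ_

_+ᴿ_ : ℝ → ℝ → ℝ
(x +ᴿ y) .approx k = approx x k ℚ.+ approx y k
(x +ᴿ y) .ℝ.cauchy ε 0<ε =
  let N , h = common x y (0<½* 0<ε) (0<½* 0<ε)
  in N , λ {j} {k} p q →
    +-close (approx x j) (approx y j) (approx x k) (approx y k) (proj₁ (h p q)) (proj₂ (h p q))

-ᴿ_ : ℝ → ℝ
(-ᴿ y) .approx k = ℚ.- approx y k
(-ᴿ y) .ℝ.cauchy ε 0<ε =
  let N , h = ℝ.cauchy y ε 0<ε
  in N , λ {j} {k} p q → neg-close (approx y j) (approx y k) (h p q)

_-ᴿ_ : ℝ → ℝ → ℝ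
x -ᴿ y = x +ᴿ (-ᴿ y)

_*ᴿ_ : ℝ → ℝ → ℝ
(x *ᴿ y) .approx k = approx x k ℚ.* approx y k
(x *ᴿ y) .ℝ.cauchy ε 0<ε =
  let A , A>0 , M₁ , x≤A = eventually-bounded x
      B , B>0 , M₂ , y≤B = eventually-bounded y
      A+B>0 = ℚ.positive (ℚ.+-mono-< (ℚ.positive⁻¹ A {{A>0}}) (ℚ.positive⁻¹ B {{B>0}}))
      δ , 0<δ , eq = divide (A ℚ.+ B) A+B>0 0<ε
      M₃ , close = common x y 0<δ 0<δ
      M  = M₂ ℕ.⊔ M₃
      ≤M = λ {k} (p : M₁ ℕ.⊔ M ℕ.≤ k) → ℕ.≤-trans (ℕ.m≤n⊔m M₁ M) p
      ≤M₃ = λ {k} (p : M₁ ℕ.⊔ M ℕ.≤ k) → ℕ.≤-trans (ℕ.m≤n⊔m M₂ M₃) (≤M p)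
  in M₁ ℕ.⊔ M , λ {j} {k} p q →
    subst (ℚ.∣ approx x j ℚ.* approx y j ℚ.- approx x k ℚ.* approx y k ∣ ℚ.<_) eq
      (*-close (approx x j) (approx y j) (approx x k) (approx y k) {{A>0}} {{B>0}}
        (x≤A (ℕ.≤-trans (ℕ.m≤m⊔n M₁ M) p))
        (y≤B (ℕ.≤-trans (ℕ.m≤m⊔n M₂ M₃) (≤M q)))
        (proj₁ (close (≤M₃ p) (≤M₃ q)))
        (proj₂ (close (≤M₃ p) (≤M₃ q))))

_^ᴿ_ : ℝ → ℕ → ℝ
x ^ᴿ zero  = 1ᴿ
x ^ᴿ suc k = x *ᴿ x ^ᴿ k

fromℕ : ℕ → ℝ
fromℕ k = fromℚ (+ k ℚ./ 1)

sumᴿ : List ℝ → ℝ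
sumᴿ = foldr _+ᴿ_ 0ᴿ

[0,1] : Set
[0,1] = ∃ λ x → 0ᴿ ≤ᴿ x × x ≤ᴿ 1ᴿ

infix 4 _⟶_

_⟶_ : (ℕ → ℝ) → ℝ → Set
x ⟶ L = ∀ ε → 0ℚ ℚ.< ε →
  ∃ λ N → ∀ n → N ℕ.≤ n → (L <ᴿ x n +ᴿ fromℚ ε) × (x n <ᴿ L +ᴿ fromℚ ε)

------------------------------------------------------------------------
-- Extended reals, as Dedekind cuts
--
-- log 0 = -∞ and a lower limit may be infinite, so these values are given by
-- their cuts: a lower cut is the set of rationals strictly below the value
-- (-∞ is the empty cut), an upper cut the set of rationals strictly above it.

LowerCut UpperCut : Set₁
LowerCut = Pred ℚ 0ℓ
UpperCut = Pred ℚ 0ℓ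

-- For n ≥ 2, a/b < log_n x means n^(a/b) < x, that is n^a < x^b (x ≥ 0, b > 0).
-- A negative power of n is moved to the right-hand side.
log : ℕ → [0,1] → LowerCut
log n (x , _) q with ↥ q
... | + a      = fromℕ (n ℕ.^ a) <ᴿ x ^ᴿ ↧ₙ q
... | -[1+ a ] = 1ᴿ <ᴿ x ^ᴿ ↧ₙ q *ᴿ fromℕ (n ℕ.^ suc a)

sup : (ℕ → LowerCut) → LowerCut
sup x q = ∃ λ N → x N q

-- The strict inequality q < r makes the cut open: a bound q with q < x n for all n
-- may still equal the infimum.
inf≥ : ℕ → (ℕ → LowerCut) → LowerCut
inf≥ N x q = ∃ λ r → q ℚ.< r × (∀ n → N ℕ.≤ n → x n r)

liminf : (ℕ → LowerCut) → LowerCut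
liminf x = sup (λ N → inf≥ N x)

negate : LowerCut → UpperCut
negate L q = L (ℚ.- q)

infix 4 _<ᵁ_

_<ᵁ_ : UpperCut → ℚ → Set
U <ᵁ q = U q

Middling : (e : ℕ) .{{_ : ℕ.NonZero e}} → (ℕ → [0,1]) → Set
Middling e p =
  (negate (liminf (λ n → log n (p n))) <ᵁ + 1 ℚ./ e) × ((λ n → proj₁ (p n)) ⟶ 0ᴿ)

------------------------------------------------------------------------
-- Graphs

elements : Subset n → List (Fin n)
elements {n} σ = filter (_∈? σ) (allFin n)

subsets : ∀ n → List (Subset n)
subsets zero    = [] ∷ []
subsets (suc n) = map (inside ∷_) (subsets n) ++ map (outside ∷_) (subsets n)

-- The vertex set is a subset of Fin n, so that the class of graphs is closed
-- under passing to induced subgraphs.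
record Graph (n : ℕ) : Set₁ where
  infix 4 _~_ _~?_
  field
    V        : Subset n
    _~_      : Rel (Fin n) 0ℓ
    _~?_     : Binary.Decidable _~_
    ~-sym    : ∀ {u v} → u ~ v → v ~ u
    ~-irrefl : ∀ {u} → ¬ u ~ u
    ~⇒∈V     : ∀ {u v} → u ~ v → u ∈ V

open Graph public using (V)

infixl 6 _-ᴳ_

_-ᴳ_ : Graph n → Subset n → Graph n
Γ -ᴳ C = record
  { V        = W
  ; _~_      = λ u v → u ~ v × u ∈ W × v ∈ W
  ; _~?_     = λ u v → (u ~? v) ×-dec (u ∈? W) ×-dec (v ∈? W)
  ; ~-sym    = λ (u~v , u∈W , v∈W) → ~-sym u~v , v∈W , u∈W
  ; ~-irrefl = λ (u~u , _) → ~-irrefl u~u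
  ; ~⇒∈V     = λ (_ , u∈W , _) → u∈W
  }
  where
  open Graph Γ hiding (V)
  W = V Γ ─ C

neighbours : Graph n → Fin n → Subset n
neighbours Γ v = tabulate (λ u → does (Graph._~?_ Γ v u))

commonNeighbours : Graph n → Subset n → Subset n
commonNeighbours Γ I = ⋂ (map (neighbours Γ) (elements I))

------------------------------------------------------------------------
-- Simplicial complexes and reduced cohomology

-- Faces include the empty one; an i-simplex is a face with i + 1 elements.
record SimplicialComplex (n : ℕ) : Set₁ where
  field
    Face   : Pred (Subset n) 0ℓ
    Face?  : Decidable Face
    face-∅ : Face ∅
    face-⊆ : ∀ {σ τ} → τ ⊆ σ → Face σ → Face τ

  Simplex : ℕ → Pred (Subset n) 0ℓ
  Simplex i σ = Face σ × ∣ σ ∣ ≡ suc i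

  Simplex? : ∀ i → Decidable (Simplex i)
  Simplex? i σ = Face? σ ×-dec (∣ σ ∣ ℕ.≟ suc i)

Cl : Graph n → SimplicialComplex n
Cl {n} Γ = record
  { Face   = λ σ → σ ⊆ V Γ × (∀ u v → u ∈ σ → v ∈ σ → u ≢ v → u ~ v)
  ; Face?  = λ σ → (σ ⊆? V Γ) ×-dec
      Fin.all? (λ u → Fin.all? (λ v →
        (u ∈? σ) →-dec ((v ∈? σ) →-dec (¬? (u Fin.≟ v) →-dec (u ~? v)))))
  ; face-∅ = (λ v∈∅ → ⊥-elim (∉⊥ v∈∅)) , λ _ _ u∈∅ → ⊥-elim (∉⊥ u∈∅)
  ; face-⊆ = λ τ⊆σ (σ⊆V , adj) →
      (λ v∈τ → σ⊆V (τ⊆σ v∈τ)) , λ u v u∈τ v∈τ → adj u v (τ⊆σ u∈τ) (τ⊆σ v∈τ)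
  }
  where open Graph Γ hiding (V)

module Cohomology {c ℓ} (K : CommutativeRing c ℓ) (X : SimplicialComplex n) where
  open CommutativeRing K
  open SimplicialComplex X

  -- An i-cochain is a function on i-simplices. It is given as a function on all
  -- subsets of which only the values on i-simplices are ever used; for i = -1
  -- this is the value on the empty face.
  Cochain : Set c
  Cochain = Subset n → Carrier

  -- The right-nested difference x₀ - (x₁ - (x₂ - …)) is Σⱼ (-1)ʲ xⱼ, and elements
  -- lists the vertices of σ in increasing order.
  d : Cochain → Cochain
  d f σ = foldr _-_ 0# (map (λ v → f (σ ∸ˢ v)) (elements σ))

  Cocycle : ℕ → Cochain → Set ℓ
  Cocycle i z = ∀ σ → Simplex (suc i) σ → d z σ ≈ 0#

  Cohomologous : ℕ → Cochain → Cochain → Set (c ⊔ ℓ)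
  Cohomologous i z w = ∃ λ (g : Cochain) → ∀ σ → Simplex i σ → z σ - w σ ≈ d g σ

  H̃≢0 : ℕ → Set (c ⊔ ℓ)
  H̃≢0 i = ∃ λ z → Cocycle i z × ¬ Cohomologous i z (λ _ → 0#)

H̃[_,_]≢0 : ∀ {c ℓ} → ℕ → CommutativeRing c ℓ → SimplicialComplex n → Set (c ⊔ ℓ)
H̃[ i , K ]≢0 X = Cohomology.H̃≢0 K X i

𝔽₂ : CommutativeRing 0ℓ 0ℓ
𝔽₂ = Bool.xor-∧-commutativeRing

private
  allSubset? : {P : Pred (Subset n) 0ℓ} → Decidable P → Dec (∀ σ → P σ)
  allSubset? P? = map′
    (λ ¬∃ σ → decidable-stable (P? σ) (λ ¬p → ¬∃ (σ , ¬p)))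
    (λ ∀p (σ , ¬p) → ¬p (∀p σ))
    (¬? (anySubset? (λ σ → ¬? (P? σ))))

  glue : (Subset n → Bool) → (Subset n → Bool) → Subset (suc n) → Bool
  glue f g (true  ∷ σ) = f σ
  glue f g (false ∷ σ) = g σ

  glue-cong : ∀ {f f′ g g′ : Subset n → Bool} → f ≗ f′ → g ≗ g′ → glue f g ≗ glue f′ g′
  glue-cong f≗f′ g≗g′ (true  ∷ σ) = f≗f′ σ
  glue-cong f≗f′ g≗g′ (false ∷ σ) = g≗g′ σ

  anyFunction? : {P : (Subset n → Bool) → Set} →
                 (∀ {f g} → f ≗ g → P f → P g) → Decidable P → Dec (∃ P)
  anyFunction? {zero} {P} resp P? = map′
    [ _ ,_ , _ ,_ ]′
    (λ (f , pf) → constant (f []) (resp (λ { [] → refl }) pf))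
    (P? (λ _ → true) ⊎-dec P? (λ _ → false))
    where
    constant : ∀ b → P (λ _ → b) → P (λ _ → true) ⊎ P (λ _ → false)
    constant true  = Sum.inj₁
    constant false = Sum.inj₂
  anyFunction? {suc n} resp P? = map′
    (λ (f , g , p) → glue f g , p)
    (λ (h , p) → h ∘ (true ∷_) , h ∘ (false ∷_) , resp (λ { (true ∷ _) → refl ; (false ∷ _) → refl }) p)
    (anyFunction?
      (λ f≗f′ (g , p) → g , resp (glue-cong f≗f′ (λ _ → refl)) p)
      (λ f → anyFunction? (λ g≗g′ → resp (glue-cong {f = f} (λ _ → refl) g≗g′)) (λ g → P? (glue f g))))

H̃[_,𝔽₂]≢0? : ∀ i (X : SimplicialComplex n) → Dec (H̃[ i , 𝔽₂ ]≢0 X)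
H̃[_,𝔽₂]≢0? {n} i X = anyFunction?
  (λ z≗w (cocycle , ¬∼0) →
    (λ σ s → trans (sym (d-cong z≗w σ)) (cocycle σ s)) ,
    (λ (g , h) → ¬∼0 (g , λ σ s → trans (cong (_- false) (z≗w σ)) (h σ s))))
  (λ z →
    allSubset? (λ σ → Simplex? (suc i) σ →-dec (d z σ Bool.≟ false)) ×-dec
    ¬? (anyFunction?
      (λ g≗h eq σ s → trans (eq σ s) (d-cong g≗h σ))
      (λ g → allSubset? (λ σ → Simplex? i σ →-dec ((z σ - false) Bool.≟ d g σ)))))
  where
  open CommutativeRing 𝔽₂ using (_-_)
  open Cohomology 𝔽₂ X
  open SimplicialComplex X
  d-cong : ∀ {f g : Subset n → Bool} → f ≗ g → d f ≗ d g
  d-cong f≗g σ = cong (foldr _-_ false) (map-cong (λ v → f≗g (σ ∸ˢ v)) (elements σ))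

------------------------------------------------------------------------
-- The invariants κ and δ, with values in ℕ ∪ {∞}

min : List ℕ → ℕ ⁺
min = foldr cons ⊤⁺
  where
  cons : ℕ → ℕ ⁺ → ℕ ⁺
  cons k [ m ] = [ k ℕ.⊓ m ]
  cons k ⊤⁺    = [ k ]

-- Computing the minimum requires deciding the vanishing of cohomology over K.
κ : ∀ {c ℓ} (i : ℕ) (K : CommutativeRing c ℓ) →
    (∀ (X : SimplicialComplex n) → Dec (H̃[ i , K ]≢0 X)) → Graph n → ℕ ⁺
κ {n} i K ≢0? Γ =
  min (map ∣_∣ (filter (λ C → (C ⊆? V Γ) ×-dec ≢0? (Cl (Γ -ᴳ C))) (subsets n)))

κ[_,𝔽₂] : ℕ → Graph n → ℕ ⁺
κ[ i ,𝔽₂] = κ i 𝔽₂ H̃[ i ,𝔽₂]≢0?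

δ[_] : ℕ → Graph n → ℕ ⁺
δ[_] {n} i Γ =
  min (map (λ I → ∣ commonNeighbours Γ I ∣) (filter (SimplicialComplex.Simplex? (Cl Γ) i) (subsets n)))

_≟⁺_ : Binary.DecidableEquality (ℕ ⁺)
_≟⁺_ = ≡-dec ℕ._≟_

------------------------------------------------------------------------
-- Random graphs

sublists : ∀ {a} {A : Set a} → List A → List (List A)
sublists []       = [] ∷ []
sublists (x ∷ xs) = map (x ∷_) (sublists xs) ++ sublists xs

possibleEdges : ∀ n → List (Fin n × Fin n)
possibleEdges n = filter (λ (u , v) → u Fin.<? v) (cartesianProduct (allFin n) (allFin n))

graph : List (Fin n × Fin n) → Graph n
graph {n} E = record
  { V        = full
  ; _~_      = λ u v → u ≢ v × ((u , v) ∈ˡ E ⊎ (v , u) ∈ˡ E)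
  ; _~?_     = λ u v → ¬? (u Fin.≟ v) ×-dec (((u , v) ∈ˡ? E) ⊎-dec ((v , u) ∈ˡ? E))
  ; ~-sym    = λ (u≢v , uv∈E) → u≢v ∘ sym , Sum.swap uv∈E
  ; ~-irrefl = λ (u≢u , _) → u≢u refl
  ; ~⇒∈V     = λ _ → ∈⊤
  }
  where open DecMembership (×-≡-dec (Fin._≟_ {n}) (Fin._≟_ {n})) renaming (_∈?_ to _∈ˡ?_)

-- The outcomes are the edge sets E ⊆ possibleEdges n, and E has probability
-- p^|E| (1 - p)^(C(n,2) - |E|).
ℙ : ∀ n → [0,1] → {A : Pred (Graph n) 0ℓ} → Decidable A → ℝ
ℙ n (p , _) A? = sumᴿ (map weight (filter (λ E → A? (graph E)) (sublists (possibleEdges n))))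
  where
  weight : List (Fin n × Fin n) → ℝ
  weight E = p ^ᴿ length E *ᴿ (1ᴿ -ᴿ p) ^ᴿ (length (possibleEdges n) ℕ.∸ length E)

{-# OPTIONS --safe #-}

-- With probability tending to 1 the random graph satisfies: any two t-sets of vertices meet or are
-- joined by an edge; any two vertices have at least m common neighbours, up to constants the expected
-- number; three vertices have at most m/4; and degrees are small compared with n. Each failure
-- probability is bounded by an expectation E[∏ (1 + c X…X)] of a function that is affine in every edge
-- indicator, hence is evaluated by substituting p for all indicators.
--
-- These properties imply κ = δ. For an edge ab, deleting C = N(a,b) leaves ab in no triangle, so its
-- indicator is a cocycle; it is not a coboundary because some path a, u, v, b avoids C. Conversely let
-- |C| < δ and let z be a cocycle of Γ - C. Double counting gives a vertex b outside C with at most m/2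
-- neighbours in C. Let g(v) be a value attained by z(bw) + z(wv) for at least m/4 common neighbours
-- w ∉ C of b and v. If u ~ v keep at least m/4 common neighbours outside C, there are such w ∈ N(u,v),
-- x ∈ N(b,u), y ∈ N(b,v) forming a triangle, with x and y in the classes defining g(u) and g(v), and
-- filling the pentagon b x u v y gives z(uv) = g(u) + g(v). At most one edge keeps fewer common
-- neighbours; it still keeps one, w, and is handled by way of uw and wv.

module Submission where

open import Defs
open import Algebra.Bundles using (CommutativeRing)
open import Data.Bool using (Bool; true; false; if_then_else_)
open import Data.Empty using (⊥)
open import Data.Fin as Fin using (Fin; zero; suc)
import Data.Fin.Properties as Fin
open import Data.Fin.Subset.Properties using (∈⊤)
open import Data.Integer as ℤ using (-[1+_])
import Data.Integer.Properties as ℤ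
open import Data.List using (List; []; _∷_; _++_; map; filter; foldr; length; allFin; cartesianProduct; cartesianProductWith)
open import Data.List.Properties using (map-++; map-∘; length-++; length-map; length-filter; filter-all)
import Data.List.Membership.DecPropositional as DecMembership
open import Data.List.Membership.Propositional using (find; lose) renaming (_∈_ to _∈ˡ_; _∉_ to _∉ˡ_)
open import Data.List.Membership.Propositional.Properties
  using (∈-allFin; ∈-filter⁺; ∈-filter⁻; ∈-cartesianProduct⁺; ∈-cartesianProductWith⁺)
open import Data.List.Relation.Unary.All as All using (All; []; _∷_)
import Data.List.Relation.Unary.All.Properties as All
open import Data.List.Relation.Unary.AllPairs using (allPairs?)
open import Data.List.Relation.Unary.Any as Any using (Any; here; there)
open import Data.List.Relation.Unary.Unique.Propositional using (Unique; []; _∷_)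
import Data.List.Relation.Unary.Unique.Propositional.Properties as Unique
open import Data.Nat as ℕ using (ℕ; zero; suc; z≤n; s≤s)
import Data.Nat.DivMod as ℕ
import Data.Nat.Properties as ℕ
import Data.Nat.Solver as ℕ
open import Data.Product using (_×_; _,_; ∃; ∃₂; proj₁; proj₂)
open import Data.Product.Properties using () renaming (≡-dec to ×-≡-dec)
import Data.Rational.Unnormalised as ℚᵘ
import Data.Rational.Unnormalised.Properties as ℚᵘ
open import Data.Sum using (_⊎_; inj₁; inj₂; [_,_]′)
open import Data.Unit using (⊤; tt)
open import Function using (_∘_; id)
open import Level using (0ℓ)
open import Relation.Binary.PropositionalEquality
open import Relation.Nullary using (¬_; Dec; yes; no; does; contradiction)
open import Relation.Nullary.Decidable using (_×-dec_; _⊎-dec_; ¬?; dec-true; dec-false; decidable-stable; from-yes)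
open import Relation.Unary using (Pred; Decidable)

-- Everything is proved for one `n` and one rational `x`: arithmetic on `ℝ` is termwise, so the
-- `i`-th approximation of the probability is a polynomial evaluated at the `i`-th approximation of
-- `p n`, and the resulting bounds do not depend on `i`. Density enters as `1 ≤ n x^10`. The scales
-- are natural numbers: `k` with `1/(4k) ≤ x ≤ 1/(2k)`, `l` with `n ≤ 2^l`, and `μ` of order `n/k²`.
-- The decisive requirement is that `m/4` exceeds `t² + 2t` for `t = 12kl`. Codegrees are controlled
-- only up to constant factors, although `κ = δ` is exact: a set `C` smaller than `δ` cannot spoil
-- two edges at a common vertex, because their common neighbourhoods overlap in at most `m/4`
-- vertices. Smallness of `x` gives this overlap bound and the sparsity that yields `b`. With
-- `c = 1` and `c = -1/2` the product test functions are `2^codegree` and `2^(-codegree)`,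
-- exponential moments that stay rational; Bernoulli's inequality takes the place of estimates for
-- the exponential function.

module Combinatorics where
  open import Data.Bool using (_xor_)
  import Data.Bool.Properties as Bool
  open import Data.Bool.Solver using (module xor-∧-Solver)
  open import Data.Fin.Subset using (Subset; _∈_; _∉_; _⊆_; _─_; _∪_; ⋂; ⁅_⁆; ∣_∣) renaming (_-_ to _∸ˢ_)
  open import Data.Fin.Subset.Properties hiding (∈⊤)
  open import Data.List using (take; tabulate)
  open import Data.List.Properties using (length-take; length-tabulate; filter-none; map-tabulate)
  open import Data.List.Membership.Propositional.Properties using (∈-map⁺; ∈-map⁻; ∈-++⁺ˡ; ∈-++⁺ʳ)
  open import Data.Nat hiding (zero; suc)
  open import Data.Nat.ListAction using (sum)
  open import Data.Nat.Properties
  open import Data.Nat.Solver using (module +-*-Solver)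
  import Data.Vec as Vec
  import Data.Vec.Properties as Vec
  open import Relation.Nullary.Construct.Add.Supremum using ([_])

  private
    variable
      n : ℕ
      A B : Set

  module Counting where
    open ≤-Reasoning

    -- Counting with decidable predicates.

    count : {P : Pred A 0ℓ} → Decidable P → List A → ℕ
    count P? xs = length (filter P? xs)

    # : {P : Pred (Fin n) 0ℓ} → Decidable P → ℕ
    # {n} P? = count P? (allFin n)

    count-mono : {P Q : Pred A 0ℓ} → (P? : Decidable P) (Q? : Decidable Q) → (∀ {x} → P x → Q x) →
                 ∀ xs → count P? xs ≤ count Q? xs
    count-mono P? Q? P⊆Q [] = z≤n
    count-mono P? Q? P⊆Q (x ∷ xs) with P? x | Q? x
    ... | yes p | yes q = s≤s (count-mono P? Q? P⊆Q xs)
    ... | yes p | no ¬q = contradiction (P⊆Q p) ¬q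
    ... | no ¬p | yes q = m≤n⇒m≤1+n (count-mono P? Q? P⊆Q xs)
    ... | no ¬p | no ¬q = count-mono P? Q? P⊆Q xs

    count-cover : {P Q R : Pred A 0ℓ} → (P? : Decidable P) (Q? : Decidable Q) (R? : Decidable R) →
                  (∀ {x} → P x → Q x ⊎ R x) →
                  ∀ xs → count P? xs ≤ count Q? xs + count R? xs
    count-cover P? Q? R? cover [] = z≤n
    count-cover P? Q? R? cover (x ∷ xs) with ih ← count-cover P? Q? R? cover xs | P? x | Q? x | R? x
    ... | yes p | yes q | yes r = s≤s (≤-trans ih (+-monoʳ-≤ _ (n≤1+n _)))
    ... | yes p | yes q | no ¬r = s≤s ih
    ... | yes p | no ¬q | yes r = ≤-trans (s≤s ih) (≤-reflexive (sym (+-suc _ _)))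
    ... | no ¬p | yes q | yes r = m≤n⇒m≤1+n (≤-trans ih (+-monoʳ-≤ _ (n≤1+n _)))
    ... | no ¬p | yes q | no ¬r = m≤n⇒m≤1+n ih
    ... | no ¬p | no ¬q | yes r = ≤-trans ih (+-monoʳ-≤ _ (n≤1+n _))
    ... | no ¬p | no ¬q | no ¬r = ih
    ... | yes p | no ¬q | no ¬r with cover p
    ...   | inj₁ q = contradiction q ¬q
    ...   | inj₂ r = contradiction r ¬r

    -- Inclusion-exclusion as an inequality: the union is enlarged to `R`, the intersection to `S`.
    -- It is applied with `C` as `R` and the common neighbourhood of three vertices as `S`.
    count-overlap : {P Q R S : Pred A 0ℓ} → (P? : Decidable P) (Q? : Decidable Q) (R? : Decidable R) (S? : Decidable S) →
                    (∀ {x} → P x → R x) → (∀ {x} → Q x → R x) → (∀ {x} → P x → Q x → S x) →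
                    ∀ xs → count P? xs + count Q? xs ≤ count R? xs + count S? xs
    count-overlap P? Q? R? S? P⊆R Q⊆R P∩Q⊆S [] = z≤n
    count-overlap P? Q? R? S? P⊆R Q⊆R P∩Q⊆S (x ∷ xs)
      with ih ← count-overlap P? Q? R? S? P⊆R Q⊆R P∩Q⊆S xs | P? x | Q? x | R? x | S? x
    ... | yes p | _     | no ¬r | _     = contradiction (P⊆R p) ¬r
    ... | no ¬p | yes q | no ¬r | _     = contradiction (Q⊆R q) ¬r
    ... | yes p | yes q | yes r | no ¬s = contradiction (P∩Q⊆S p q) ¬s
    ... | yes p | yes q | yes r | yes s = s≤s (subst₂ _≤_ (sym (+-suc _ _)) (sym (+-suc _ _)) (s≤s ih))
    ... | yes p | no ¬q | yes r | yes s = s≤s (≤-trans ih (+-monoʳ-≤ _ (n≤1+n _)))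
    ... | yes p | no ¬q | yes r | no ¬s = s≤s ih
    ... | no ¬p | yes q | yes r | yes s = ≤-trans (≤-reflexive (+-suc _ _)) (s≤s (≤-trans ih (+-monoʳ-≤ _ (n≤1+n _))))
    ... | no ¬p | yes q | yes r | no ¬s = ≤-trans (≤-reflexive (+-suc _ _)) (s≤s ih)
    ... | no ¬p | no ¬q | yes r | yes s = m≤n⇒m≤1+n (≤-trans ih (+-monoʳ-≤ _ (n≤1+n _)))
    ... | no ¬p | no ¬q | yes r | no ¬s = m≤n⇒m≤1+n ih
    ... | no ¬p | no ¬q | no ¬r | yes s = ≤-trans ih (+-monoʳ-≤ _ (n≤1+n _))
    ... | no ¬p | no ¬q | no ¬r | no ¬s = ih

    count>0⇒∃ : {P : Pred A 0ℓ} → (P? : Decidable P) → ∀ xs → 0 < count P? xs → ∃ P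
    count>0⇒∃ P? (x ∷ xs) 0<c with P? x
    ... | yes p = x , p
    ... | no ¬p = count>0⇒∃ P? xs 0<c

    Σ[_] : List A → (A → ℕ) → ℕ
    Σ[ xs ] f = sum (map f xs)

    Σ-zero : ∀ (xs : List A) → Σ[ xs ] (λ _ → 0) ≡ 0
    Σ-zero []       = refl
    Σ-zero (x ∷ xs) = Σ-zero xs

    Σ-+ : ∀ (f g : A → ℕ) xs → Σ[ xs ] f + Σ[ xs ] g ≡ Σ[ xs ] (λ x → f x + g x)
    Σ-+ f g []       = refl
    Σ-+ f g (x ∷ xs) = begin-equality
      f x + Σ[ xs ] f + (g x + Σ[ xs ] g)   ≡⟨ solve 4 (λ a b c d → a :+ b :+ (c :+ d) := (a :+ c) :+ (b :+ d)) refl (f x) (Σ[ xs ] f) (g x) (Σ[ xs ] g) ⟩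
      f x + g x + (Σ[ xs ] f + Σ[ xs ] g)   ≡⟨ cong (f x + g x +_) (Σ-+ f g xs) ⟩
      f x + g x + Σ[ xs ] (λ x → f x + g x) ∎
      where open +-*-Solver

    -- Both sides count the pairs related by `R`; this exchanges the roles of `C` and its complement
    -- when edges between them are counted.
    count-swap : {R : A → B → Set} (R? : ∀ a b → Dec (R a b)) → ∀ xs ys →
                 Σ[ xs ] (λ x → count (R? x) ys) ≡ Σ[ ys ] (λ y → count (λ x → R? x y) xs)
    count-swap R? []       ys = sym (Σ-zero ys)
    count-swap R? (x ∷ xs) ys = begin-equality
      count (R? x) ys + Σ[ xs ] (λ x → count (R? x) ys)                           ≡⟨ cong (count (R? x) ys +_) (count-swap R? xs ys) ⟩
      count (R? x) ys + Σ[ ys ] (λ y → count (λ x → R? x y) xs)                   ≡⟨ cong (_+ Σ[ ys ] (λ y → count (λ x → R? x y) xs)) (indicators ys) ⟩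
      Σ[ ys ] (λ y → count (λ x → R? x y) (x ∷ [])) + Σ[ ys ] (λ y → count (λ x → R? x y) xs) ≡⟨ Σ-+ _ _ ys ⟩
      Σ[ ys ] (λ y → count (λ x → R? x y) (x ∷ []) + count (λ x → R? x y) xs)     ≡⟨ consΣ ys ⟩
      Σ[ ys ] (λ y → count (λ x → R? x y) (x ∷ xs))                               ∎
      where
      indicators : ∀ ys → count (R? x) ys ≡ Σ[ ys ] (λ y → count (λ x → R? x y) (x ∷ []))
      indicators [] = refl
      indicators (y ∷ ys) with R? x y
      ... | yes _ = cong suc (indicators ys)
      ... | no _  = indicators ys
      cons : ∀ y → count (λ x → R? x y) (x ∷ []) + count (λ x → R? x y) xs ≡ count (λ x → R? x y) (x ∷ xs)
      cons y with R? x y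
      ... | yes _ = refl
      ... | no _  = refl
      consΣ : ∀ ys → Σ[ ys ] (λ y → count (λ x → R? x y) (x ∷ []) + count (λ x → R? x y) xs) ≡ Σ[ ys ] (λ y → count (λ x → R? x y) (x ∷ xs))
      consΣ []       = refl
      consΣ (y ∷ ys) = cong₂ _+_ (cons y) (consΣ ys)

    Σ-upper : {P : Pred A 0ℓ} → (P? : Decidable P) (f : A → ℕ) (k : ℕ) → (∀ {x} → P x → f x ≤ k) → (∀ {x} → ¬ P x → f x ≡ 0) →
              ∀ xs → Σ[ xs ] f ≤ count P? xs * k
    Σ-upper P? f k f≤k f≡0 [] = z≤n
    Σ-upper P? f k f≤k f≡0 (x ∷ xs) with P? x
    ... | yes p = +-mono-≤ (f≤k p) (Σ-upper P? f k f≤k f≡0 xs)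
    ... | no ¬p = subst (λ a → a + Σ[ xs ] f ≤ count P? xs * k) (sym (f≡0 ¬p)) (Σ-upper P? f k f≤k f≡0 xs)

    Σ-lower : {P : Pred A 0ℓ} → (P? : Decidable P) (f : A → ℕ) (k : ℕ) → (∀ {x} → P x → k ≤ f x) →
              ∀ xs → count P? xs * k ≤ Σ[ filter P? xs ] f
    Σ-lower P? f k k≤f [] = z≤n
    Σ-lower P? f k k≤f (x ∷ xs) with P? x
    ... | yes p = +-mono-≤ (k≤f p) (Σ-lower P? f k k≤f xs)
    ... | no ¬p = Σ-lower P? f k k≤f xs

    count-filter : {P Q : Pred A 0ℓ} → (P? : Decidable P) (Q? : Decidable Q) → (∀ {x} → P x → Q x) →
                   ∀ xs → count P? (filter Q? xs) ≡ count P? xs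
    count-filter P? Q? P⊆Q [] = refl
    count-filter P? Q? P⊆Q (x ∷ xs) with Q? x
    ... | yes q with P? x
    ...   | yes p = cong suc (count-filter P? Q? P⊆Q xs)
    ...   | no ¬p = count-filter P? Q? P⊆Q xs
    count-filter P? Q? P⊆Q (x ∷ xs) | no ¬q with P? x
    ...   | yes p = contradiction (P⊆Q p) ¬q
    ...   | no ¬p = count-filter P? Q? P⊆Q xs

    count-sublist : {P Q : Pred A 0ℓ} → (P? : Decidable P) (Q? : Decidable Q) → ∀ xs → count P? (filter Q? xs) ≤ count P? xs
    count-sublist P? Q? [] = z≤n
    count-sublist P? Q? (x ∷ xs) with Q? x
    ... | yes q with P? x
    ...   | yes p = s≤s (count-sublist P? Q? xs)
    ...   | no ¬p = count-sublist P? Q? xs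
    count-sublist P? Q? (x ∷ xs) | no ¬q with P? x
    ...   | yes p = m≤n⇒m≤1+n (count-sublist P? Q? xs)
    ...   | no ¬p = count-sublist P? Q? xs

    count-none : {P : Pred A 0ℓ} (P? : Decidable P) → (∀ {x} → ¬ P x) → ∀ xs → count P? xs ≡ 0
    count-none P? ¬P xs = cong length (filter-none P? (All.universal (λ _ → ¬P) xs))

    count-Any : {R : A → B → Set} (R? : ∀ a b → Dec (R a b)) → ∀ as xs →
                count (λ x → Any.any? (λ a → R? a x) as) xs ≤ Σ[ as ] (λ a → count (R? a) xs)
    count-Any R? []       xs = ≤-reflexive (count-none (λ x → Any.any? (λ a → R? a x) []) (λ ()) xs)
    count-Any R? (a ∷ as) xs = ≤-trans
      (count-cover (λ x → Any.any? (λ a → R? a x) (a ∷ as)) (R? a) (λ x → Any.any? (λ a → R? a x) as)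
        (λ { (here r) → inj₁ r ; (there r) → inj₂ r }) xs)
      (+-monoʳ-≤ (count (R? a) xs) (count-Any R? as xs))

    Σ-≤ : ∀ (f : A → ℕ) {k as} → All (λ a → f a ≤ k) as → Σ[ as ] f ≤ length as * k
    Σ-≤ f []       = z≤n
    Σ-≤ f (p ∷ ps) = +-mono-≤ p (Σ-≤ f ps)

    count-≡ : ∀ (a : Fin n) {xs} → Unique xs → count (Fin._≟ a) xs ≤ 1
    count-≡ a [] = z≤n
    count-≡ a {x ∷ xs} (x∉xs ∷ uniq) with x Fin.≟ a
    ... | yes refl = s≤s (≤-reflexive (cong length (filter-none (Fin._≟ a) (All.map (_∘ sym) x∉xs))))
    ... | no _     = count-≡ a uniq

    length-allFin : ∀ n → length (allFin n) ≡ n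
    length-allFin n = length-tabulate {n = n} id

    -- Cohomology of a pseudorandom graph after a small deletion

    -- Overlapping lists are allowed and a shared vertex counts as joined, since the sets to which
    -- this is applied, such as the classes of two vertices, may intersect.
    Joined : Graph n → ℕ → Set
    Joined {n} Γ t = ∀ (as bs : List (Fin n)) → Unique as → Unique bs → length as ≡ t → length bs ≡ t →
                     ∃₂ λ a b → a ∈ˡ as × b ∈ˡ bs × (a ≡ b ⊎ Graph._~_ Γ a b)

    CommonNeighbour : Graph n → List (Fin n) → Pred (Fin n) 0ℓ
    CommonNeighbour Γ S w = All (λ s → Graph._~_ Γ s w) S

    CommonNeighbour? : (Γ : Graph n) (S : List (Fin n)) → Decidable (CommonNeighbour Γ S)
    CommonNeighbour? Γ S w = All.all? (λ s → Graph._~?_ Γ s w) S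

    -- One notion for lists of every length: the degree for a single vertex, also for `u ∷ u ∷ []`,
    -- and the number of common neighbours of two or three vertices.
    codegree : Graph n → List (Fin n) → ℕ
    codegree Γ S = # (CommonNeighbour? Γ S)

    -- `codeg≥` covers `u ≡ v`, where it bounds a degree from below: this provides an edge to start
    -- from, and it includes the base vertex among the `v` of `surviving-base`.
    record Pseudorandom (Γ : Graph n) (t m Δ M T : ℕ) : Set where
      field
        joined   : Joined Γ t
        codeg≥   : ∀ u v → m ≤ codegree Γ (u ∷ v ∷ [])
        deg≤     : ∀ u → codegree Γ (u ∷ []) ≤ Δ
        codeg≤   : ∀ u v → u ≢ v → codegree Γ (u ∷ v ∷ []) ≤ M
        tricodeg≤ : ∀ u v w → u ≢ v → u ≢ w → v ≢ w → codegree Γ (u ∷ v ∷ w ∷ []) ≤ T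

    module _ {Γ : Graph n} {t : ℕ} (joined : Joined Γ t) where
      open Graph Γ

      private
        module Choose {P : Pred (Fin n) 0ℓ} (P? : Decidable P) (t≤ : t ≤ # P?) where
          chosen : List (Fin n)
          chosen = take t (filter P? (allFin n))
          unique : Unique chosen
          unique = Unique.take⁺ t (Unique.filter⁺ P? (Unique.allFin⁺ n))
          size : length chosen ≡ t
          size = trans (length-take t (filter P? (allFin n))) (m≤n⇒m⊓n≡m t≤)
          satisfy : All P chosen
          satisfy = All.take⁺ t (All.all-filter P? (allFin n))

        open Choose

      joined-sets : ∀ {P Q : Pred (Fin n) 0ℓ} (P? : Decidable P) (Q? : Decidable Q) →
                    t ≤ # P? → t ≤ # Q? → ∃₂ λ a b → P a × Q b × (a ≡ b ⊎ a ~ b)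
      joined-sets P? Q? t≤P t≤Q =
        let a , b , a∈ , b∈ , r = joined (chosen P? t≤P) (chosen Q? t≤Q) (unique P? t≤P) (unique Q? t≤Q) (size P? t≤P) (size Q? t≤Q)
        in a , b , All.lookup (satisfy P? t≤P) a∈ , All.lookup (satisfy Q? t≤Q) b∈ , r

      module _ {X : Pred (Fin n) 0ℓ} (X? : Decidable X) (large : t * t + t ≤ # X?) where

        Poor : Pred (Fin n) 0ℓ
        Poor w = # (λ x → X? x ×-dec (w ~? x)) < t

        Poor? : Decidable Poor
        Poor? w = # (λ x → X? x ×-dec (w ~? x)) <? t

        -- Suppose there are `t` poor vertices. They and their neighbours inside `X` make up at most
        -- `t * t` vertices of `X`, so at least `t` vertices of `X` neither meet nor are joined to
        -- them, against `Joined`.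
        few-poor : # Poor? < t
        few-poor = ≰⇒> λ t≤ →
          let as = chosen Poor? t≤
              Y? = λ x → X? x ×-dec ¬? (Any.any? (near? x) as)
              t≤Y : t ≤ # Y?
              t≤Y = +-cancelˡ-≤ (t * t) t (# Y?) (begin
                t * t + t                                      ≤⟨ large ⟩
                # X?                                           ≤⟨ count-cover X? (λ x → Any.any? (near? x) as) Y? (split as) (allFin n) ⟩
                # (λ x → Any.any? (near? x) as) + # Y?         ≤⟨ +-monoˡ-≤ (# Y?) (count-Any (λ a x → near? x a) as (allFin n)) ⟩
                Σ[ as ] (λ a → # (λ x → near? x a)) + # Y?     ≤⟨ +-monoˡ-≤ (# Y?) (Σ-≤ (λ a → # (λ x → near? x a)) (All.map nearby (satisfy Poor? t≤))) ⟩
                length as * t + # Y?                           ≡⟨ cong (λ l → l * t + # Y?) (size Poor? t≤) ⟩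
                t * t + # Y?                                   ∎)
              a , b , a∈ , b∈ , r = joined as (chosen Y? t≤Y) (unique Poor? t≤) (unique Y? t≤Y) (size Poor? t≤) (size Y? t≤Y)
              Xb , ¬near = All.lookup (satisfy Y? t≤Y) b∈
          in ¬near (lose a∈ (near Xb r))
          where
          Near : Fin n → Fin n → Set
          Near x a = x ≡ a ⊎ (X x × a ~ x)
          near? : ∀ x a → Dec (Near x a)
          near? x a = (x Fin.≟ a) ⊎-dec (X? x ×-dec (a ~? x))
          near : ∀ {a b} → X b → a ≡ b ⊎ a ~ b → Near b a
          near Xb (inj₁ a≡b) = inj₁ (sym a≡b)
          near Xb (inj₂ a~b) = inj₂ (Xb , a~b)
          split : ∀ as {x} → X x → Any (Near x) as ⊎ (X x × ¬ Any (Near x) as)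
          split as {x} Xx with Any.any? (near? x) as
          ... | yes p = inj₁ p
          ... | no ¬p = inj₂ (Xx , ¬p)
          -- The strict inequality in `Poor` leaves room for `a` itself.
          nearby : ∀ {a} → Poor a → # (λ x → near? x a) ≤ t
          nearby {a} poor = begin
            # (λ x → near? x a)                                  ≤⟨ count-cover (λ x → near? x a) (Fin._≟ a) (λ x → X? x ×-dec (a ~? x)) id (allFin n) ⟩
            # (Fin._≟ a) + # (λ x → X? x ×-dec (a ~? x))         ≤⟨ +-monoˡ-≤ _ (count-≡ a (Unique.allFin⁺ n)) ⟩
            suc (# (λ x → X? x ×-dec (a ~? x)))                  ≤⟨ poor ⟩
            t                                                    ∎

      -- Fewer than `2t` vertices are poor for `X` or for `Y`, so some `w` in `A` has at least `t`
      -- neighbours in each, and these two neighbourhoods are joined. The outcome `x ≡ y` remains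
      -- possible because `X` and `Y` may intersect.
      transversal-triangle : ∀ {A X Y : Pred (Fin n) 0ℓ} (A? : Decidable A) (X? : Decidable X) (Y? : Decidable Y) →
        t + t ≤ # A? → t * t + t ≤ # X? → t * t + t ≤ # Y? →
        ∃ λ w → ∃₂ λ x y → A w × X x × Y y × w ~ x × w ~ y × (x ≡ y ⊎ x ~ y)
      transversal-triangle {A} {X} {Y} A? X? Y? 2t≤A X-large Y-large
        with Fin.any? (λ w → A? w ×-dec ¬? (Poor? X? X-large w) ×-dec ¬? (Poor? Y? Y-large w))
      ... | yes (w , Aw , richX , richY) =
        let x , y , (Xx , w~x) , (Yy , w~y) , r =
              joined-sets (λ x → X? x ×-dec (w ~? x)) (λ y → Y? y ×-dec (w ~? y)) (≮⇒≥ richX) (≮⇒≥ richY)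
        in w , x , y , Aw , Xx , Yy , w~x , w~y , r
      ... | no none = contradiction 2t≤A (<⇒≱ (begin-strict
        # A?                                       ≤⟨ count-cover A? (Poor? X? X-large) (Poor? Y? Y-large) poor (allFin n) ⟩
        # (Poor? X? X-large) + # (Poor? Y? Y-large) <⟨ +-mono-< (few-poor X? X-large) (few-poor Y? Y-large) ⟩
        t + t                                      ∎))
        where
        poor : ∀ {w} → A w → Poor X? X-large w ⊎ Poor Y? Y-large w
        poor {w} Aw with Poor? X? X-large w | Poor? Y? Y-large w
        ... | yes p | _     = inj₁ p
        ... | no _  | yes q = inj₂ q
        ... | no ¬p | no ¬q = contradiction (w , Aw , ¬p , ¬q) none

    private
      fill-triangle : ∀ uv xu bx {xv gu gv} → xv ≡ xu xor uv → bx xor xu ≡ gu → bx xor xv ≡ gv → uv ≡ gu xor gv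
      fill-triangle uv xu bx refl refl refl =
        solve 3 (λ uv xu bx → uv := (bx :+ xu) :+ (bx :+ (xu :+ uv))) refl uv xu bx
        where open xor-∧-Solver

      -- The sum of the triangles `uwv`, `xuw`, `wyv`, `xwy`, `bxy`: inner edges cancel over 𝔽₂ and
      -- the boundary pentagon remains.
      fill-pentagon : ∀ uw xu wy yv bx {uv wv xw xy by gu gv} → uv ≡ uw xor wv → xw ≡ xu xor uw → wv ≡ wy xor yv →
                      xy ≡ xw xor wy → by ≡ bx xor xy → bx xor xu ≡ gu → by xor yv ≡ gv → uv ≡ gu xor gv
      fill-pentagon uw xu wy yv bx refl refl refl refl refl refl refl =
        solve 5 (λ uw xu wy yv bx → uw :+ (wy :+ yv) := (bx :+ xu) :+ ((bx :+ ((xu :+ uw) :+ wy)) :+ yv)) refl uw xu wy yv bx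
        where open xor-∧-Solver

      concatenate : ∀ gu gv gw {uv uw wv} → uv ≡ uw xor wv → uw ≡ gu xor gw → wv ≡ gw xor gv → uv ≡ gu xor gv
      concatenate gu gv gw refl refl refl =
        solve 3 (λ gu gv gw → (gu :+ gw) :+ (gw :+ gv) := gu :+ gv) refl gu gv gw
        where open xor-∧-Solver

    -- `ζ` takes ordered pairs and its cocycle rule composes directed edges head to tail, which
    -- separates the combinatorics from simplices as subsets. `large` makes the classes big enough
    -- for `transversal-triangle`; `sparse` yields the base vertex.
    module Vanishing {Γ : Graph n} {t m Δ M T : ℕ} (R : Pseudorandom Γ t m Δ M T)
      (4T≤m : 4 * T ≤ m) (large : 4 * (t * t + (t + t)) ≤ m) (sparse : M * m + 2 * (M * Δ) < n * m)
      {C : Pred (Fin n) 0ℓ} (C? : Decidable C) (C≤M : # C? ≤ M)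
      (C< : ∀ u v → Graph._~_ Γ u v → # C? < codegree Γ (u ∷ v ∷ []))
      (ζ : Fin n → Fin n → Bool)
      (cocycle : ∀ u v w → ¬ C u → ¬ C v → ¬ C w → Graph._~_ Γ u v → Graph._~_ Γ v w → Graph._~_ Γ u w →
                 ζ u w ≡ ζ u v xor ζ v w)
      where
      open Graph Γ
      open Pseudorandom R

      private
        all : List (Fin n)
        all = allFin n

        ~⇒≢ : ∀ {u v} → u ~ v → u ≢ v
        ~⇒≢ u~v refl = ~-irrefl u~v

      Surviving? : ∀ S → Decidable (λ w → CommonNeighbour Γ S w × ¬ C w)
      Surviving? S w = CommonNeighbour? Γ S w ×-dec ¬? (C? w)

      Removed? : ∀ S → Decidable (λ w → CommonNeighbour Γ S w × C w)
      Removed? S w = CommonNeighbour? Γ S w ×-dec C? w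

      removed+surviving : ∀ S → codegree Γ S ≤ # (Removed? S) + # (Surviving? S)
      removed+surviving S = count-cover (CommonNeighbour? Γ S) (Removed? S) (Surviving? S) split all
        where
        split : ∀ {w} → CommonNeighbour Γ S w → (CommonNeighbour Γ S w × C w) ⊎ (CommonNeighbour Γ S w × ¬ C w)
        split {w} p with C? w
        ... | yes c = inj₁ (p , c)
        ... | no ¬c = inj₂ (p , ¬c)

      Good : Fin n → Fin n → Set
      Good u v = m ≤ 4 * # (Surviving? (u ∷ v ∷ []))

      Good-sym : ∀ {u v} → Good u v → Good v u
      Good-sym {u} {v} good = ≤-trans good (*-monoʳ-≤ 4
        (count-mono (Surviving? (u ∷ v ∷ [])) (Surviving? (v ∷ u ∷ [])) (λ { (u~ ∷ v~ ∷ [] , ¬c) → v~ ∷ u~ ∷ [] , ¬c }) all))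

      -- The parts of `C` in the two common neighbourhoods overlap in at most `T` vertices, so their
      -- sizes add up to at most `|C| + T`, and `|C|` is below the codegree of `uv`. Hence the
      -- codegree of `uw` is less than `T` plus the two surviving parts. If both of these were below
      -- `m/4`, it would be less than `m`.
      bad⇒good : ∀ u v w → u ~ v → u ~ w → v ≢ w → ¬ Good u v → Good u w
      bad⇒good u v w u~v u~w v≢w bad = ≮⇒≥ λ bad′ → <-irrefl refl (begin-strict
        4 * m                          ≤⟨ *-monoʳ-≤ 4 (codeg≥ u w) ⟩
        4 * codegree Γ (u ∷ w ∷ [])    <⟨ *-monoʳ-< 4 codeg< ⟩
        4 * (T + (r₁ + r₂))            ≡⟨ solve 3 (λ a b c → con 4 :* (a :+ (b :+ c)) := con 4 :* a :+ (con 4 :* b :+ con 4 :* c)) refl T r₁ r₂ ⟩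
        4 * T + (4 * r₁ + 4 * r₂)      ≤⟨ +-mono-≤ 4T≤m (+-mono-≤ (<⇒≤ (≰⇒> bad)) (<⇒≤ bad′)) ⟩
        m + (m + m)                    ≤⟨ +-monoʳ-≤ m (+-monoʳ-≤ m (m≤m+n m (m + 0))) ⟩
        4 * m                          ∎)
        where
        open +-*-Solver
        r₁ = # (Surviving? (u ∷ v ∷ []))
        r₂ = # (Surviving? (u ∷ w ∷ []))
        shared : # (Removed? (u ∷ v ∷ [])) + # (Removed? (u ∷ w ∷ [])) ≤ # C? + T
        shared = ≤-trans
          (count-overlap (Removed? (u ∷ v ∷ [])) (Removed? (u ∷ w ∷ [])) C? (CommonNeighbour? Γ (u ∷ v ∷ w ∷ []))
            proj₂ proj₂ (λ { (u~ ∷ v~ ∷ [] , _) (_ ∷ w~ ∷ [] , _) → u~ ∷ v~ ∷ w~ ∷ [] }) all)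
          (+-monoʳ-≤ (# C?) (tricodeg≤ u v w (~⇒≢ u~v) (~⇒≢ u~w) v≢w))
        codeg< : codegree Γ (u ∷ w ∷ []) < T + (r₁ + r₂)
        codeg< = +-cancelˡ-< (codegree Γ (u ∷ v ∷ [])) _ _ (begin-strict
          codegree Γ (u ∷ v ∷ []) + codegree Γ (u ∷ w ∷ [])        ≤⟨ +-mono-≤ (removed+surviving (u ∷ v ∷ [])) (removed+surviving (u ∷ w ∷ [])) ⟩
          (c₁ + r₁) + (c₂ + r₂)                                    ≡⟨ solve 4 (λ a b c d → (a :+ b) :+ (c :+ d) := (a :+ c) :+ (b :+ d)) refl c₁ r₁ c₂ r₂ ⟩
          (c₁ + c₂) + (r₁ + r₂)                                    ≤⟨ +-monoˡ-≤ (r₁ + r₂) shared ⟩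
          # C? + T + (r₁ + r₂)                                     ≡⟨ +-assoc (# C?) T (r₁ + r₂) ⟩
          # C? + (T + (r₁ + r₂))                                   <⟨ +-monoˡ-< (T + (r₁ + r₂)) (C< u v u~v) ⟩
          codegree Γ (u ∷ v ∷ []) + (T + (r₁ + r₂))                ∎)
          where
          c₁ = # (Removed? (u ∷ v ∷ []))
          c₂ = # (Removed? (u ∷ w ∷ []))

      -- Double counting the edges between C and its complement.
      base : ∃ λ b → ¬ C b × # (λ c → C? c ×-dec (b ~? c)) + # (λ c → C? c ×-dec (b ~? c)) ≤ m
      base with Fin.any? (λ b → ¬? (C? b) ×-dec (# (λ c → C? c ×-dec (b ~? c)) + # (λ c → C? c ×-dec (b ~? c)) ≤? m))
      ... | yes b = b
      ... | no none = contradiction sparse (≤⇒≯ (begin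
        n * m                                 ≡⟨ cong (_* m) (length-allFin n) ⟨
        length all * m                        ≡⟨ cong (λ xs → length xs * m) (filter-all U? (All.universal (λ _ → tt) all)) ⟨
        # U? * m                              ≤⟨ *-monoˡ-≤ m (count-cover U? C? W? (λ {x} _ → split x) all) ⟩
        (# C? + # W?) * m                     ≡⟨ *-distribʳ-+ m (# C?) (# W?) ⟩
        # C? * m + # W? * m                   ≤⟨ +-mono-≤ (*-monoˡ-≤ m C≤M) (Σ-lower W? (λ b → f b + f b) m dense all) ⟩
        M * m + Σ[ ws ] (λ b → f b + f b)     ≡⟨ cong (M * m +_) (Σ-+ f f ws) ⟨
        M * m + (Σ[ ws ] f + Σ[ ws ] f)       ≤⟨ +-monoʳ-≤ (M * m) (+-mono-≤ edges edges) ⟩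
        M * m + (M * Δ + M * Δ)               ≡⟨ cong (λ a → M * m + (M * Δ + a)) (+-identityʳ (M * Δ)) ⟨
        M * m + 2 * (M * Δ)                   ∎))
        where
        U? : Decidable {A = Fin n} (λ _ → ⊤)
        U? _ = yes tt
        W? = λ x → ¬? (C? x)
        ws = filter W? all
        f : Fin n → ℕ
        f b = # (λ c → C? c ×-dec (b ~? c))
        split : ∀ x → C x ⊎ ¬ C x
        split x with C? x
        ... | yes c = inj₁ c
        ... | no ¬c = inj₂ ¬c
        dense : ∀ {b} → ¬ C b → m ≤ f b + f b
        dense {b} ¬Cb = <⇒≤ (≰⇒> λ small → none (b , ¬Cb , small))
        edges : Σ[ ws ] f ≤ M * Δ
        edges = begin
          Σ[ ws ] f                                                ≡⟨ count-swap (λ b c → C? c ×-dec (b ~? c)) ws all ⟩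
          Σ[ all ] (λ c → count (λ b → C? c ×-dec (b ~? c)) ws)    ≤⟨ Σ-upper C? _ Δ degree vanish all ⟩
          # C? * Δ                                                 ≤⟨ *-monoˡ-≤ Δ C≤M ⟩
          M * Δ                                                    ∎
          where
          degree : ∀ {c} → C c → count (λ b → C? c ×-dec (b ~? c)) ws ≤ Δ
          degree {c} _ = ≤-trans (count-sublist (λ b → C? c ×-dec (b ~? c)) W? all)
            (≤-trans (count-mono (λ b → C? c ×-dec (b ~? c)) (CommonNeighbour? Γ (c ∷ [])) (λ (_ , b~c) → ~-sym b~c ∷ []) all) (deg≤ c))
          vanish : ∀ {c} → ¬ C c → count (λ b → C? c ×-dec (b ~? c)) ws ≡ 0
          vanish {c} ¬Cc = count-none (λ b → C? c ×-dec (b ~? c)) (λ (Cc , _) → ¬Cc Cc) ws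

      module _ (b : Fin n) (¬Cb : ¬ C b)
               (few : # (λ c → C? c ×-dec (b ~? c)) + # (λ c → C? c ×-dec (b ~? c)) ≤ m) where

        Class : Fin n → Bool → Pred (Fin n) 0ℓ
        Class v c w = (CommonNeighbour Γ (b ∷ v ∷ []) w × ¬ C w) × ζ b w xor ζ w v ≡ c

        Class? : ∀ v c → Decidable (Class v c)
        Class? v c w = Surviving? (b ∷ v ∷ []) w ×-dec (ζ b w xor ζ w v Bool.≟ c)

        -- `C` contains at most `m/2` neighbours of `b`, so whatever `v` is, at least `m/2` of the
        -- common neighbours of `b` and `v` survive.
        surviving-base : ∀ v → m ≤ # (Surviving? (b ∷ v ∷ [])) + # (Surviving? (b ∷ v ∷ []))
        surviving-base v = +-cancelˡ-≤ m _ _ (begin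
          m + m                           ≤⟨ +-mono-≤ bound bound ⟩
          (f + s) + (f + s)               ≡⟨ solve 2 (λ a b → (a :+ b) :+ (a :+ b) := (a :+ a) :+ (b :+ b)) refl f s ⟩
          (f + f) + (s + s)               ≤⟨ +-monoˡ-≤ (s + s) few ⟩
          m + (s + s)                     ∎)
          where
          open +-*-Solver
          f = # (λ c → C? c ×-dec (b ~? c))
          s = # (Surviving? (b ∷ v ∷ []))
          bound : m ≤ f + s
          bound = begin
            m                                           ≤⟨ codeg≥ b v ⟩
            codegree Γ (b ∷ v ∷ [])                     ≤⟨ removed+surviving (b ∷ v ∷ []) ⟩
            # (Removed? (b ∷ v ∷ [])) + s               ≤⟨ +-monoˡ-≤ s (count-mono (Removed? (b ∷ v ∷ [])) (λ c → C? c ×-dec (b ~? c)) (λ { (b~c ∷ _ , Cc) → Cc , b~c }) all) ⟩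
            f + s                                       ∎

        -- The survivors, at least `m/2` of them, fall into two classes; any class with at least
        -- `m/4` members serves, and it need not be the larger one.
        majority : ∀ v → ∃ λ c → m ≤ 4 * # (Class? v c)
        majority v with m ≤? 4 * # (Class? v true)
        ... | yes p = true , p
        ... | no ¬p = false , +-cancelˡ-≤ m _ _ (begin
          m + m                                                 ≤⟨ +-mono-≤ (surviving-base v) (surviving-base v) ⟩
          s + s + (s + s)                                       ≡⟨ solve 1 (λ a → a :+ a :+ (a :+ a) := con 4 :* a) refl s ⟩
          4 * s                                                 ≤⟨ *-monoʳ-≤ 4 (count-cover (Surviving? (b ∷ v ∷ [])) (Class? v true) (Class? v false) split all) ⟩
          4 * (# (Class? v true) + # (Class? v false))          ≡⟨ *-distribˡ-+ 4 (# (Class? v true)) (# (Class? v false)) ⟩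
          4 * # (Class? v true) + 4 * # (Class? v false)        ≤⟨ +-monoˡ-≤ _ (<⇒≤ (≰⇒> ¬p)) ⟩
          m + 4 * # (Class? v false)                            ∎)
          where
          open +-*-Solver
          s = # (Surviving? (b ∷ v ∷ []))
          split : ∀ {w} → CommonNeighbour Γ (b ∷ v ∷ []) w × ¬ C w → Class v true w ⊎ Class v false w
          split {w} p with ζ b w xor ζ w v in eq
          ... | true  = inj₁ (p , refl)
          ... | false = inj₂ (p , refl)

        module _ (potential : Fin n → Bool) (majority : ∀ v → m ≤ 4 * # (Class? v (potential v))) where

          private
            -- `transversal-triangle` asks for `2t` candidates `w` and for `t² + t` vertices in each
            -- class; `t² + 2t` covers both.
            quarter : ∀ {k} → m ≤ 4 * k → t * t + (t + t) ≤ k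
            quarter m≤ = *-cancelˡ-≤ 4 (≤-trans large m≤)

            weaken : ∀ {k} → t * t + (t + t) ≤ k → t * t + t ≤ k
            weaken = ≤-trans (+-monoʳ-≤ (t * t) (m≤m+n t t))

          potential-good : ∀ u v → ¬ C u → ¬ C v → u ~ v → Good u v → ζ u v ≡ potential u xor potential v
          potential-good u v ¬Cu ¬Cv u~v good
            with transversal-triangle {Γ = Γ} {t = t} joined (Surviving? (u ∷ v ∷ [])) (Class? u (potential u)) (Class? v (potential v))
                   (≤-trans (m≤n+m (t + t) (t * t)) (quarter good))
                   (weaken (quarter (majority u))) (weaken (quarter (majority v)))
          -- Here `x ≡ y`: the pentagon degenerates and the single triangle `x u v` suffices.
          ... | w , x , .x , _ , ((b~x ∷ u~x ∷ [] , ¬Cx) , gu) , ((_ ∷ v~x ∷ [] , _) , gv) , _ , _ , inj₁ refl =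
            fill-triangle (ζ u v) (ζ x u) (ζ b x) (cocycle x u v ¬Cx ¬Cu ¬Cv (~-sym u~x) u~v (~-sym v~x)) gu gv
          ... | w , x , y , (u~w ∷ v~w ∷ [] , ¬Cw) , ((b~x ∷ u~x ∷ [] , ¬Cx) , gu) , ((b~y ∷ v~y ∷ [] , ¬Cy) , gv) , w~x , w~y , inj₂ x~y =
            fill-pentagon (ζ u w) (ζ x u) (ζ w y) (ζ y v) (ζ b x)
              (cocycle u w v ¬Cu ¬Cw ¬Cv u~w (~-sym v~w) u~v)
              (cocycle x u w ¬Cx ¬Cu ¬Cw (~-sym u~x) u~w (~-sym w~x))
              (cocycle w y v ¬Cw ¬Cy ¬Cv w~y (~-sym v~y) (~-sym v~w))
              (cocycle x w y ¬Cx ¬Cw ¬Cy (~-sym w~x) w~y x~y)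
              (cocycle b x y ¬Cb ¬Cx ¬Cy b~x x~y b~y)
              gu gv

          exact : ∀ u v → ¬ C u → ¬ C v → u ~ v → ζ u v ≡ potential u xor potential v
          exact u v ¬Cu ¬Cv u~v with m ≤? 4 * # (Surviving? (u ∷ v ∷ []))
          ... | yes good = potential-good u v ¬Cu ¬Cv u~v good
          ... | no bad with count>0⇒∃ (Surviving? (u ∷ v ∷ [])) all (+-cancelˡ-< (# C?) 0 _ (begin-strict
            # C? + 0                                                  ≡⟨ +-identityʳ (# C?) ⟩
            # C?                                                      <⟨ C< u v u~v ⟩
            codegree Γ (u ∷ v ∷ [])                                   ≤⟨ removed+surviving (u ∷ v ∷ []) ⟩
            # (Removed? (u ∷ v ∷ [])) + # (Surviving? (u ∷ v ∷ []))   ≤⟨ +-monoˡ-≤ _ (count-mono (Removed? (u ∷ v ∷ [])) C? proj₂ all) ⟩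
            # C? + # (Surviving? (u ∷ v ∷ []))                        ∎))
          -- Both `uw` and `wv` share an endpoint with the bad edge `uv`, so `bad⇒good` applies to
          -- each.
          ... | w , u~w ∷ v~w ∷ [] , ¬Cw = concatenate (potential u) (potential v) (potential w)
            (cocycle u w v ¬Cu ¬Cw ¬Cv u~w (~-sym v~w) u~v)
            (potential-good u w ¬Cu ¬Cw u~w (bad⇒good u v w u~v u~w (~⇒≢ v~w) bad))
            (potential-good w v ¬Cw ¬Cv (~-sym v~w)
              (Good-sym (bad⇒good v u w (~-sym u~v) v~w (~⇒≢ u~w) (bad ∘ Good-sym))))

      coboundary : ∃ λ (g : Fin n → Bool) → ∀ u v → ¬ C u → ¬ C v → u ~ v → ζ u v ≡ g u xor g v
      coboundary =
        let b , ¬Cb , few = base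
            h = majority b ¬Cb few
        in proj₁ ∘ h , exact b ¬Cb few (proj₁ ∘ h) (proj₂ ∘ h)

  open Counting public

  -- Simplices of the clique complex

  min-∷ : ∀ x xs → ∃ λ k → min (x ∷ xs) ≡ [ k ] × k ∈ˡ x ∷ xs × All (k ≤_) (x ∷ xs)
  min-∷ x [] = x , refl , here refl , ≤-refl ∷ []
  min-∷ x (y ∷ ys) with min (y ∷ ys) | min-∷ y ys
  ... | _ | k , refl , k∈ , k≤ with ≤-total x k
  ...   | inj₁ x≤k = x ⊓ k , refl , here (m≤n⇒m⊓n≡m x≤k) , m⊓n≤m x k ∷ All.map (≤-trans (m⊓n≤n x k)) k≤
  ...   | inj₂ k≤x = x ⊓ k , refl , there (subst (_∈ˡ y ∷ ys) (sym (m≥n⇒m⊓n≡n k≤x)) k∈) , m⊓n≤m x k ∷ All.map (≤-trans (m⊓n≤n x k)) k≤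

  min-∈ : ∀ {x xs} → x ∈ˡ xs → ∃ λ k → min xs ≡ [ k ] × k ∈ˡ xs × All (k ≤_) xs
  min-∈ {xs = x ∷ xs} _ = min-∷ x xs

  min-least : ∀ {k xs} → k ∈ˡ xs → All (k ≤_) xs → min xs ≡ [ k ]
  min-least k∈ k≤ with min-∈ k∈
  ... | l , eq , l∈ , l≤ = trans eq (cong [_] (≤-antisym (All.lookup l≤ k∈) (All.lookup k≤ l∈)))

  ∈-subsets : ∀ (σ : Subset n) → σ ∈ˡ subsets n
  ∈-subsets Vec.[]            = here refl
  ∈-subsets (true  Vec.∷ σ) = ∈-++⁺ˡ (∈-map⁺ (true Vec.∷_) (∈-subsets σ))
  ∈-subsets (false Vec.∷ σ) = ∈-++⁺ʳ (map (true Vec.∷_) (subsets _)) (∈-map⁺ (false Vec.∷_) (∈-subsets σ))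

  count-map : ∀ {A B : Set} {P : Pred B 0ℓ} (P? : Decidable P) (f : A → B) xs →
              count P? (map f xs) ≡ count (P? ∘ f) xs
  count-map P? f [] = refl
  count-map P? f (x ∷ xs) with does (P? (f x))
  ... | true  = cong suc (count-map P? f xs)
  ... | false = count-map P? f xs

  length-elements : ∀ (σ : Subset n) → length (elements σ) ≡ ∣ σ ∣
  length-elements Vec.[] = refl
  length-elements {suc n} (s Vec.∷ σ) = step s
    where
    tail : ∀ s → count (_∈? (s Vec.∷ σ)) (tabulate suc) ≡ ∣ σ ∣
    tail s = trans (cong (count (_∈? (s Vec.∷ σ))) (sym (map-tabulate id suc)))
      (trans (count-map (_∈? (s Vec.∷ σ)) suc (allFin n))
      (trans (≤-antisym (count-mono (λ i → suc i ∈? (s Vec.∷ σ)) (_∈? σ) drop-there (allFin n))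
                        (count-mono (_∈? σ) (λ i → suc i ∈? (s Vec.∷ σ)) Vec.there (allFin n)))
             (length-elements σ)))
    step : ∀ s → length (elements (s Vec.∷ σ)) ≡ ∣ s Vec.∷ σ ∣
    step true  = cong suc (tail true)
    step false = tail false

  ∈-elements⁺ : ∀ {x} {σ : Subset n} → x ∈ σ → x ∈ˡ elements σ
  ∈-elements⁺ {σ = σ} x∈σ = ∈-filter⁺ (_∈? σ) (∈-allFin _) x∈σ

  ∈-elements⁻ : ∀ {x} {σ : Subset n} → x ∈ˡ elements σ → x ∈ σ
  ∈-elements⁻ {n} {σ = σ} x∈ = proj₂ (∈-filter⁻ (_∈? σ) {xs = allFin n} x∈)

  unique-elements : ∀ (σ : Subset n) → Unique (elements σ)
  unique-elements {n} σ = Unique.filter⁺ (_∈? σ) (Unique.allFin⁺ n)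

  ∣σ∪⁅x⁆∣ : ∀ {x} (σ : Subset n) → x ∉ σ → ∣ σ ∪ ⁅ x ⁆ ∣ ≡ suc ∣ σ ∣
  ∣σ∪⁅x⁆∣ {x = zero}  (true  Vec.∷ σ) x∉σ = contradiction Vec.here x∉σ
  ∣σ∪⁅x⁆∣ {x = zero}  (false Vec.∷ σ) x∉σ = cong (suc ∘ ∣_∣) (∪-identityʳ σ)
  ∣σ∪⁅x⁆∣ {x = suc x} (true  Vec.∷ σ) x∉σ = cong suc (∣σ∪⁅x⁆∣ σ (x∉σ ∘ Vec.there))
  ∣σ∪⁅x⁆∣ {x = suc x} (false Vec.∷ σ) x∉σ = ∣σ∪⁅x⁆∣ σ (x∉σ ∘ Vec.there)

  x∉p─q : ∀ (p q : Subset n) {x} → x ∈ p ─ q → x ∉ q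
  x∉p─q (_ Vec.∷ p) (false Vec.∷ q) Vec.here ()
  x∉p─q (_ Vec.∷ p) (true Vec.∷ q) (Vec.there x∈) (Vec.there x∈q) = x∉p─q p q x∈ x∈q
  x∉p─q (_ Vec.∷ p) (false Vec.∷ q) (Vec.there x∈) (Vec.there x∈q) = x∉p─q p q x∈ x∈q

  pair : Fin n → Fin n → Subset n
  pair u v = ⁅ u ⁆ ∪ ⁅ v ⁆

  ∈-pair⁻ : ∀ {x} (u v : Fin n) → x ∈ pair u v → x ≡ u ⊎ x ≡ v
  ∈-pair⁻ u v x∈ with x∈p∪q⁻ ⁅ u ⁆ ⁅ v ⁆ x∈
  ... | inj₁ x∈u = inj₁ (x∈⁅y⁆⇒x≡y u x∈u)
  ... | inj₂ x∈v = inj₂ (x∈⁅y⁆⇒x≡y v x∈v)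

  ∈-pairˡ : ∀ (u v : Fin n) → u ∈ pair u v
  ∈-pairˡ u v = x∈p∪q⁺ (inj₁ (x∈⁅x⁆ u))

  ∈-pairʳ : ∀ (u v : Fin n) → v ∈ pair u v
  ∈-pairʳ u v = x∈p∪q⁺ (inj₂ (x∈⁅x⁆ v))

  pair-comm : ∀ (u v : Fin n) → pair u v ≡ pair v u
  pair-comm u v = ∪-comm ⁅ u ⁆ ⁅ v ⁆

  ∣pair∣ : ∀ {u v : Fin n} → u ≢ v → ∣ pair u v ∣ ≡ 2
  ∣pair∣ {u = u} {v} u≢v = trans (∣σ∪⁅x⁆∣ ⁅ u ⁆ (λ v∈u → u≢v (sym (x∈⁅y⁆⇒x≡y u v∈u)))) (cong suc (∣⁅x⁆∣≡1 u))

  -- The list is kept beside the set equation: `d` folds over `elements σ`, whereas edges are named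
  -- by `pair`.
  data Two (σ : Subset n) : Set where
    two : ∀ a b → elements σ ≡ a ∷ b ∷ [] → a ≢ b → σ ≡ pair a b → Two σ

  two-elements : ∀ (σ : Subset n) → ∣ σ ∣ ≡ 2 → Two σ
  two-elements σ size with elements σ in eq | trans (length-elements σ) size | unique-elements σ
  ... | a ∷ b ∷ [] | _ | (a≢b ∷ []) ∷ _ = two a b eq a≢b (⊆-antisym σ⊆ ⊆σ)
    where
    σ⊆ : σ ⊆ pair a b
    σ⊆ x∈σ with subst (_ ∈ˡ_) eq (∈-elements⁺ x∈σ)
    ... | here refl         = ∈-pairˡ a b
    ... | there (here refl) = ∈-pairʳ a b
    ⊆σ : pair a b ⊆ σ
    ⊆σ x∈ with ∈-pair⁻ a b x∈
    ... | inj₁ refl = ∈-elements⁻ (subst (a ∈ˡ_) (sym eq) (here refl))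
    ... | inj₂ refl = ∈-elements⁻ (subst (b ∈ˡ_) (sym eq) (there (here refl)))

  module _ {n} (X : SimplicialComplex n) where
    open Cohomology 𝔽₂ X

    private
      xor-false : ∀ a b → a xor (b xor false) ≡ b xor a
      xor-false true  true  = refl
      xor-false true  false = refl
      xor-false false true  = refl
      xor-false false false = refl

      ∸-pairˡ : ∀ {a b : Fin n} → a ≢ b → pair a b ∸ˢ a ≡ ⁅ b ⁆
      ∸-pairˡ {a} {b} a≢b = ⊆-antisym
        (λ x∈ → [ (λ { refl → contradiction (x∈⁅x⁆ a) (x∉p─q (pair a b) ⁅ a ⁆ x∈) }) , (λ { refl → x∈⁅x⁆ b }) ]′
                  (∈-pair⁻ a b (p─q⊆p (pair a b) ⁅ a ⁆ x∈)))
        (λ x∈ → subst (_∈ pair a b ∸ˢ a) (sym (x∈⁅y⁆⇒x≡y b x∈)) (x∈p∧x≢y⇒x∈p-y (∈-pairʳ a b) (a≢b ∘ sym)))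

      -- Subtraction in 𝔽₂ is `xor`, so the nested difference is a plain sum, and removing one
      -- element of the pair leaves the other.
      d-two : ∀ (g : Cochain) {a b} σ → elements σ ≡ a ∷ b ∷ [] → a ≢ b → σ ≡ pair a b → d g σ ≡ g ⁅ a ⁆ xor g ⁅ b ⁆
      d-two g {a} {b} .(pair a b) eq a≢b refl rewrite eq | ∸-pairˡ a≢b
        | trans (cong (_∸ˢ b) (pair-comm a b)) (∸-pairˡ (a≢b ∘ sym)) = xor-false (g ⁅ b ⁆) (g ⁅ a ⁆)

    d-pair : ∀ (g : Cochain) {u v} → u ≢ v → d g (pair u v) ≡ g ⁅ u ⁆ xor g ⁅ v ⁆
    d-pair g {u} {v} u≢v with two-elements (pair u v) (∣pair∣ u≢v)
    ... | two a b eq a≢b σ≡ with ∈-pair⁻ u v (subst (a ∈_) (sym σ≡) (∈-pairˡ a b)) | ∈-pair⁻ u v (subst (b ∈_) (sym σ≡) (∈-pairʳ a b))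
    ...   | inj₁ refl | inj₁ refl = contradiction refl a≢b
    ...   | inj₂ refl | inj₂ refl = contradiction refl a≢b
    ...   | inj₁ refl | inj₂ refl = d-two g (pair u v) eq a≢b σ≡
    ...   | inj₂ refl | inj₁ refl = trans (d-two g (pair u v) eq a≢b σ≡) (Bool.xor-comm (g ⁅ v ⁆) (g ⁅ u ⁆))

    d-vanish : ∀ (f : Cochain) σ → (∀ {x} → x ∈ σ → f (σ ∸ˢ x) ≡ false) → d f σ ≡ false
    d-vanish f σ f≡0 = go (elements σ) (All.tabulate (f≡0 ∘ ∈-elements⁻))
      where
      go : ∀ xs → All (λ x → f (σ ∸ˢ x) ≡ false) xs → foldr _xor_ false (map (λ x → f (σ ∸ˢ x)) xs) ≡ false
      go []       []       = refl
      go (x ∷ xs) (p ∷ ps) rewrite p = go xs ps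

  triple : Fin n → Fin n → Fin n → Subset n
  triple u v w = pair u v ∪ ⁅ w ⁆

  ∈-triple⁻ : ∀ {x} (u v w : Fin n) → x ∈ triple u v w → x ≡ u ⊎ x ≡ v ⊎ x ≡ w
  ∈-triple⁻ u v w x∈ with x∈p∪q⁻ (pair u v) ⁅ w ⁆ x∈
  ... | inj₂ x∈w = inj₂ (inj₂ (x∈⁅y⁆⇒x≡y w x∈w))
  ... | inj₁ x∈uv with ∈-pair⁻ u v x∈uv
  ...   | inj₁ x≡u = inj₁ x≡u
  ...   | inj₂ x≡v = inj₂ (inj₁ x≡v)

  ∣triple∣ : ∀ {u v w : Fin n} → u ≢ v → u ≢ w → v ≢ w → ∣ triple u v w ∣ ≡ 3
  ∣triple∣ {u = u} {v} {w} u≢v u≢w v≢w = trans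
    (∣σ∪⁅x⁆∣ (pair u v) (λ w∈ → [ u≢w ∘ sym , v≢w ∘ sym ]′ (∈-pair⁻ u v w∈))) (cong suc (∣pair∣ u≢v))

  private
    xor-three : ∀ a b c → a xor (b xor (c xor false)) ≡ false → (a ≡ b xor c) × (b ≡ a xor c) × (c ≡ a xor b)
    xor-three true  true  false _ = refl , refl , refl
    xor-three true  false true  _ = refl , refl , refl
    xor-three false true  true  _ = refl , refl , refl
    xor-three false false false _ = refl , refl , refl

    xor-swap : ∀ {a} b c → a ≡ b xor c → a ≡ c xor b
    xor-swap b c eq = trans eq (Bool.xor-comm b c)

    cannot : ∀ {A : Set} {x : Fin n} → x ≢ x → A
    cannot x≢x = contradiction refl x≢x

    module _ (F : Fin n → Bool) where

      -- The order in which `elements` lists the three vertices is not known, so all placements are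
      -- examined; coinciding positions contradict distinctness.
      xor-elements : ∀ {u v w} xs → length xs ≡ 3 → u ∈ˡ xs → v ∈ˡ xs → w ∈ˡ xs → u ≢ v → u ≢ w → v ≢ w →
                     foldr _xor_ false (map F xs) ≡ false → F v ≡ F u xor F w
      xor-elements (a ∷ b ∷ c ∷ []) _ u∈ v∈ w∈ u≢v u≢w v≢w eq with xor-three (F a) (F b) (F c) eq | u∈ | v∈ | w∈
      ... | A , B , C | here refl | here refl | here refl = cannot u≢v
      ... | A , B , C | here refl | here refl | there (here refl) = cannot u≢v
      ... | A , B , C | here refl | here refl | there (there (here refl)) = cannot u≢v
      ... | A , B , C | here refl | there (here refl) | here refl = cannot u≢w
      ... | A , B , C | here refl | there (here refl) | there (here refl) = cannot v≢w
      ... | A , B , C | here refl | there (here refl) | there (there (here refl)) = B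
      ... | A , B , C | here refl | there (there (here refl)) | here refl = cannot u≢w
      ... | A , B , C | here refl | there (there (here refl)) | there (here refl) = C
      ... | A , B , C | here refl | there (there (here refl)) | there (there (here refl)) = cannot v≢w
      ... | A , B , C | there (here refl) | here refl | here refl = cannot v≢w
      ... | A , B , C | there (here refl) | here refl | there (here refl) = cannot u≢w
      ... | A , B , C | there (here refl) | here refl | there (there (here refl)) = A
      ... | A , B , C | there (here refl) | there (here refl) | here refl = cannot u≢v
      ... | A , B , C | there (here refl) | there (here refl) | there (here refl) = cannot u≢v
      ... | A , B , C | there (here refl) | there (here refl) | there (there (here refl)) = cannot u≢v
      ... | A , B , C | there (here refl) | there (there (here refl)) | here refl = xor-swap (F a) (F b) C
      ... | A , B , C | there (here refl) | there (there (here refl)) | there (here refl) = cannot u≢w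
      ... | A , B , C | there (here refl) | there (there (here refl)) | there (there (here refl)) = cannot v≢w
      ... | A , B , C | there (there (here refl)) | here refl | here refl = cannot v≢w
      ... | A , B , C | there (there (here refl)) | here refl | there (here refl) = xor-swap (F b) (F c) A
      ... | A , B , C | there (there (here refl)) | here refl | there (there (here refl)) = cannot u≢w
      ... | A , B , C | there (there (here refl)) | there (here refl) | here refl = xor-swap (F a) (F c) B
      ... | A , B , C | there (there (here refl)) | there (here refl) | there (here refl) = cannot v≢w
      ... | A , B , C | there (there (here refl)) | there (here refl) | there (there (here refl)) = cannot u≢w
      ... | A , B , C | there (there (here refl)) | there (there (here refl)) | here refl = cannot u≢v
      ... | A , B , C | there (there (here refl)) | there (there (here refl)) | there (here refl) = cannot u≢v
      ... | A , B , C | there (there (here refl)) | there (there (here refl)) | there (there (here refl)) = cannot u≢v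
  d-triple : ∀ (f : Subset n → Bool) {u v w : Fin n} → u ≢ v → u ≢ w → v ≢ w →
             foldr _xor_ false (map (λ x → f (triple u v w ∸ˢ x)) (elements (triple u v w))) ≡ false →
             f (pair u w) ≡ f (pair u v) xor f (pair v w)
  d-triple f {u} {v} {w} u≢v u≢w v≢w df≡0 = begin
    f (pair u w)                      ≡⟨ cong f -v ⟨
    f (σ ∸ˢ v)                        ≡⟨ xor-elements (λ x → f (σ ∸ˢ x)) (elements σ) (trans (length-elements σ) (∣triple∣ u≢v u≢w v≢w))
                                           (∈-elements⁺ w∈) (∈-elements⁺ v∈) (∈-elements⁺ u∈) (v≢w ∘ sym) (u≢w ∘ sym) (u≢v ∘ sym) df≡0 ⟩
    f (σ ∸ˢ w) xor f (σ ∸ˢ u)         ≡⟨ cong₂ (λ a b → f a xor f b) -w -u ⟩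
    f (pair u v) xor f (pair v w)     ∎
    where
    open ≡-Reasoning
    σ = triple u v w
    u∈ : u ∈ σ
    u∈ = x∈p∪q⁺ (inj₁ (∈-pairˡ u v))
    v∈ : v ∈ σ
    v∈ = x∈p∪q⁺ (inj₁ (∈-pairʳ u v))
    w∈ : w ∈ σ
    w∈ = x∈p∪q⁺ (inj₂ (x∈⁅x⁆ w))
    remove : ∀ {x y z} → x ∈ σ → y ∈ σ → x ≢ z → y ≢ z → (∀ {a} → a ∈ σ → a ≢ z → a ≡ x ⊎ a ≡ y) → σ ∸ˢ z ≡ pair x y
    remove {x} {y} {z} x∈ y∈ x≢z y≢z only = ⊆-antisym
      (λ {a} a∈ → [ (λ { refl → ∈-pairˡ x y }) , (λ { refl → ∈-pairʳ x y }) ]′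
                  (only (p─q⊆p σ ⁅ z ⁆ a∈) (λ { refl → x∉p─q σ ⁅ z ⁆ a∈ (x∈⁅x⁆ z) })))
      (λ a∈ → [ (λ { refl → x∈p∧x≢y⇒x∈p-y x∈ x≢z }) , (λ { refl → x∈p∧x≢y⇒x∈p-y y∈ y≢z }) ]′ (∈-pair⁻ x y a∈))
    -w : σ ∸ˢ w ≡ pair u v
    -w = remove u∈ v∈ u≢w v≢w λ a∈ a≢w → [ inj₁ , [ inj₂ , (λ eq → contradiction eq a≢w) ]′ ]′ (∈-triple⁻ u v w a∈)
    -v : σ ∸ˢ v ≡ pair u w
    -v = remove u∈ w∈ u≢v (v≢w ∘ sym) λ a∈ a≢v → [ inj₁ , [ (λ eq → contradiction eq a≢v) , inj₂ ]′ ]′ (∈-triple⁻ u v w a∈)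
    -u : σ ∸ˢ u ≡ pair v w
    -u = remove v∈ w∈ (u≢v ∘ sym) (u≢w ∘ sym) λ a∈ a≢u → [ (λ eq → contradiction eq a≢u) , id ]′ (∈-triple⁻ u v w a∈)

  private
    xor-path : ∀ a u v b → a xor u ≡ false → u xor v ≡ false → v xor b ≡ false → ¬ (a xor b ≡ true)
    xor-path true  true  true  true  _ _ _ ()
    xor-path false false false false _ _ _ ()

  does-true : ∀ {A : Set} (a? : Dec A) → does a? ≡ true → A
  does-true (yes a) _ = a

  module _ (Γ : Graph n) where
    open Graph Γ using (_~_; _~?_; ~-sym; ~-irrefl)

    ∈-neighbours⁺ : ∀ {v w} → v ~ w → w ∈ neighbours Γ v
    ∈-neighbours⁺ {v} {w} v~w = Vec.lookup⇒[]= w _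
      (trans (Vec.lookup∘tabulate (λ u → does (v ~? u)) w) (dec-true (v ~? w) v~w))

    ∈-neighbours⁻ : ∀ {v w} → w ∈ neighbours Γ v → v ~ w
    ∈-neighbours⁻ {v} {w} w∈ = does-true (v ~? w)
      (trans (sym (Vec.lookup∘tabulate (λ u → does (v ~? u)) w)) (Vec.[]=⇒lookup w∈))

    ∈-⋂⁺ : ∀ {w} vs → CommonNeighbour Γ vs w → w ∈ ⋂ (map (neighbours Γ) vs)
    ∈-⋂⁺ []       []       = ∈⊤
    ∈-⋂⁺ (v ∷ vs) (p ∷ ps) = x∈p∩q⁺ (∈-neighbours⁺ p , ∈-⋂⁺ vs ps)

    ∈-⋂⁻ : ∀ {w} vs → w ∈ ⋂ (map (neighbours Γ) vs) → CommonNeighbour Γ vs w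
    ∈-⋂⁻ []       _  = []
    ∈-⋂⁻ (v ∷ vs) w∈ with x∈p∩q⁻ (neighbours Γ v) (⋂ (map (neighbours Γ) vs)) w∈
    ... | w∈v , w∈vs = ∈-neighbours⁻ w∈v ∷ ∈-⋂⁻ vs w∈vs

    ∈-commonNeighbours-pair⁺ : ∀ {u v w} → CommonNeighbour Γ (u ∷ v ∷ []) w → w ∈ commonNeighbours Γ (pair u v)
    ∈-commonNeighbours-pair⁺ {u} {v} {w} (u~w ∷ v~w ∷ []) = ∈-⋂⁺ (elements (pair u v)) (All.tabulate λ c∈ →
      [ (λ { refl → u~w }) , (λ { refl → v~w }) ]′ (∈-pair⁻ u v (∈-elements⁻ c∈)))

    ∈-commonNeighbours-pair⁻ : ∀ {u v w} → w ∈ commonNeighbours Γ (pair u v) → CommonNeighbour Γ (u ∷ v ∷ []) w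
    ∈-commonNeighbours-pair⁻ {u} {v} {w} w∈ =
      let adj = ∈-⋂⁻ (elements (pair u v)) w∈
      in All.lookup adj (∈-elements⁺ (∈-pairˡ u v)) ∷ All.lookup adj (∈-elements⁺ (∈-pairʳ u v)) ∷ []

    ∣commonNeighbours∣ : ∀ u v → ∣ commonNeighbours Γ (pair u v) ∣ ≡ codegree Γ (u ∷ v ∷ [])
    ∣commonNeighbours∣ u v = trans (sym (length-elements N)) (≤-antisym
      (count-mono (_∈? N) (CommonNeighbour? Γ (u ∷ v ∷ [])) ∈-commonNeighbours-pair⁻ (allFin n))
      (count-mono (CommonNeighbour? Γ (u ∷ v ∷ [])) (_∈? N) ∈-commonNeighbours-pair⁺ (allFin n)))
      where N = commonNeighbours Γ (pair u v)

    edge-simplex : ∀ {u v} → u ~ v → SimplicialComplex.Simplex (Cl Γ) 1 (pair u v)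
    edge-simplex {u} {v} u~v = (⊆V , adjacent) , ∣pair∣ {u = u} {v} (λ { refl → ~-irrefl u~v })
      where
      ⊆V : pair u v ⊆ V Γ
      ⊆V x∈ = [ (λ { refl → Graph.~⇒∈V Γ u~v }) , (λ { refl → Graph.~⇒∈V Γ (~-sym u~v) }) ]′ (∈-pair⁻ u v x∈)
      adjacent : ∀ x y → x ∈ pair u v → y ∈ pair u v → x ≢ y → x ~ y
      adjacent x y x∈ y∈ x≢y with ∈-pair⁻ u v x∈ | ∈-pair⁻ u v y∈
      ... | inj₁ refl | inj₁ refl = contradiction refl x≢y
      ... | inj₁ refl | inj₂ refl = u~v
      ... | inj₂ refl | inj₁ refl = ~-sym u~v
      ... | inj₂ refl | inj₂ refl = contradiction refl x≢y

    triangle-simplex : ∀ {u v w} → u ~ v → v ~ w → u ~ w → SimplicialComplex.Simplex (Cl Γ) 2 (triple u v w)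
    triangle-simplex {u} {v} {w} u~v v~w u~w =
      (⊆V , adjacent) , ∣triple∣ {u = u} {v} {w} (λ { refl → ~-irrefl u~v }) (λ { refl → ~-irrefl u~w }) (λ { refl → ~-irrefl v~w })
      where
      ⊆V : triple u v w ⊆ V Γ
      ⊆V x∈ = [ (λ { refl → Graph.~⇒∈V Γ u~v }) , [ (λ { refl → Graph.~⇒∈V Γ v~w }) , (λ { refl → Graph.~⇒∈V Γ (~-sym v~w) }) ]′ ]′ (∈-triple⁻ u v w x∈)
      adjacent : ∀ x y → x ∈ triple u v w → y ∈ triple u v w → x ≢ y → x ~ y
      adjacent x y x∈ y∈ x≢y with ∈-triple⁻ u v w x∈ | ∈-triple⁻ u v w y∈
      ... | inj₁ refl        | inj₁ refl        = contradiction refl x≢y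
      ... | inj₁ refl        | inj₂ (inj₁ refl) = u~v
      ... | inj₁ refl        | inj₂ (inj₂ refl) = u~w
      ... | inj₂ (inj₁ refl) | inj₁ refl        = ~-sym u~v
      ... | inj₂ (inj₁ refl) | inj₂ (inj₁ refl) = contradiction refl x≢y
      ... | inj₂ (inj₁ refl) | inj₂ (inj₂ refl) = v~w
      ... | inj₂ (inj₂ refl) | inj₁ refl        = ~-sym u~w
      ... | inj₂ (inj₂ refl) | inj₂ (inj₁ refl) = ~-sym v~w
      ... | inj₂ (inj₂ refl) | inj₂ (inj₂ refl) = contradiction refl x≢y

    simplex-edge : ∀ {σ} → SimplicialComplex.Simplex (Cl Γ) 1 σ → ∃₂ λ u v → u ~ v × σ ≡ pair u v
    simplex-edge {σ} ((_ , adjacent) , size) with two-elements σ size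
    ... | two a b _ a≢b σ≡ = a , b , adjacent a b (subst (a ∈_) (sym σ≡) (∈-pairˡ a b)) (subst (b ∈_) (sym σ≡) (∈-pairʳ a b)) a≢b , σ≡

  -- `κ = δ` for pseudorandom graphs.

  module _ {Γ : Graph n} {t m Δ M T : ℕ} (∈V : ∀ v → v ∈ V Γ) (R : Pseudorandom Γ t m Δ M T)
    (0<t : 0 < t) (4T≤m : 4 * T ≤ m) (large : 4 * (t * t + (t + t)) ≤ m) (sparse : M * m + 2 * (M * Δ) < n * m)
    where
    open Graph Γ using (_~_; _~?_; ~-sym; ~-irrefl)
    open Pseudorandom R

    private
      ~⇒≢ : ∀ {u v} → u ~ v → u ≢ v
      ~⇒≢ u~v refl = ~-irrefl u~v

      2t≤ : t + t ≤ t * t + (t + t)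
      2t≤ = m≤n+m (t + t) (t * t)

      0<m : 0 < m
      0<m = ≤-trans 0<t (≤-trans (m≤m+n t t) (≤-trans 2t≤ (≤-trans (m≤m+n _ _) large)))

      common : ∀ u v → ∃ (CommonNeighbour Γ (u ∷ v ∷ []))
      common u v = count>0⇒∃ (CommonNeighbour? Γ (u ∷ v ∷ [])) (allFin n) (≤-trans 0<m (codeg≥ u v))

      vertex : Fin n
      vertex = nonempty n sparse
        where
        nonempty : ∀ k → M * m + 2 * (M * Δ) < k * m → Fin k
        nonempty (suc k) _ = zero

      edge : ∃₂ λ u v → u ~ v
      edge with common vertex vertex
      ... | w , v~w ∷ _ = vertex , w , v~w

    -- Take a common neighbour `w` of `a` and `b`. At least `m` vertices are adjacent to both `a`
    -- and `w`, and at most `T` of them to `b` as well. This avoids comparing the degree of `a` with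
    -- the codegree of `a` and `b`.
    private-neighbours : ∀ {a b} → a ~ b → t ≤ # (λ u → (a ~? u) ×-dec ¬? (b ~? u) ×-dec ¬? (u Fin.≟ b))
    private-neighbours {a} {b} a~b with common a b
    ... | w , a~w ∷ b~w ∷ [] = *-cancelˡ-≤ 4 (+-cancelʳ-≤ (4 + m) (4 * t) (4 * s) (begin
      4 * t + (4 + m)                            ≡⟨ solve 2 (λ t m → con 4 :* t :+ (con 4 :+ m) := con 4 :* (t :+ con 1) :+ m) refl t m ⟩
      4 * (t + 1) + m                            ≤⟨ +-monoˡ-≤ m (≤-trans (*-monoʳ-≤ 4 (≤-trans (+-monoʳ-≤ t 0<t) 2t≤)) large) ⟩
      m + m                                      ≤⟨ +-monoʳ-≤ m (m≤m+n m (m + (m + 0))) ⟩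
      4 * m                                      ≤⟨ *-monoʳ-≤ 4 bound ⟩
      4 * (s + 1 + T)                            ≡⟨ solve 2 (λ s T → con 4 :* (s :+ con 1 :+ T) := con 4 :* s :+ (con 4 :+ con 4 :* T)) refl s T ⟩
      4 * s + (4 + 4 * T)                        ≤⟨ +-monoʳ-≤ (4 * s) (+-monoʳ-≤ 4 4T≤m) ⟩
      4 * s + (4 + m)                            ∎))
      where
      open ≤-Reasoning
      open +-*-Solver
      P? = λ u → (a ~? u) ×-dec ¬? (b ~? u) ×-dec ¬? (u Fin.≟ b)
      Q? = λ u → (a ~? u) ×-dec ¬? (b ~? u)
      s = # P?
      split₁ : ∀ {u} → CommonNeighbour Γ (a ∷ w ∷ []) u → (a ~ u × ¬ b ~ u) ⊎ CommonNeighbour Γ (a ∷ b ∷ w ∷ []) u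
      split₁ {u} (a~u ∷ w~u ∷ []) with b ~? u
      ... | yes b~u = inj₂ (a~u ∷ b~u ∷ w~u ∷ [])
      ... | no ¬b~u = inj₁ (a~u , ¬b~u)
      split₂ : ∀ {u} → a ~ u × ¬ b ~ u → (a ~ u × ¬ b ~ u × u ≢ b) ⊎ u ≡ b
      split₂ {u} (a~u , ¬b~u) with u Fin.≟ b
      ... | yes u≡b = inj₂ u≡b
      ... | no u≢b  = inj₁ (a~u , ¬b~u , u≢b)
      bound : m ≤ s + 1 + T
      bound = begin
        m                                                       ≤⟨ codeg≥ a w ⟩
        codegree Γ (a ∷ w ∷ [])                                 ≤⟨ count-cover (CommonNeighbour? Γ (a ∷ w ∷ [])) Q? (CommonNeighbour? Γ (a ∷ b ∷ w ∷ [])) split₁ (allFin n) ⟩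
        # Q? + codegree Γ (a ∷ b ∷ w ∷ [])                      ≤⟨ +-mono-≤ (count-cover Q? P? (Fin._≟ b) split₂ (allFin n)) (tricodeg≤ a b w (~⇒≢ a~b) (~⇒≢ a~w) (~⇒≢ b~w)) ⟩
        s + # (Fin._≟ b) + T                                    ≤⟨ +-monoˡ-≤ T (+-monoʳ-≤ s (count-≡ b (Unique.allFin⁺ n))) ⟩
        s + 1 + T                                               ∎

    module _ {a b : Fin n} (a~b : a ~ b) where
      private
        C = commonNeighbours Γ (pair a b)
        X = Cl (Γ -ᴳ C)
        open Cohomology 𝔽₂ X

        indicator : Cochain
        indicator τ = does (Vec.≡-dec Bool._≟_ τ (pair a b))

        at-pair : indicator (pair a b) ≡ true
        at-pair = dec-true (Vec.≡-dec Bool._≟_ (pair a b) (pair a b)) refl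

        elsewhere : ∀ {τ} → τ ≢ pair a b → indicator τ ≡ false
        elsewhere {τ} = dec-false (Vec.≡-dec Bool._≟_ τ (pair a b))

        ∉C⇒∈W : ∀ {x} → x ∉ C → x ∈ V (Γ -ᴳ C)
        ∉C⇒∈W {x} = x∈p∧x∉q⇒x∈p─q (∈V x)

        ∉C : ∀ {x} → ¬ (a ~ x × b ~ x) → x ∉ C
        ∉C ¬adj x∈C with ∈-commonNeighbours-pair⁻ Γ x∈C
        ... | a~x ∷ b~x ∷ [] = ¬adj (a~x , b~x)

        isCocycle : Cocycle 1 indicator
        isCocycle σ ((σ⊆W , adjacent) , _) = d-vanish X indicator σ λ {x} x∈σ → elsewhere λ eq →
          let in-pair : ∀ {y} → y ∈ pair a b → y ∈ σ × y ≢ x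
              in-pair {y} y∈ = let y∈′ = subst (y ∈_) (sym eq) y∈
                               in p─q⊆p σ ⁅ x ⁆ y∈′ , λ { refl → x∉p─q σ ⁅ x ⁆ y∈′ (x∈⁅x⁆ x) }
              a∈σ , a≢x = in-pair (∈-pairˡ a b)
              b∈σ , b≢x = in-pair (∈-pairʳ a b)
          in x∉p─q (V Γ) C (σ⊆W x∈σ) (∈-commonNeighbours-pair⁺ Γ
               (proj₁ (adjacent a x a∈σ x∈σ a≢x) ∷ proj₁ (adjacent b x b∈σ x∈σ b≢x) ∷ []))

        -- A vertex adjacent to only one of `a` and `b` lies outside `C`, so the path survives the
        -- deletion. The outcome `u ≡ v` of `joined-sets` is impossible, as `u` is adjacent to `a`
        -- and `v` is not.
        path : ∃₂ λ u v → (a ~ u × ¬ b ~ u × u ≢ b) × (b ~ v × ¬ a ~ v × v ≢ a) × u ~ v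
        path with joined-sets {Γ = Γ} {t = t} joined (λ u → (a ~? u) ×-dec ¬? (b ~? u) ×-dec ¬? (u Fin.≟ b))
                    (λ v → (b ~? v) ×-dec ¬? (a ~? v) ×-dec ¬? (v Fin.≟ a))
                    (private-neighbours a~b) (private-neighbours (~-sym a~b))
        ... | u , v , pu , pv , inj₂ u~v = u , v , pu , pv , u~v
        ... | u , .u , (a~u , _) , (_ , ¬a~u , _) , inj₁ refl = contradiction a~u ¬a~u

        notCoboundary : ¬ Cohomologous 1 indicator (λ _ → false)
        notCoboundary (g , dg) with path
        ... | u , v , (a~u , ¬b~u , u≢b) , (b~v , ¬a~v , v≢a) , u~v =
          xor-path (g ⁅ a ⁆) (g ⁅ u ⁆) (g ⁅ v ⁆) (g ⁅ b ⁆)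
            (trans (sym (on-edge a~u a∉C u∉C)) (elsewhere (off-pair (∈-pairʳ a u) u≢a u≢b)))
            (trans (sym (on-edge u~v u∉C v∉C)) (elsewhere (off-pair (∈-pairˡ u v) u≢a u≢b)))
            (trans (sym (on-edge (~-sym b~v) v∉C b∉C)) (elsewhere (off-pair (∈-pairˡ v b) v≢a (~⇒≢ (~-sym b~v)))))
            (trans (sym (on-edge a~b a∉C b∉C)) at-pair)
          where
          a∉C : a ∉ C
          a∉C = ∉C (~-irrefl ∘ proj₁)
          b∉C : b ∉ C
          b∉C = ∉C (~-irrefl ∘ proj₂)
          u∉C : u ∉ C
          u∉C = ∉C (¬b~u ∘ proj₂)
          v∉C : v ∉ C
          v∉C = ∉C (¬a~v ∘ proj₁)
          u≢a : u ≢ a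
          u≢a = ~⇒≢ (~-sym a~u)
          off-pair : ∀ {x τ} → x ∈ τ → x ≢ a → x ≢ b → τ ≢ pair a b
          off-pair x∈ x≢a x≢b refl = [ x≢a , x≢b ]′ (∈-pair⁻ a b x∈)
          on-edge : ∀ {x y} → x ~ y → x ∉ C → y ∉ C → indicator (pair x y) ≡ g ⁅ x ⁆ xor g ⁅ y ⁆
          on-edge {x} {y} x~y x∉C y∉C = trans (sym (Bool.xor-identityʳ (indicator (pair x y)))) (trans
            (dg (pair x y) (edge-simplex (Γ -ᴳ C) (x~y , ∉C⇒∈W x∉C , ∉C⇒∈W y∉C)))
            (d-pair X g (~⇒≢ x~y)))

      cut-edge : H̃[ 1 , 𝔽₂ ]≢0 X
      cut-edge = indicator , isCocycle , notCoboundary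

    module _ {C : Subset n} (C≤M : ∣ C ∣ ≤ M) (C< : ∀ u v → u ~ v → ∣ C ∣ < codegree Γ (u ∷ v ∷ [])) where
      private
        X = Cl (Γ -ᴳ C)
        open Cohomology 𝔽₂ X

        ∉C⇒∈W : ∀ {x} → x ∉ C → x ∈ V (Γ -ᴳ C)
        ∉C⇒∈W {x} = x∈p∧x∉q⇒x∈p─q (∈V x)

        -- A 0-cochain is given on all subsets, so `g` has to be extended from singletons; any
        -- extension would do, and this one is the disjunction of `g` over `τ`.
        support : (Fin n → Bool) → Cochain
        support g τ = does (Fin.any? (λ v → (v ∈? τ) ×-dec (g v Bool.≟ true)))

        support-vertex : ∀ g v → support g ⁅ v ⁆ ≡ g v
        support-vertex g v with g v in eq
        ... | true  = dec-true (Fin.any? (λ w → (w ∈? ⁅ v ⁆) ×-dec (g w Bool.≟ true))) (v , x∈⁅x⁆ v , eq)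
        ... | false = dec-false (Fin.any? (λ w → (w ∈? ⁅ v ⁆) ×-dec (g w Bool.≟ true)))
          (λ (w , w∈ , gw) → contradiction (trans (sym gw) (trans (cong g (x∈⁅y⁆⇒x≡y v w∈)) eq)) λ ())

      robust : ¬ H̃[ 1 , 𝔽₂ ]≢0 X
      robust (z , isCocycle , notCoboundary) = notCoboundary (support g , λ σ simplex →
        let u , v , (u~v , u∈W , v∈W) , σ≡ = simplex-edge (Γ -ᴳ C) simplex
        in begin
          z σ xor false                              ≡⟨ Bool.xor-identityʳ (z σ) ⟩
          z σ                                        ≡⟨ cong z σ≡ ⟩
          z (pair u v)                               ≡⟨ dg u v (x∉p─q (V Γ) C u∈W) (x∉p─q (V Γ) C v∈W) u~v ⟩
          g u xor g v                                ≡⟨ cong₂ _xor_ (support-vertex g u) (support-vertex g v) ⟨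
          support g ⁅ u ⁆ xor support g ⁅ v ⁆        ≡⟨ d-pair X (support g) (~⇒≢ u~v) ⟨
          d (support g) (pair u v)                   ≡⟨ cong (d (support g)) σ≡ ⟨
          d (support g) σ                            ∎)
        where
        open ≡-Reasoning
        size : # (_∈? C) ≡ ∣ C ∣
        size = length-elements C
        triangle : ∀ u v w → u ∉ C → v ∉ C → w ∉ C → u ~ v → v ~ w → u ~ w → z (pair u w) ≡ z (pair u v) xor z (pair v w)
        triangle u v w u∉C v∉C w∉C u~v v~w u~w = d-triple z (~⇒≢ u~v) (~⇒≢ u~w) (~⇒≢ v~w)
          (isCocycle (triple u v w) (triangle-simplex (Γ -ᴳ C)
            (u~v , ∉C⇒∈W u∉C , ∉C⇒∈W v∉C) (v~w , ∉C⇒∈W v∉C , ∉C⇒∈W w∉C) (u~w , ∉C⇒∈W u∉C , ∉C⇒∈W w∉C)))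
        potential : ∃ λ (g : Fin n → Bool) → ∀ u v → u ∉ C → v ∉ C → u ~ v → z (pair u v) ≡ g u xor g v
        potential = Vanishing.coboundary R 4T≤m large sparse (_∈? C) (subst (_≤ M) (sym size) C≤M)
          (λ u v u~v → subst (_< codegree Γ (u ∷ v ∷ [])) (sym size) (C< u v u~v)) (λ u v → z (pair u v)) triangle
        g = proj₁ potential
        dg = proj₂ potential

    private
      codegree-∈ : ∀ {u v} → u ~ v → codegree Γ (u ∷ v ∷ []) ∈ˡ
        map (λ I → ∣ commonNeighbours Γ I ∣) (filter (SimplicialComplex.Simplex? (Cl Γ) 1) (subsets n))
      codegree-∈ {u} {v} u~v = subst (_∈ˡ _) (∣commonNeighbours∣ Γ u v)
        (∈-map⁺ (λ I → ∣ commonNeighbours Γ I ∣) (∈-filter⁺ (SimplicialComplex.Simplex? (Cl Γ) 1) (∈-subsets (pair u v)) (edge-simplex Γ u~v)))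

      codegrees = map (λ I → ∣ commonNeighbours Γ I ∣) (filter (SimplicialComplex.Simplex? (Cl Γ) 1) (subsets n))

      -- `cut-edge` attains the value at the common neighbourhood of `a` and `b`; `robust` excludes
      -- smaller sets. Its hypothesis `|C| ≤ M` comes from the codegree of the edge `ab` itself.
      κ-at : ∀ {k a b} → a ~ b → All (k ≤_) codegrees → k ≡ ∣ commonNeighbours Γ (pair a b) ∣ → κ[ 1 ,𝔽₂] Γ ≡ [ k ]
      κ-at {k} {a} {b} a~b k≤ k≡ = min-least attained minimal
        where
        Cut? : Decidable (λ C → C ⊆ V Γ × H̃[ 1 , 𝔽₂ ]≢0 (Cl (Γ -ᴳ C)))
        Cut? C = (C ⊆? V Γ) ×-dec H̃[ 1 ,𝔽₂]≢0? (Cl (Γ -ᴳ C))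
        attained : k ∈ˡ map ∣_∣ (filter Cut? (subsets n))
        attained = subst (_∈ˡ map ∣_∣ (filter Cut? (subsets n))) (sym k≡) (∈-map⁺ ∣_∣
          (∈-filter⁺ Cut? (∈-subsets (commonNeighbours Γ (pair a b))) ((λ _ → ∈V _) , cut-edge a~b)))
        minimal : All (k ≤_) (map ∣_∣ (filter Cut? (subsets n)))
        minimal = All.tabulate λ l∈ → let C , C∈ , l≡ = ∈-map⁻ ∣_∣ l∈ in
          subst (k ≤_) (sym l≡) (≮⇒≥ λ C<k →
            let C<codegree : ∀ u v → u ~ v → ∣ C ∣ < codegree Γ (u ∷ v ∷ [])
                C<codegree u v u~v = <-≤-trans C<k (All.lookup k≤ (codegree-∈ u~v))
                C≤M = ≤-trans (<⇒≤ (C<codegree a b a~b)) (codeg≤ a b (~⇒≢ a~b))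
            in robust C≤M C<codegree (proj₂ (proj₂ (∈-filter⁻ Cut? {xs = subsets n} C∈))))

    κ≡δ : κ[ 1 ,𝔽₂] Γ ≡ δ[ 1 ] Γ
    κ≡δ =
      -- The existence of an edge makes the list of codegrees nonempty, so `δ` is finite.
      let k , δ≡k , k∈ , k≤ = min-∈ (codegree-∈ (proj₂ (proj₂ edge)))
          I , I∈ , k≡ = ∈-map⁻ (λ I → ∣ commonNeighbours Γ I ∣) k∈
          a , b , a~b , I≡ = simplex-edge Γ (proj₂ (∈-filter⁻ (SimplicialComplex.Simplex? (Cl Γ) 1) {xs = subsets n} I∈))
      in trans (κ-at a~b k≤ (trans k≡ (cong (λ I → ∣ commonNeighbours Γ I ∣) I≡))) (sym δ≡k)

open Combinatorics
open import Data.Rational hiding (_<?_)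
open import Data.Rational.Properties hiding (_<?_)
open import Data.Rational.Solver using (module +-*-Solver)
import Algebra.Properties.CommutativeSemiring.Exp (CommutativeRing.commutativeSemiring +-*-commutativeRing) as Exp
import Algebra.Properties.Semiring.Exp (CommutativeRing.semiring +-*-commutativeRing) as SExp
open Exp using () renaming (_^_ to infixr 8 _↑_)

-- Powers and finite products of rationals.

*-nonneg : ∀ {p q} → 0ℚ ≤ p → 0ℚ ≤ q → 0ℚ ≤ p * q
*-nonneg {p} {q} 0≤p 0≤q = subst (_≤ p * q) (*-zeroˡ q) (*-monoʳ-≤-nonNeg q {{nonNegative 0≤q}} 0≤p)

*-mono-≤ : ∀ {p q r s} → 0ℚ ≤ q → 0ℚ ≤ r → p ≤ q → r ≤ s → p * r ≤ q * s
*-mono-≤ {p} {q} {r} {s} 0≤q 0≤r p≤q r≤s = ≤-trans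
  (*-monoʳ-≤-nonNeg r {{nonNegative 0≤r}} p≤q) (*-monoˡ-≤-nonNeg q {{nonNegative 0≤q}} r≤s)

0≤1 : 0ℚ ≤ 1ℚ
0≤1 = <⇒≤ (positive⁻¹ 1ℚ)

↑-nonneg : ∀ {p} → 0ℚ ≤ p → ∀ k → 0ℚ ≤ p ↑ k
↑-nonneg 0≤p zero    = 0≤1
↑-nonneg 0≤p (suc k) = *-nonneg 0≤p (↑-nonneg 0≤p k)

∏[_] : ∀ {A : Set} → List A → (A → ℚ) → ℚ
∏[ as ] f = foldr (λ a r → f a * r) 1ℚ as

∏-const : ∀ {A : Set} (f : A → ℚ) {y} as → (∀ {a} → a ∈ˡ as → f a ≡ y) → ∏[ as ] f ≡ y ↑ length as
∏-const f []       eq = refl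
∏-const f (a ∷ as) eq = cong₂ _*_ (eq (here refl)) (∏-const f as (eq ∘ there))

∏-count : ∀ {A : Set} {P : Pred A 0ℓ} (P? : Decidable P) (f : A → ℚ) {y} as →
          (∀ {a} → a ∈ˡ as → P a → f a ≡ y) → (∀ {a} → a ∈ˡ as → ¬ P a → f a ≡ 1ℚ) →
          ∏[ as ] f ≡ y ↑ count P? as
∏-count P? f []       eq₁ eq₀ = refl
∏-count P? f {y} (a ∷ as) eq₁ eq₀ with ih ← ∏-count P? f as (eq₁ ∘ there) (eq₀ ∘ there) | P? a
... | yes p = cong₂ _*_ (eq₁ (here refl) p) ih
... | no ¬p = trans (cong₂ _*_ (eq₀ (here refl) ¬p) ih) (*-identityˡ (y ↑ count P? as))

-- Expectations of multiaffine functions of a random edge set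

Edge : ℕ → Set
Edge n = Fin n × Fin n

module _ {n : ℕ} where
  infix 4 _≟ᴱ_
  _≟ᴱ_ : ∀ (e f : Edge n) → Dec (e ≡ f)
  _≟ᴱ_ = ×-≡-dec Fin._≟_ Fin._≟_

  update : (Edge n → ℚ) → Edge n → ℚ → Edge n → ℚ
  update X e a f with e ≟ᴱ f
  ... | yes _ = a
  ... | no _  = X f

  update-≡ : ∀ X e a → update X e a e ≡ a
  update-≡ X e a with e ≟ᴱ e
  ... | yes _ = refl
  ... | no e≢e = contradiction refl e≢e

  update-≢ : ∀ X {e f} a → e ≢ f → update X e a f ≡ X f
  update-≢ X {e} {f} a e≢f with e ≟ᴱ f
  ... | yes e≡f = contradiction e≡f e≢f
  ... | no _    = refl

  -- The support `S` expresses independence: functions with disjoint supports may be multiplied.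
  -- `local` moreover identifies the values at pointwise equal arguments, which allows updates to be
  -- reordered.
  record Multiaffine (S : Pred (Edge n) 0ℓ) (Φ : (Edge n → ℚ) → ℚ) : Set where
    field
      support? : Decidable S
      local    : ∀ {X Y} → (∀ {e} → S e → X e ≡ Y e) → Φ X ≡ Φ Y
      affine   : ∀ X e a → Φ (update X e a) ≡ a * Φ (update X e 1ℚ) + (1ℚ - a) * Φ (update X e 0ℚ)

    independent : ∀ X {e} a → ¬ S e → Φ (update X e a) ≡ Φ X
    independent X {e} a ¬Se = local λ Sf → update-≢ X {e} a λ { refl → ¬Se Sf }

  open Multiaffine

  private
    constant-affine : ∀ a k → k ≡ a * k + (1ℚ - a) * k
    constant-affine = solve 2 (λ a k → k := a :* k :+ (con 1ℚ :- a) :* k) refl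
      where open +-*-Solver

  coordinate : ∀ e → Multiaffine (e ≡_) (λ X → X e)
  coordinate e .support? f = e ≟ᴱ f
  coordinate e .local X≡Y  = X≡Y refl
  coordinate e .affine X f a with f ≟ᴱ e
  ... | yes _ = solve 1 (λ a → a := a :* con 1ℚ :+ (con 1ℚ :- a) :* con 0ℚ) refl a
    where open +-*-Solver
  ... | no _  = constant-affine a (X e)

  affine-image : ∀ {S Φ} c d → Multiaffine S Φ → Multiaffine S (λ X → c + d * Φ X)
  affine-image c d MA .support? = MA .support?
  affine-image c d MA .local X≡Y = cong (λ z → c + d * z) (MA .local X≡Y)
  affine-image {Φ = Φ} c d MA .affine X e a = trans (cong (λ z → c + d * z) (MA .affine X e a))
    (solve 5 (λ c d a u v → c :+ d :* (a :* u :+ (con 1ℚ :- a) :* v) := a :* (c :+ d :* u) :+ (con 1ℚ :- a) :* (c :+ d :* v))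
      refl c d a (Φ (update X e 1ℚ)) (Φ (update X e 0ℚ)))
    where open +-*-Solver

  -- An edge can move only one of the two factors; the other is constant in it and passes through
  -- the affine identity.
  product : ∀ {S T Φ Ψ} → Multiaffine S Φ → Multiaffine T Ψ → (∀ {e} → S e → ¬ T e) →
            Multiaffine (λ e → S e ⊎ T e) (λ X → Φ X * Ψ X)
  product MA MB disjoint .support? e = MA .support? e ⊎-dec MB .support? e
  product MA MB disjoint .local X≡Y = cong₂ _*_ (MA .local (X≡Y ∘ inj₁)) (MB .local (X≡Y ∘ inj₂))
  product {Φ = Φ} {Ψ} MA MB disjoint .affine X e a with MA .support? e
  ... | yes Se = begin
    Φ (update X e a) * Ψ (update X e a)                  ≡⟨ cong₂ _*_ (MA .affine X e a) (independent MB X a ¬Te) ⟩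
    (a * u + (1ℚ - a) * v) * Ψ X                         ≡⟨ solve 4 (λ a u v w → (a :* u :+ (con 1ℚ :- a) :* v) :* w := a :* (u :* w) :+ (con 1ℚ :- a) :* (v :* w)) refl a u v (Ψ X) ⟩
    a * (u * Ψ X) + (1ℚ - a) * (v * Ψ X)                 ≡⟨ cong₂ (λ w w′ → a * (u * w) + (1ℚ - a) * (v * w′)) (independent MB X 1ℚ ¬Te) (independent MB X 0ℚ ¬Te) ⟨
    a * (u * Ψ (update X e 1ℚ)) + (1ℚ - a) * (v * Ψ (update X e 0ℚ)) ∎
    where
    open ≡-Reasoning
    open +-*-Solver
    ¬Te = disjoint Se
    u = Φ (update X e 1ℚ)
    v = Φ (update X e 0ℚ)
  ... | no ¬Se = begin
    Φ (update X e a) * Ψ (update X e a)                  ≡⟨ cong₂ _*_ (independent MA X a ¬Se) (MB .affine X e a) ⟩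
    Φ X * (a * u + (1ℚ - a) * v)                         ≡⟨ solve 4 (λ a u v w → w :* (a :* u :+ (con 1ℚ :- a) :* v) := a :* (w :* u) :+ (con 1ℚ :- a) :* (w :* v)) refl a u v (Φ X) ⟩
    a * (Φ X * u) + (1ℚ - a) * (Φ X * v)                 ≡⟨ cong₂ (λ w w′ → a * (w * u) + (1ℚ - a) * (w′ * v)) (independent MA X 1ℚ ¬Se) (independent MA X 0ℚ ¬Se) ⟨
    a * (Φ (update X e 1ℚ) * u) + (1ℚ - a) * (Φ (update X e 0ℚ) * v) ∎
    where
    open ≡-Reasoning
    open +-*-Solver
    u = Ψ (update X e 1ℚ)
    v = Ψ (update X e 0ℚ)

  resupport : ∀ {S T Φ} → (∀ {e} → S e → T e) → (∀ {e} → T e → S e) → Multiaffine S Φ → Multiaffine T Φ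
  resupport S⊆T T⊆S MA .support? e with MA .support? e
  ... | yes s = yes (S⊆T s)
  ... | no ¬s = no (¬s ∘ T⊆S)
  resupport S⊆T T⊆S MA .local X≡Y = MA .local (X≡Y ∘ S⊆T)
  resupport S⊆T T⊆S MA .affine = MA .affine

  multiaffine-∏ : ∀ {A : Set} {S : A → Pred (Edge n) 0ℓ} {Φ : A → (Edge n → ℚ) → ℚ} as → Unique as →
    (∀ {a} → a ∈ˡ as → Multiaffine (S a) (Φ a)) →
    (∀ {a a′ e} → a ∈ˡ as → a′ ∈ˡ as → S a e → S a′ e → a ≡ a′) →
    Multiaffine (λ e → Any (λ a → S a e) as) (λ X → ∏[ as ] (λ a → Φ a X))
  multiaffine-∏ [] _ _ _ .support? e = no λ ()
  multiaffine-∏ [] _ _ _ .local _ = refl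
  multiaffine-∏ [] _ _ _ .affine X e a = constant-affine a 1ℚ
  multiaffine-∏ {S = S} (a ∷ as) (a∉as ∷ unique) MA inj = resupport
    [ here , there ]′ (λ { (here s) → inj₁ s ; (there s) → inj₂ s })
    (product (MA (here refl)) (multiaffine-∏ as unique (MA ∘ there) (λ a∈ a′∈ → inj (there a∈) (there a′∈)))
      λ s any → clash s any a∉as id)
    where
    clash : ∀ {e bs} → S a e → Any (λ b → S b e) bs → All (a ≢_) bs → (∀ {b} → b ∈ˡ bs → b ∈ˡ as) → ⊥
    clash s (here s′)   (a≢b ∷ _) ⊆as = a≢b (inj (here refl) (there (⊆as (here refl))) s s′)
    clash s (there any) (_ ∷ a≢)  ⊆as = clash s any a≢ (⊆as ∘ there)

  -- For `a = 1` this is the indicator of an outcome; for `a = x` and the full edge list it is the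
  -- point whose coordinates are the edge probabilities. Building it by updates lets an induction
  -- peel off one edge at a time.
  indicator : ℚ → List (Edge n) → Edge n → ℚ
  indicator a []      _ = 0ℚ
  indicator a (e ∷ E)   = update (indicator a E) e a

  indicator-∈ : ∀ a {E e} → e ∈ˡ E → indicator a E e ≡ a
  indicator-∈ a {f ∷ E} {e} e∈ with f ≟ᴱ e
  ... | yes _ = refl
  indicator-∈ a {f ∷ E} (here refl) | no f≢f = contradiction refl f≢f
  indicator-∈ a {f ∷ E} (there e∈) | no _    = indicator-∈ a e∈

  indicator-∉ : ∀ a {E e} → e ∉ˡ E → indicator a E e ≡ 0ℚ
  indicator-∉ a {[]}    {e} e∉ = refl
  indicator-∉ a {f ∷ E} {e} e∉ with f ≟ᴱ e
  ... | yes refl = contradiction (here refl) e∉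
  ... | no _     = indicator-∉ a (e∉ ∘ there)

  -- This is the function that remains once the edge `e` is known to be present. It is constant in
  -- the coordinate `e`, and updates at other edges commute with fixing `e`.
  specialise : ∀ {S Φ} e → Multiaffine S Φ → Multiaffine S (λ X → Φ (update X e 1ℚ))
  specialise e MA .support? = MA .support?
  specialise {S} {Φ} e MA .local {X} {Y} X≡Y = MA .local agree
    where
    agree : ∀ {f} → S f → update X e 1ℚ f ≡ update Y e 1ℚ f
    agree {f} Sf with e ≟ᴱ f
    ... | yes _ = refl
    ... | no _  = X≡Y Sf
  specialise {S} {Φ} e MA .affine X f a with f ≟ᴱ e
  ... | yes refl = trans (constant-affine a _) (cong₂ (λ u v → a * u + (1ℚ - a) * v)
      (MA .local λ {g} _ → overwrite g) (MA .local λ {g} _ → overwrite g))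
    where
    overwrite : ∀ {b c} g → update (update X e b) e 1ℚ g ≡ update (update X e c) e 1ℚ g
    overwrite g with e ≟ᴱ g
    ... | yes _   = refl
    ... | no e≢g = trans (update-≢ X _ e≢g) (sym (update-≢ X _ e≢g))
  ... | no f≢e = trans (commute a) (trans (MA .affine (update X e 1ℚ) f a)
      (cong₂ (λ u v → a * u + (1ℚ - a) * v) (sym (commute 1ℚ)) (sym (commute 0ℚ))))
    where
    commute : ∀ b → Φ (update (update X f b) e 1ℚ) ≡ Φ (update (update X e 1ℚ) f b)
    commute b = MA .local λ {g} _ → pointwise g
      where
      pointwise : ∀ g → update (update X f b) e 1ℚ g ≡ update (update X e 1ℚ) f b g
      pointwise g with e ≟ᴱ g
      ... | yes refl = trans (sym (update-≡ X e 1ℚ)) (sym (update-≢ (update X e 1ℚ) b f≢e))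
      ... | no e≢g with f ≟ᴱ g
      ...   | yes _ = refl
      ...   | no _  = sym (update-≢ X 1ℚ e≢g)

  module Expectation (x : ℚ) where
    -- Edges are exposed one after another; the list holds those not yet exposed. Agreement with the
    -- weighted sum over outcomes is `sum-sublists`.
    𝔼 : List (Edge n) → (List (Edge n) → ℚ) → ℚ
    𝔼 []      F = F []
    𝔼 (e ∷ L) F = x * 𝔼 L (F ∘ (e ∷_)) + (1ℚ - x) * 𝔼 L F

    𝔼-const : ∀ L c → 𝔼 L (λ _ → c) ≡ c
    𝔼-const []      c = refl
    𝔼-const (e ∷ L) c = trans (cong₂ (λ u v → x * u + (1ℚ - x) * v) (𝔼-const L c) (𝔼-const L c)) (sym (constant-affine x c))

    𝔼-+ : ∀ L F G → 𝔼 L (λ E → F E + G E) ≡ 𝔼 L F + 𝔼 L G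
    𝔼-+ []      F G = refl
    𝔼-+ (e ∷ L) F G = trans (cong₂ (λ u v → x * u + (1ℚ - x) * v) (𝔼-+ L (F ∘ (e ∷_)) (G ∘ (e ∷_))) (𝔼-+ L F G))
      (solve 5 (λ x a b c d → x :* (a :+ b) :+ (con 1ℚ :- x) :* (c :+ d) := x :* a :+ (con 1ℚ :- x) :* c :+ (x :* b :+ (con 1ℚ :- x) :* d))
        refl x (𝔼 L (F ∘ (e ∷_))) (𝔼 L (G ∘ (e ∷_))) (𝔼 L F) (𝔼 L G))
      where open +-*-Solver

    𝔼-* : ∀ L c F → 𝔼 L (λ E → c * F E) ≡ c * 𝔼 L F
    𝔼-* []      c F = refl
    𝔼-* (e ∷ L) c F = trans (cong₂ (λ u v → x * u + (1ℚ - x) * v) (𝔼-* L c (F ∘ (e ∷_))) (𝔼-* L c F))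
      (solve 4 (λ x c a b → x :* (c :* a) :+ (con 1ℚ :- x) :* (c :* b) := c :* (x :* a :+ (con 1ℚ :- x) :* b))
        refl x c (𝔼 L (F ∘ (e ∷_))) (𝔼 L F))
      where open +-*-Solver

    -- Exposing `e` sets its coordinate to 1 or 0, and affinity recombines the two cases into the
    -- coordinate `x`. Since `e` does not recur in the rest of the list, its coordinate there is
    -- already 0.
    𝔼-multiaffine : ∀ {L S Φ} → Unique L → Multiaffine S Φ → 𝔼 L (λ E → Φ (indicator 1ℚ E)) ≡ Φ (indicator x L)
    𝔼-multiaffine {[]} _ MA = refl
    𝔼-multiaffine {e ∷ L} {S} {Φ} (e∉L ∷ unique) MA = begin
      x * 𝔼 L (λ E → Φ (update (indicator 1ℚ E) e 1ℚ)) + (1ℚ - x) * 𝔼 L (λ E → Φ (indicator 1ℚ E))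
        ≡⟨ cong₂ (λ u v → x * u + (1ℚ - x) * v) (𝔼-multiaffine unique (specialise e MA)) (𝔼-multiaffine unique MA) ⟩
      x * Φ (update (indicator x L) e 1ℚ) + (1ℚ - x) * Φ (indicator x L)
        ≡⟨ cong (λ v → x * Φ (update (indicator x L) e 1ℚ) + (1ℚ - x) * v) (MA .local λ {f} _ → absent f) ⟩
      x * Φ (update (indicator x L) e 1ℚ) + (1ℚ - x) * Φ (update (indicator x L) e 0ℚ)
        ≡⟨ MA .affine (indicator x L) e x ⟨
      Φ (update (indicator x L) e x) ∎
      where
      open ≡-Reasoning
      absent : ∀ f → indicator x L f ≡ update (indicator x L) e 0ℚ f
      absent f with e ≟ᴱ f
      ... | yes refl = indicator-∉ x (λ e∈ → All.lookup e∉L e∈ refl)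
      ... | no _     = refl

    module _ (0≤x : 0ℚ ≤ x) (x≤1 : x ≤ 1ℚ) where
      0≤1-x : 0ℚ ≤ 1ℚ - x
      0≤1-x = subst (_≤ 1ℚ - x) (+-inverseʳ x) (+-monoˡ-≤ (- x) x≤1)

      -- The restriction to `All P E` lets pointwise bounds use that the edges of an outcome are
      -- stored in increasing orientation.
      𝔼-mono : ∀ {P : Pred (Edge n) 0ℓ} {L F G} → All P L → (∀ E → All P E → F E ≤ G E) → 𝔼 L F ≤ 𝔼 L G
      𝔼-mono []       F≤G = F≤G [] []
      𝔼-mono (p ∷ ps) F≤G = +-mono-≤
        (*-monoˡ-≤-nonNeg x {{nonNegative 0≤x}} (𝔼-mono ps (λ E ok → F≤G (_ ∷ E) (p ∷ ok))))
        (*-monoˡ-≤-nonNeg (1ℚ - x) {{nonNegative 0≤1-x}} (𝔼-mono ps F≤G))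

-- Naturals among the rationals, and monotonicity of powers.

ι : ℕ → ℚ
ι k = ℤ.+ k / 1

private
  toℚᵘ-ι : ∀ k → toℚᵘ (ι k) ℚᵘ.≃ ℚᵘ.mkℚᵘ (ℤ.+ k) 0
  toℚᵘ-ι k = toℚᵘ-fromℚᵘ (ℚᵘ.mkℚᵘ (ℤ.+ k) 0)

ι-+ : ∀ j k → ι (j ℕ.+ k) ≡ ι j + ι k
ι-+ j k = toℚᵘ-injective (begin
  toℚᵘ (ι (j ℕ.+ k))                               ≈⟨ toℚᵘ-ι (j ℕ.+ k) ⟩
  ℚᵘ.mkℚᵘ (ℤ.+ (j ℕ.+ k)) 0                          ≈⟨ ℚᵘ.*≡* (cong (ℤ._* ℤ.+ 1) (sym (cong₂ ℤ._+_ (ℤ.*-identityʳ (ℤ.+ j)) (ℤ.*-identityʳ (ℤ.+ k))))) ⟩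
  ℚᵘ.mkℚᵘ (ℤ.+ j) 0 ℚᵘ.+ ℚᵘ.mkℚᵘ (ℤ.+ k) 0             ≈⟨ ℚᵘ.+-cong (toℚᵘ-ι j) (toℚᵘ-ι k) ⟨
  toℚᵘ (ι j) ℚᵘ.+ toℚᵘ (ι k)                       ≈⟨ toℚᵘ-homo-+ (ι j) (ι k) ⟨
  toℚᵘ (ι j + ι k)                                 ∎)
  where open ℚᵘ.≃-Reasoning

ι-* : ∀ j k → ι (j ℕ.* k) ≡ ι j * ι k
ι-* j k = toℚᵘ-injective (begin
  toℚᵘ (ι (j ℕ.* k))                               ≈⟨ toℚᵘ-ι (j ℕ.* k) ⟩
  ℚᵘ.mkℚᵘ (ℤ.+ (j ℕ.* k)) 0                          ≈⟨ ℚᵘ.*≡* (cong (ℤ._* ℤ.+ 1) (ℤ.pos-* j k)) ⟩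
  ℚᵘ.mkℚᵘ (ℤ.+ j) 0 ℚᵘ.* ℚᵘ.mkℚᵘ (ℤ.+ k) 0             ≈⟨ ℚᵘ.*-cong (toℚᵘ-ι j) (toℚᵘ-ι k) ⟨
  toℚᵘ (ι j) ℚᵘ.* toℚᵘ (ι k)                       ≈⟨ toℚᵘ-homo-* (ι j) (ι k) ⟨
  toℚᵘ (ι j * ι k)                                 ∎)
  where open ℚᵘ.≃-Reasoning

ι-suc : ∀ k → ι (suc k) ≡ 1ℚ + ι k
ι-suc = ι-+ 1

ι-nonneg : ∀ k → 0ℚ ≤ ι k
ι-nonneg k = nonNegative⁻¹ (ι k) {{normalize-nonNeg k 1}}

ι-mono : ∀ {j k} → j ℕ.≤ k → ι j ≤ ι k
ι-mono {j} {k} j≤k = begin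
  ι j                    ≡⟨ +-identityʳ (ι j) ⟨
  ι j + 0ℚ               ≤⟨ +-monoʳ-≤ (ι j) (ι-nonneg (k ℕ.∸ j)) ⟩
  ι j + ι (k ℕ.∸ j)      ≡⟨ ι-+ j (k ℕ.∸ j) ⟨
  ι (j ℕ.+ (k ℕ.∸ j))    ≡⟨ cong ι (ℕ.m+[n∸m]≡n j≤k) ⟩
  ι k                    ∎
  where open ≤-Reasoning

ι-cancel : ∀ {j k} → ι j ≤ ι k → j ℕ.≤ k
ι-cancel {j} {k} ιj≤ιk = ℕ.≮⇒≥ λ k<j → <-irrefl refl (begin-strict
  ι k            ≡⟨ +-identityˡ (ι k) ⟨
  0ℚ + ι k       <⟨ +-monoˡ-< (ι k) (positive⁻¹ 1ℚ) ⟩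
  1ℚ + ι k       ≡⟨ ι-suc k ⟨
  ι (suc k)      ≤⟨ ι-mono k<j ⟩
  ι j            ≤⟨ ιj≤ιk ⟩
  ι k            ∎)
  where open ≤-Reasoning

ι-^ : ∀ j k → ι (j ℕ.^ k) ≡ ι j ↑ k
ι-^ j zero    = refl
ι-^ j (suc k) = trans (ι-* j (j ℕ.^ k)) (cong (ι j *_) (ι-^ j k))

∏-nonneg : ∀ {A : Set} (f : A → ℚ) as → (∀ {a} → a ∈ˡ as → 0ℚ ≤ f a) → 0ℚ ≤ ∏[ as ] f
∏-nonneg f []       _   = 0≤1
∏-nonneg f (a ∷ as) 0≤f = *-nonneg (0≤f (here refl)) (∏-nonneg f as (0≤f ∘ there))

∏-zero : ∀ {A : Set} (f : A → ℚ) {a as} → a ∈ˡ as → f a ≡ 0ℚ → ∏[ as ] f ≡ 0ℚ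
∏-zero f {as = _ ∷ as} (here refl) eq = trans (cong (_* ∏[ as ] f) eq) (*-zeroˡ (∏[ as ] f))
∏-zero f {as = b ∷ as} (there a∈)  eq = trans (cong (f b *_) (∏-zero f a∈ eq)) (*-zeroʳ (f b))

1↑ : ∀ k → 1ℚ ↑ k ≡ 1ℚ
1↑ zero    = refl
1↑ (suc k) = trans (*-identityˡ (1ℚ ↑ k)) (1↑ k)

∏-one : ∀ {A : Set} (f : A → ℚ) as → (∀ {a} → a ∈ˡ as → f a ≡ 1ℚ) → ∏[ as ] f ≡ 1ℚ
∏-one f as eq = trans (∏-const f as eq) (1↑ (length as))

0≤½ : 0ℚ ≤ ½
0≤½ = <⇒≤ (positive⁻¹ ½)

0≤2 : 0ℚ ≤ 1ℚ + 1ℚ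
0≤2 = <⇒≤ (positive⁻¹ (1ℚ + 1ℚ))

p≤p+q : ∀ {p q} → 0ℚ ≤ q → p ≤ p + q
p≤p+q {p} {q} 0≤q = subst (_≤ p + q) (+-identityʳ p) (+-monoʳ-≤ p 0≤q)

p≤q⇒0≤q-p : ∀ {p q} → p ≤ q → 0ℚ ≤ q - p
p≤q⇒0≤q-p {p} {q} p≤q = subst (_≤ q - p) (+-inverseʳ p) (+-monoˡ-≤ (- p) p≤q)

1-≤1 : ∀ {p} → 0ℚ ≤ p → 1ℚ - p ≤ 1ℚ
1-≤1 {p} 0≤p = subst (1ℚ - p ≤_) (+-identityʳ 1ℚ) (+-monoʳ-≤ 1ℚ (neg-antimono-≤ 0≤p))

↑≤1 : ∀ {p} → 0ℚ ≤ p → p ≤ 1ℚ → ∀ k → p ↑ k ≤ 1ℚ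
↑≤1 0≤p p≤1 zero    = ≤-refl
↑≤1 0≤p p≤1 (suc k) = *-mono-≤ 0≤1 (↑-nonneg 0≤p k) p≤1 (↑≤1 0≤p p≤1 k)

1≤↑ : ∀ {p} → 1ℚ ≤ p → ∀ k → 1ℚ ≤ p ↑ k
1≤↑ 1≤p zero    = ≤-refl
1≤↑ 1≤p (suc k) = *-mono-≤ (≤-trans 0≤1 1≤p) 0≤1 1≤p (1≤↑ 1≤p k)

↑-monoʳ : ∀ {p j k} → 1ℚ ≤ p → j ℕ.≤ k → p ↑ j ≤ p ↑ k
↑-monoʳ {k = k} 1≤p z≤n = 1≤↑ 1≤p k
↑-monoʳ {p} 1≤p (s≤s j≤k) = *-monoˡ-≤-nonNeg p {{nonNegative (≤-trans 0≤1 1≤p)}} (↑-monoʳ 1≤p j≤k)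

↑-antimonoʳ : ∀ {p j k} → 0ℚ ≤ p → p ≤ 1ℚ → j ℕ.≤ k → p ↑ k ≤ p ↑ j
↑-antimonoʳ {k = k} 0≤p p≤1 z≤n = ↑≤1 0≤p p≤1 k
↑-antimonoʳ {p} 0≤p p≤1 (s≤s j≤k) = *-monoˡ-≤-nonNeg p {{nonNegative 0≤p}} (↑-antimonoʳ 0≤p p≤1 j≤k)

<⇒≱ : ∀ {p q} → p < q → ¬ (q ≤ p)
<⇒≱ p<q q≤p = <-irrefl refl (<-≤-trans p<q q≤p)

-- Every unordered pair is represented by its increasing orientation, as in possibleEdges.
edge : ∀ {n} → Fin n → Fin n → Edge n
edge u v with u Fin.<? v
... | yes _ = u , v
... | no _  = v , u

edge-≡ : ∀ {n} (u v u′ v′ : Fin n) → edge u v ≡ edge u′ v′ → (u ≡ u′ × v ≡ v′) ⊎ (u ≡ v′ × v ≡ u′)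
edge-≡ u v u′ v′ eq with u Fin.<? v | u′ Fin.<? v′ | eq
... | yes _ | yes _ | refl = inj₁ (refl , refl)
... | yes _ | no _  | refl = inj₂ (refl , refl)
... | no _  | yes _ | refl = inj₂ (refl , refl)
... | no _  | no _  | refl = inj₁ (refl , refl)

Ordered : ∀ {n} → Edge n → Set
Ordered (u , v) = u Fin.< v

module _ {n : ℕ} where
  open DecMembership (_≟ᴱ_ {n}) using () renaming (_∈?_ to _∈ˡ?_)

  possibleEdges-ordered : All Ordered (possibleEdges n)
  possibleEdges-ordered = All.all-filter (λ (u , v) → u Fin.<? v) (cartesianProduct (allFin n) (allFin n))

  possibleEdges-unique : Unique (possibleEdges n)
  possibleEdges-unique = Unique.filter⁺ (λ (u , v) → u Fin.<? v)
    (Unique.cartesianProduct⁺ (Unique.allFin⁺ n) (Unique.allFin⁺ n))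

  edge-possible : ∀ {u v} → u ≢ v → edge u v ∈ˡ possibleEdges n
  edge-possible {u} {v} u≢v with u Fin.<? v
  ... | yes u<v = ∈-filter⁺ (λ (u , v) → u Fin.<? v) (∈-cartesianProduct⁺ (∈-allFin u) (∈-allFin v)) u<v
  ... | no u≮v  = ∈-filter⁺ (λ (u , v) → u Fin.<? v) (∈-cartesianProduct⁺ (∈-allFin v) (∈-allFin u))
                    (ℕ.≤∧≢⇒< (ℕ.≮⇒≥ u≮v) (λ eq → u≢v (sym (Fin.toℕ-injective eq))))

  _~⟨_⟩_ : Fin n → List (Edge n) → Fin n → Set
  u ~⟨ E ⟩ v = Graph._~_ (graph E) u v

  module _ {E : List (Edge n)} (ordered : All Ordered E) where
    indicator-adjacent : ∀ {u v} → u ~⟨ E ⟩ v → indicator 1ℚ E (edge u v) ≡ 1ℚ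
    indicator-adjacent {u} {v} (u≢v , uv∈) = indicator-∈ 1ℚ (edge∈ uv∈)
      where
      edge∈ : (u , v) ∈ˡ E ⊎ (v , u) ∈ˡ E → edge u v ∈ˡ E
      edge∈ uv∈ with u Fin.<? v | uv∈
      ... | yes _   | inj₁ p = p
      ... | yes u<v | inj₂ p = contradiction u<v (ℕ.<-asym (All.lookup ordered p))
      ... | no u≮v  | inj₁ p = contradiction (All.lookup ordered p) u≮v
      ... | no _    | inj₂ p = p

    indicator-nonadjacent : ∀ {u v} → u ≢ v → ¬ u ~⟨ E ⟩ v → indicator 1ℚ E (edge u v) ≡ 0ℚ
    indicator-nonadjacent {u} {v} u≢v ¬adj = indicator-∉ 1ℚ (λ e∈ → ¬adj (u≢v , ∈edge e∈))
      where
      ∈edge : edge u v ∈ˡ E → (u , v) ∈ˡ E ⊎ (v , u) ∈ˡ E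
      ∈edge e∈ with u Fin.<? v
      ... | yes _ = inj₁ e∈
      ... | no _  = inj₂ e∈

  indicator-possible : ∀ x {u v} → u ≢ v → indicator x (possibleEdges n) (edge u v) ≡ x
  indicator-possible x u≢v = indicator-∈ x (edge-possible u≢v)

  Spokes : List (Fin n) → Fin n → Pred (Edge n) 0ℓ
  Spokes bs a e = Any (λ b → edge a b ≡ e) bs

  monomial : List (Fin n) → Fin n → (Edge n → ℚ) → ℚ
  monomial bs a X = ∏[ bs ] (λ b → X (edge a b))

  -- `φ` is `1 - z` for crossing edges and the identity for common neighbours.
  star-multiaffine : ∀ {φ : ℚ → ℚ} a {bs} → Unique bs → a ∉ˡ bs →
    (∀ b → Multiaffine (edge a b ≡_) (λ X → φ (X (edge a b)))) →
    Multiaffine (Spokes bs a) (λ X → ∏[ bs ] (λ b → φ (X (edge a b))))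
  star-multiaffine a {bs} unique a∉bs MA = multiaffine-∏ bs unique (λ {b} _ → MA b) same
    where
    same : ∀ {b b′ e} → b ∈ˡ bs → b′ ∈ˡ bs → edge a b ≡ e → edge a b′ ≡ e → b ≡ b′
    same {b} {b′} b∈ _ p q with edge-≡ a b a b′ (trans p (sym q))
    ... | inj₁ (_ , b≡b′) = b≡b′
    ... | inj₂ (_ , refl) = contradiction b∈ a∉bs

  -- An edge between `as` and `bs` determines its end in `as`, because no vertex of `as` is in `bs`;
  -- hence different stars have no edge in common.
  stars-multiaffine : ∀ {Φ : Fin n → (Edge n → ℚ) → ℚ} {as bs} → Unique as → (∀ {a} → a ∈ˡ as → a ∉ˡ bs) →
    (∀ {a} → a ∈ˡ as → Multiaffine (Spokes bs a) (Φ a)) →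
    Multiaffine (λ e → Any (λ a → Spokes bs a e) as) (λ X → ∏[ as ] (λ a → Φ a X))
  stars-multiaffine {as = as} {bs} unique disjoint MA = multiaffine-∏ as unique MA same
    where
    same : ∀ {a a′ e} → a ∈ˡ as → a′ ∈ˡ as → Spokes bs a e → Spokes bs a′ e → a ≡ a′
    same {a} {a′} a∈ a′∈ s s′ with find s | find s′
    ... | b , b∈ , p | b′ , b′∈ , q with edge-≡ a b a′ b′ (trans p (sym q))
    ...   | inj₁ (a≡a′ , _)  = a≡a′
    ...   | inj₂ (refl , _)  = contradiction b′∈ (disjoint a∈)

-- Rare events

module Events {n : ℕ} (x : ℚ) (0≤x : 0ℚ ≤ x) (x≤1 : x ≤ 1ℚ) where
  open Expectation {n} x

  private
    L = possibleEdges n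

  -- P fails with probability at most β, by Markov's inequality for the test function b.
  record Rarely¬ (β : ℚ) (P : List (Edge n) → Set) : Set where
    constructor rarely
    field
      test        : List (Edge n) → ℚ
      nonneg      : ∀ {E} → All Ordered E → 0ℚ ≤ test E
      holds       : ∀ {E} → All Ordered E → test E < 1ℚ → P E
      expectation : 𝔼 L test ≤ β

  open Rarely¬

  weaken : ∀ {β γ P} → β ≤ γ → Rarely¬ β P → Rarely¬ γ P
  weaken β≤γ (rarely b b≥0 h e) = rarely b b≥0 h (≤-trans e β≤γ)

  implies : ∀ {β P Q} → (∀ {E} → All Ordered E → P E → Q E) → Rarely¬ β P → Rarely¬ β Q
  implies P⇒Q (rarely b b≥0 h e) = rarely b b≥0 (λ o → P⇒Q o ∘ h o) e

  certain : ∀ {P} → (∀ {E} → P E) → Rarely¬ 0ℚ P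
  certain p = rarely (λ _ → 0ℚ) (λ _ → ≤-refl) (λ _ _ → p) (≤-reflexive (𝔼-const L 0ℚ))

  -- The union bound: tests are added, and by nonnegativity a sum below 1 forces each summand below
  -- 1.
  both : ∀ {β γ P Q} → Rarely¬ β P → Rarely¬ γ Q → Rarely¬ (β + γ) (λ E → P E × Q E)
  both {β} {γ} (rarely b b≥0 h e) (rarely c c≥0 k f) = rarely (λ E → b E + c E)
    (λ o → +-mono-≤ (b≥0 o) (c≥0 o))
    (λ {E} o small → h o (≤-<-trans (subst (_≤ b E + c E) (+-identityʳ (b E)) (+-monoʳ-≤ (b E) (c≥0 o))) small)
                   , k o (≤-<-trans (subst (_≤ b E + c E) (+-identityˡ (c E)) (+-monoˡ-≤ (c E) (b≥0 o))) small))
    (≤-trans (≤-reflexive (𝔼-+ L b c)) (+-mono-≤ e f))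

  all : ∀ {A : Set} {β} {P : A → List (Edge n) → Set} as → (∀ a → Rarely¬ β (P a)) →
        Rarely¬ (ι (length as) * β) (λ E → All (λ a → P a E) as)
  all {β = β} []       _ = weaken (≤-reflexive (sym (*-zeroˡ β))) (certain [])
  all {β = β} (a ∷ as) r = weaken
    (≤-reflexive (begin
      β + ι (length as) * β           ≡⟨ solve 2 (λ β l → β :+ l :* β := (con 1ℚ :+ l) :* β) refl β (ι (length as)) ⟩
      (1ℚ + ι (length as)) * β        ≡⟨ cong (_* β) (ι-suc (length as)) ⟨
      ι (suc (length as)) * β         ∎))
    (implies (λ _ (p , ps) → p ∷ ps) (both (r a) (all as r)))
    where
    open ≡-Reasoning
    open +-*-Solver

  test-function : ∀ {S Φ P} k → Multiaffine S Φ → 0ℚ ≤ k → (∀ {E} → All Ordered E → 0ℚ ≤ Φ (indicator 1ℚ E)) →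
    (∀ {E} → All Ordered E → k * Φ (indicator 1ℚ E) < 1ℚ → P E) → Rarely¬ (k * Φ (indicator x L)) P
  test-function {Φ = Φ} k MA 0≤k 0≤Φ h = rarely (λ E → k * Φ (indicator 1ℚ E)) (λ o → *-nonneg 0≤k (0≤Φ o)) h
    (≤-reflexive (trans (𝔼-* L k _) (cong (k *_) (𝔼-multiaffine possibleEdges-unique MA))))

  -- The product of `1 - X` over all pairs is 1 when no edge crosses. The pairs are distinct edges,
  -- so its expectation is computed exactly.
  crossing-edge : ∀ {as bs : List (Fin n)} → Unique as → Unique bs → (∀ {a} → a ∈ˡ as → a ∉ˡ bs) →
    Rarely¬ ((1ℚ - x) ↑ (length bs ℕ.* length as)) (λ E → Any (λ a → Any (λ b → a ~⟨ E ⟩ b) bs) as)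
  crossing-edge {as} {bs} as! bs! disjoint = weaken (≤-reflexive (trans (*-identityˡ _) value))
    (test-function 1ℚ (stars-multiaffine as! disjoint star) 0≤1
      (λ o → ∏-nonneg _ as (λ {a} a∈ → ∏-nonneg _ bs (λ b∈ → factor-nonneg o (disjoint⇒≢ a∈ b∈))))
      found)
    where
    Φ : Fin n → (Edge n → ℚ) → ℚ
    Φ a X = ∏[ bs ] (λ b → 1ℚ + (- 1ℚ) * X (edge a b))
    star : ∀ {a} → a ∈ˡ as → Multiaffine (Spokes bs a) (Φ a)
    star {a} a∈ = star-multiaffine {φ = λ z → 1ℚ + (- 1ℚ) * z} a bs! (disjoint a∈) (λ b → affine-image 1ℚ (- 1ℚ) (coordinate (edge a b)))
    disjoint⇒≢ : ∀ {a b} → a ∈ˡ as → b ∈ˡ bs → a ≢ b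
    disjoint⇒≢ a∈ b∈ refl = disjoint a∈ b∈
    factor-nonneg : ∀ {E a b} → All Ordered E → a ≢ b → 0ℚ ≤ 1ℚ + (- 1ℚ) * indicator 1ℚ E (edge a b)
    factor-nonneg {E} {a} {b} o a≢b with Graph._~?_ (graph E) a b
    ... | yes adj = ≤-reflexive (sym (cong (λ z → 1ℚ + (- 1ℚ) * z) (indicator-adjacent o adj)))
    ... | no ¬adj = subst (0ℚ ≤_) (sym (cong (λ z → 1ℚ + (- 1ℚ) * z) (indicator-nonadjacent o a≢b ¬adj))) 0≤1
    value : ∏[ as ] (λ a → Φ a (indicator x L)) ≡ (1ℚ - x) ↑ (length bs ℕ.* length as)
    value = trans (∏-const _ as (λ {a} a∈ → ∏-const _ bs (λ b∈ →
        trans (cong (λ z → 1ℚ + (- 1ℚ) * z) (indicator-possible x (disjoint⇒≢ a∈ b∈))) (cong (λ z → 1ℚ + z) (solve 1 (λ x → con (- 1ℚ) :* x := :- x) refl x)))))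
      (Exp.^-assocʳ (1ℚ - x) (length bs) (length as))
      where open +-*-Solver
    found : ∀ {E} → All Ordered E → 1ℚ * ∏[ as ] (λ a → Φ a (indicator 1ℚ E)) < 1ℚ → Any (λ a → Any (λ b → a ~⟨ E ⟩ b) bs) as
    found {E} o small with Any.any? (λ a → Any.any? (λ b → Graph._~?_ (graph E) a b) bs) as
    ... | yes adj = adj
    ... | no ¬adj = contradiction small (<-irrefl (trans (*-identityˡ _) (∏-one _ as (λ {a} a∈ → ∏-one _ bs (λ {b} b∈ →
      cong (λ z → 1ℚ + (- 1ℚ) * z) (indicator-nonadjacent o (disjoint⇒≢ a∈ b∈) (λ adj → ¬adj (lose a∈ (lose b∈ adj)))))))))

  module _ {S : List (Fin n)} (S! : Unique S) where
    private
      -- Leaving out `S` keeps the edges towards `S` distinct. No common neighbour is lost, since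
      -- adjacency is irreflexive.
      outside? : Decidable {A = Fin n} (λ a → ¬ Any (a ≡_) S)
      outside? a = ¬? (Any.any? (a Fin.≟_) S)
      ws : List (Fin n)
      ws = filter outside? (allFin n)

      ws∌S : ∀ {a} → a ∈ˡ ws → a ∉ˡ S
      ws∌S a∈ = proj₂ (∈-filter⁻ outside? {xs = allFin n} a∈)

      factor : ℚ → Fin n → (Edge n → ℚ) → ℚ
      factor c a X = 1ℚ + c * monomial S a X

      factors : ℚ → (Edge n → ℚ) → ℚ
      factors c X = ∏[ ws ] (λ a → factor c a X)

      multiaffine : ∀ c → Multiaffine (λ e → Any (λ a → Spokes S a e) ws) (factors c)
      multiaffine c = stars-multiaffine (Unique.filter⁺ outside? (Unique.allFin⁺ n)) ws∌S
        (λ {a} a∈ → affine-image 1ℚ c (star-multiaffine {φ = id} a S! (ws∌S a∈) (λ b → coordinate (edge a b))))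

      ∈∉⇒≢ : ∀ {a s} → a ∈ˡ ws → s ∈ˡ S → a ≢ s
      ∈∉⇒≢ a∈ s∈ refl = ws∌S a∈ s∈

      at-graph : ∀ c {E} → All Ordered E → factors c (indicator 1ℚ E) ≡ (1ℚ + c) ↑ codegree (graph E) S
      at-graph c {E} o = trans (∏-count CN? _ ws full partial) (cong ((1ℚ + c) ↑_)
        (count-filter CN? outside? (λ {a} common a∈S → Graph.~-irrefl (graph E) (All.lookup common a∈S)) (allFin n)))
        where
        CN? = CommonNeighbour? (graph E) S
        full : ∀ {a} → a ∈ˡ ws → CommonNeighbour (graph E) S a → factor c a (indicator 1ℚ E) ≡ 1ℚ + c
        full {a} a∈ common = trans (cong (λ z → 1ℚ + c * z) (∏-one _ S (λ s∈ →
          indicator-adjacent o (Graph.~-sym (graph E) (All.lookup common s∈))))) (cong (1ℚ +_) (*-identityʳ c))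
        partial : ∀ {a} → a ∈ˡ ws → ¬ CommonNeighbour (graph E) S a → factor c a (indicator 1ℚ E) ≡ 1ℚ
        partial {a} a∈ ¬common with find (All.¬All⇒Any¬ (λ s → Graph._~?_ (graph E) s a) S ¬common)
        ... | s , s∈ , ¬adj = trans (cong (λ z → 1ℚ + c * z) (∏-zero (λ s → indicator 1ℚ E (edge a s)) s∈
          (indicator-nonadjacent o (∈∉⇒≢ a∈ s∈) (¬adj ∘ Graph.~-sym (graph E))))) (cong (1ℚ +_) (*-zeroʳ c))

      at-x : ∀ c → factors c (indicator x L) ≡ (1ℚ + c * x ↑ length S) ↑ length ws
      at-x c = ∏-const _ ws (λ {a} a∈ → cong (λ z → 1ℚ + c * z)
        (∏-const _ S (λ s∈ → indicator-possible x (∈∉⇒≢ a∈ s∈))))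

      ws-length : n ℕ.≤ length ws ℕ.+ length S
      ws-length = begin
        n                                                               ≡⟨ length-allFin n ⟨
        length (allFin n)                                               ≡⟨ cong length (filter-all U? (All.universal (λ _ → tt) (allFin n))) ⟨
        # U?                                                            ≤⟨ count-cover U? outside? (λ a → Any.any? (a Fin.≟_) S) (λ {a} _ → split a) (allFin n) ⟩
        length ws ℕ.+ # (λ a → Any.any? (a Fin.≟_) S)                   ≤⟨ ℕ.+-monoʳ-≤ (length ws) (count-Any (λ s a → a Fin.≟ s) S (allFin n)) ⟩
        length ws ℕ.+ Σ[ S ] (λ s → # (Fin._≟ s))                       ≤⟨ ℕ.+-monoʳ-≤ (length ws) (Σ-≤ (λ s → # (Fin._≟ s)) (All.universal (λ s → count-≡ s (Unique.allFin⁺ n)) S)) ⟩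
        length ws ℕ.+ length S ℕ.* 1                                    ≡⟨ cong (length ws ℕ.+_) (ℕ.*-identityʳ (length S)) ⟩
        length ws ℕ.+ length S                                          ∎
        where
        open ℕ.≤-Reasoning
        U? : Decidable {A = Fin n} (λ _ → ⊤)
        U? _ = yes tt
        split : ∀ a → ¬ Any (a ≡_) S ⊎ Any (a ≡_) S
        split a with Any.any? (a Fin.≟_) S
        ... | yes p = inj₂ p
        ... | no ¬p = inj₁ ¬p

    -- `c = 1` gives `2^codegree`, compared with `2^M`: a Chernoff bound with base 2. The base
    -- `1 + x^|S|` is at least 1, so the exponent may be raised from the number of vertices outside
    -- `S` to `n`.
    codegree-upper : ∀ M → Rarely¬ (½ ↑ M * (1ℚ + x ↑ length S) ↑ n) (λ E → codegree (graph E) S ℕ.< M)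
    codegree-upper M = weaken (*-monoˡ-≤-nonNeg (½ ↑ M) {{nonNegative (↑-nonneg 0≤½ M)}} bound)
      (test-function (½ ↑ M) (multiaffine 1ℚ) (↑-nonneg 0≤½ M)
        (λ {E} o → subst (0ℚ ≤_) (sym (at-graph 1ℚ o)) (↑-nonneg 0≤2 (codegree (graph E) S)))
        (λ {E} o small → ℕ.≰⇒> λ M≤ → <⇒≱ small (subst (λ z → 1ℚ ≤ ½ ↑ M * z) (sym (at-graph 1ℚ o)) (½2 (codegree (graph E) S) M≤))))
      where
      bound : factors 1ℚ (indicator x L) ≤ (1ℚ + x ↑ length S) ↑ n
      bound = subst₂ _≤_ (sym (trans (at-x 1ℚ) (cong (λ z → (1ℚ + z) ↑ length ws) (*-identityˡ (x ↑ length S)))))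
        refl (↑-monoʳ 1≤ (subst (length ws ℕ.≤_) (length-allFin n) (length-filter outside? (allFin n))))
        where
        1≤ : 1ℚ ≤ 1ℚ + x ↑ length S
        1≤ = p≤p+q (↑-nonneg 0≤x (length S))
      ½2 : ∀ k → M ℕ.≤ k → 1ℚ ≤ ½ ↑ M * (1ℚ + 1ℚ) ↑ k
      ½2 k M≤k = begin
        1ℚ                                      ≡⟨ 1↑ M ⟨
        (½ * (1ℚ + 1ℚ)) ↑ M                     ≡⟨ Exp.^-distrib-* ½ (1ℚ + 1ℚ) M ⟩
        ½ ↑ M * (1ℚ + 1ℚ) ↑ M                   ≤⟨ *-monoˡ-≤-nonNeg (½ ↑ M) {{nonNegative (↑-nonneg 0≤½ M)}} (↑-monoʳ (p≤p+q 0≤1) M≤k) ⟩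
        ½ ↑ M * (1ℚ + 1ℚ) ↑ k                   ∎
        where open ≤-Reasoning

    -- `c = -1/2` gives `2^(-codegree)`. The base is now at most 1, so the number of factors must be
    -- bounded from below, and `k` leaves room for the vertices of `S`.
    codegree-lower : ∀ m {k} → k ℕ.+ length S ℕ.≤ n →
      Rarely¬ ((1ℚ + 1ℚ) ↑ m * (1ℚ - ½ * x ↑ length S) ↑ k) (λ E → m ℕ.≤ codegree (graph E) S)
    codegree-lower m {k} k≤ = weaken (*-monoˡ-≤-nonNeg ((1ℚ + 1ℚ) ↑ m) {{nonNegative (↑-nonneg 0≤2 m)}} bound)
      (test-function ((1ℚ + 1ℚ) ↑ m) (multiaffine (- ½)) (↑-nonneg 0≤2 m)
        (λ {E} o → subst (0ℚ ≤_) (sym (at-graph (- ½) o)) (↑-nonneg 0≤½ (codegree (graph E) S)))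
        (λ {E} o small → ℕ.≮⇒≥ λ <m → <⇒≱ small (subst (λ z → 1ℚ ≤ (1ℚ + 1ℚ) ↑ m * z) (sym (at-graph (- ½) o)) (2½ (codegree (graph E) S) (ℕ.<⇒≤ <m)))))
      where
      y = ½ * x ↑ length S
      0≤y : 0ℚ ≤ y
      0≤y = *-nonneg 0≤½ (↑-nonneg 0≤x (length S))
      y≤1 : y ≤ 1ℚ
      y≤1 = ≤-trans (*-mono-≤ 0≤1 (↑-nonneg 0≤x (length S)) (p≤p+q {½} {½} 0≤½) (↑≤1 0≤x x≤1 (length S))) ≤-refl
      bound : factors (- ½) (indicator x L) ≤ (1ℚ - y) ↑ k
      bound = subst (_≤ (1ℚ - y) ↑ k) (sym (trans (at-x (- ½)) (cong (λ z → (1ℚ + z) ↑ length ws) (sym (neg-distribˡ-* ½ (x ↑ length S))))))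
        (↑-antimonoʳ (p≤q⇒0≤q-p y≤1) (1-≤1 0≤y) (ℕ.+-cancelʳ-≤ (length S) k (length ws) (ℕ.≤-trans k≤ ws-length)))
      2½ : ∀ j → j ℕ.≤ m → 1ℚ ≤ (1ℚ + 1ℚ) ↑ m * ½ ↑ j
      2½ j j≤m = begin
        1ℚ                                      ≡⟨ 1↑ j ⟨
        ((1ℚ + 1ℚ) * ½) ↑ j                     ≡⟨ Exp.^-distrib-* (1ℚ + 1ℚ) ½ j ⟩
        (1ℚ + 1ℚ) ↑ j * ½ ↑ j                   ≤⟨ *-monoʳ-≤-nonNeg (½ ↑ j) {{nonNegative (↑-nonneg 0≤½ j)}} (↑-monoʳ (p≤p+q 0≤1) j≤m) ⟩
        (1ℚ + 1ℚ) ↑ m * ½ ↑ j                   ∎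
        where open ≤-Reasoning

-- Bernoulli estimates and union bounds in powers of two.

2ℚ : ℚ
2ℚ = 1ℚ + 1ℚ

↑-monoˡ : ∀ {p q} → 0ℚ ≤ p → p ≤ q → ∀ k → p ↑ k ≤ q ↑ k
↑-monoˡ 0≤p p≤q zero    = ≤-refl
↑-monoˡ 0≤p p≤q (suc k) = *-mono-≤ (≤-trans 0≤p p≤q) (↑-nonneg 0≤p k) p≤q (↑-monoˡ 0≤p p≤q k)

bernoulli⁻ : ∀ {y} → 0ℚ ≤ y → y ≤ 1ℚ → ∀ j → 1ℚ - ι j * y ≤ (1ℚ - y) ↑ j
bernoulli⁻ {y} 0≤y y≤1 zero = ≤-reflexive (trans (cong (λ z → 1ℚ - z) (*-zeroˡ y)) refl)
bernoulli⁻ {y} 0≤y y≤1 (suc j) = begin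
  1ℚ - ι (suc j) * y                        ≡⟨ cong (λ z → 1ℚ - z * y) (ι-suc j) ⟩
  1ℚ - (1ℚ + ι j) * y                       ≤⟨ p≤p+q (*-nonneg (ι-nonneg j) (*-nonneg 0≤y 0≤y)) ⟩
  1ℚ - (1ℚ + ι j) * y + ι j * (y * y)       ≡⟨ solve 2 (λ j y → con 1ℚ :- (con 1ℚ :+ j) :* y :+ j :* (y :* y) := (con 1ℚ :- y) :* (con 1ℚ :- j :* y)) refl (ι j) y ⟩
  (1ℚ - y) * (1ℚ - ι j * y)                 ≤⟨ *-monoˡ-≤-nonNeg (1ℚ - y) {{nonNegative (p≤q⇒0≤q-p y≤1)}} (bernoulli⁻ 0≤y y≤1 j) ⟩
  (1ℚ - y) * (1ℚ - y) ↑ j                   ∎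
  where
  open ≤-Reasoning
  open +-*-Solver

bernoulli⁺ : ∀ {y} → 0ℚ ≤ y → ∀ j → 1ℚ + ι j * y ≤ (1ℚ + y) ↑ j
bernoulli⁺ {y} 0≤y zero = ≤-reflexive (trans (cong (1ℚ +_) (*-zeroˡ y)) refl)
bernoulli⁺ {y} 0≤y (suc j) = begin
  1ℚ + ι (suc j) * y                        ≡⟨ cong (λ z → 1ℚ + z * y) (ι-suc j) ⟩
  1ℚ + (1ℚ + ι j) * y                       ≤⟨ p≤p+q (*-nonneg (ι-nonneg j) (*-nonneg 0≤y 0≤y)) ⟩
  1ℚ + (1ℚ + ι j) * y + ι j * (y * y)       ≡⟨ solve 2 (λ j y → con 1ℚ :+ (con 1ℚ :+ j) :* y :+ j :* (y :* y) := (con 1ℚ :+ y) :* (con 1ℚ :+ j :* y)) refl (ι j) y ⟩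
  (1ℚ + y) * (1ℚ + ι j * y)                 ≤⟨ *-monoˡ-≤-nonNeg (1ℚ + y) {{nonNegative (≤-trans 0≤1 (p≤p+q 0≤y))}} (bernoulli⁺ 0≤y j) ⟩
  (1ℚ + y) * (1ℚ + y) ↑ j                   ∎
  where
  open ≤-Reasoning
  open +-*-Solver

module _ {y} (0≤y : 0ℚ ≤ y) (y≤1 : y ≤ 1ℚ) where
  private
    0≤1-y : 0ℚ ≤ 1ℚ - y
    0≤1-y = p≤q⇒0≤q-p y≤1

    0≤1+y : 0ℚ ≤ 1ℚ + y
    0≤1+y = ≤-trans 0≤1 (p≤p+q 0≤y)

    conjugates : ∀ j → (1ℚ - y) ↑ j * (1ℚ + y) ↑ j ≤ 1ℚ
    conjugates j = begin
      (1ℚ - y) ↑ j * (1ℚ + y) ↑ j   ≡⟨ Exp.^-distrib-* (1ℚ - y) (1ℚ + y) j ⟨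
      ((1ℚ - y) * (1ℚ + y)) ↑ j     ≤⟨ ↑≤1 (*-nonneg 0≤1-y 0≤1+y) (subst (_≤ 1ℚ) square (1-≤1 (*-nonneg 0≤y 0≤y))) j ⟩
      1ℚ                            ∎
      where
      open ≤-Reasoning
      square : 1ℚ - y * y ≡ (1ℚ - y) * (1ℚ + y)
      square = solve 1 (λ y → con 1ℚ :- y :* y := (con 1ℚ :- y) :* (con 1ℚ :+ y)) refl y
        where open +-*-Solver

  -- `(1-y)^j (1+y)^j ≤ 1`, and the second factor is at least `1 + jy ≥ 2`.
  [1-y]↑≤½ : ∀ {j} → 1ℚ ≤ ι j * y → (1ℚ - y) ↑ j ≤ ½
  [1-y]↑≤½ {j} 1≤jy = begin
    (1ℚ - y) ↑ j                              ≡⟨ trans (*-assoc ((1ℚ - y) ↑ j) 2ℚ ½) (*-identityʳ ((1ℚ - y) ↑ j)) ⟨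
    (1ℚ - y) ↑ j * 2ℚ * ½                     ≤⟨ *-monoʳ-≤-nonNeg ½ (*-monoˡ-≤-nonNeg ((1ℚ - y) ↑ j) {{nonNegative (↑-nonneg 0≤1-y j)}}
                                                   (≤-trans (+-monoʳ-≤ 1ℚ 1≤jy) (bernoulli⁺ 0≤y j))) ⟩
    (1ℚ - y) ↑ j * (1ℚ + y) ↑ j * ½           ≤⟨ *-monoʳ-≤-nonNeg ½ (conjugates j) ⟩
    1ℚ * ½                                    ≡⟨⟩
    ½                                         ∎
    where open ≤-Reasoning

  -- The same product bound, now with `(1-y)^j ≥ 1 - jy ≥ 1/2`.
  [1+y]↑≤2 : ∀ {j} → ι j * y ≤ ½ → (1ℚ + y) ↑ j ≤ 2ℚ
  [1+y]↑≤2 {j} jy≤½ = begin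
    (1ℚ + y) ↑ j                              ≡⟨ trans (*-assoc ((1ℚ + y) ↑ j) ½ 2ℚ) (*-identityʳ ((1ℚ + y) ↑ j)) ⟨
    (1ℚ + y) ↑ j * ½ * 2ℚ                     ≤⟨ *-monoʳ-≤-nonNeg 2ℚ (*-monoˡ-≤-nonNeg ((1ℚ + y) ↑ j) {{nonNegative (↑-nonneg 0≤1+y j)}}
                                                   (≤-trans (+-monoʳ-≤ 1ℚ (neg-antimono-≤ jy≤½)) (bernoulli⁻ 0≤y y≤1 j))) ⟩
    (1ℚ + y) ↑ j * (1ℚ - y) ↑ j * 2ℚ          ≡⟨ cong (_* 2ℚ) (*-comm ((1ℚ + y) ↑ j) ((1ℚ - y) ↑ j)) ⟩
    (1ℚ - y) ↑ j * (1ℚ + y) ↑ j * 2ℚ          ≤⟨ *-monoʳ-≤-nonNeg 2ℚ (conjugates j) ⟩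
    1ℚ * 2ℚ                                   ≡⟨⟩
    2ℚ                                        ∎
    where open ≤-Reasoning

  [1-y]↑≤½↑ : ∀ {j} i → 1ℚ ≤ ι j * y → (1ℚ - y) ↑ (j ℕ.* i) ≤ ½ ↑ i
  [1-y]↑≤½↑ {j} i 1≤jy = begin
    (1ℚ - y) ↑ (j ℕ.* i)   ≡⟨ SExp.^-assocʳ (1ℚ - y) j i ⟨
    ((1ℚ - y) ↑ j) ↑ i     ≤⟨ ↑-monoˡ (↑-nonneg 0≤1-y j) ([1-y]↑≤½ {j} 1≤jy) i ⟩
    ½ ↑ i                  ∎
    where open ≤-Reasoning

  [1+y]↑≤2↑ : ∀ {j n} i → n ℕ.≤ j ℕ.* i → ι j * y ≤ ½ → (1ℚ + y) ↑ n ≤ 2ℚ ↑ i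
  [1+y]↑≤2↑ {j} {n} i n≤ji jy≤½ = begin
    (1ℚ + y) ↑ n           ≤⟨ ↑-monoʳ (p≤p+q 0≤y) n≤ji ⟩
    (1ℚ + y) ↑ (j ℕ.* i)   ≡⟨ SExp.^-assocʳ (1ℚ + y) j i ⟨
    ((1ℚ + y) ↑ j) ↑ i     ≤⟨ ↑-monoˡ (↑-nonneg 0≤1+y j) ([1+y]↑≤2 {j} jy≤½) i ⟩
    2ℚ ↑ i                 ∎
    where open ≤-Reasoning

2↑*½↑ : ∀ m j → 2ℚ ↑ m * ½ ↑ (m ℕ.+ j) ≡ ½ ↑ j
2↑*½↑ m j = begin
  2ℚ ↑ m * ½ ↑ (m ℕ.+ j)      ≡⟨ cong (2ℚ ↑ m *_) (SExp.^-homo-* ½ m j) ⟩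
  2ℚ ↑ m * (½ ↑ m * ½ ↑ j)    ≡⟨ *-assoc (2ℚ ↑ m) (½ ↑ m) (½ ↑ j) ⟨
  2ℚ ↑ m * ½ ↑ m * ½ ↑ j      ≡⟨ cong (_* ½ ↑ j) (trans (sym (Exp.^-distrib-* 2ℚ ½ m)) (1↑ m)) ⟩
  1ℚ * ½ ↑ j                  ≡⟨ *-identityˡ (½ ↑ j) ⟩
  ½ ↑ j                       ∎
  where open ≡-Reasoning

union-bound : ∀ {N q} a b l → N ℕ.≤ 2 ℕ.^ a → q ≤ ½ ↑ b → a ℕ.+ l ℕ.≤ b → ι N * q ≤ ½ ↑ l
union-bound {N} {q} a b l N≤ q≤ a+l≤b = begin
  ι N * q                     ≤⟨ *-monoˡ-≤-nonNeg (ι N) {{nonNegative (ι-nonneg N)}} q≤ ⟩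
  ι N * ½ ↑ b                 ≤⟨ *-mono-≤ (↑-nonneg 0≤2 a) (↑-nonneg 0≤½ b)
                                   (≤-trans (ι-mono N≤) (≤-reflexive (ι-^ 2 a))) (↑-antimonoʳ 0≤½ (p≤p+q {½} {½} 0≤½) a+l≤b) ⟩
  2ℚ ↑ a * ½ ↑ (a ℕ.+ l)      ≡⟨ 2↑*½↑ a l ⟩
  ½ ↑ l                       ∎
  where open ≤-Reasoning

-- The random graph is pseudorandom with high probability.

length-cartesianProductWith : ∀ {A B C : Set} (f : A → B → C) xs ys →
  length (cartesianProductWith f xs ys) ≡ length xs ℕ.* length ys
length-cartesianProductWith f []       ys = refl
length-cartesianProductWith f (x ∷ xs) ys = trans (length-++ (map (f x) ys))
  (cong₂ ℕ._+_ (length-map (f x) ys) (length-cartesianProductWith f xs ys))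

tuples : ∀ n → ℕ → List (List (Fin n))
tuples n zero    = [] ∷ []
tuples n (suc r) = cartesianProductWith _∷_ (allFin n) (tuples n r)

length-tuples : ∀ n r → length (tuples n r) ≡ n ℕ.^ r
length-tuples n zero    = refl
length-tuples n (suc r) = trans (length-cartesianProductWith _∷_ (allFin n) (tuples n r))
  (cong₂ ℕ._*_ (length-allFin n) (length-tuples n r))

∈-tuples : ∀ {n} (S : List (Fin n)) → S ∈ˡ tuples n (length S)
∈-tuples []      = here refl
∈-tuples (s ∷ S) = ∈-cartesianProductWith⁺ _∷_ (∈-allFin s) (∈-tuples S)

another : ∀ {n} → 2 ℕ.≤ n → (u : Fin n) → ∃ λ v → u ≢ v
another (s≤s (s≤s _)) zero    = suc zero , λ ()
another (s≤s (s≤s _)) (suc u) = zero , λ ()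

-- For `t = 4k * 3l` and `4kx ≥ 1` one has `(1-x)^(t*t) ≤ 2^(-3lt)`, which beats the at most
-- `2^(2lt)` pairs of `t`-tuples.
sampleSize : ℕ → ℕ → ℕ
sampleSize k l = 4 ℕ.* k ℕ.* (3 ℕ.* l)

-- With `n` between `1024 k² μ` and `2048 k² μ` and `x` between `1/(4k)` and `1/(2k)`, the quantity
-- `n x²` lies between `64 μ` and `512 μ`. The factor `2049` is `2048` from
-- `(1 + x²)^n ≤ 2^(2048 μ)` plus 1 for the tail; `2 μ` is a quarter of `8 μ`.
minCodegree maxCodegree maxTricodegree : ℕ → ℕ
minCodegree μ    = 8 ℕ.* μ
maxCodegree μ    = 2049 ℕ.* μ
maxTricodegree μ = 2 ℕ.* μ

maxDegree : ℕ → ℕ → ℕ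
maxDegree k μ = 2049 ℕ.* (k ℕ.* μ)

module Typical {n : ℕ} (x : ℚ) (0≤x : 0ℚ ≤ x) (x≤1 : x ≤ 1ℚ) (k l μ : ℕ)
  (2kx≤1 : ι (2 ℕ.* k) * x ≤ 1ℚ) (1≤4kx : 1ℚ ≤ ι (4 ℕ.* k) * x)
  (n≤2^l : n ℕ.≤ 2 ℕ.^ l) (1≤l : 1 ℕ.≤ l) (2048≤k : 2048 ℕ.≤ k) (4l≤μ : 4 ℕ.* l ℕ.≤ μ)
  (n≥ : 1024 ℕ.* (k ℕ.* k) ℕ.* μ ℕ.≤ n) (n≤ : n ℕ.≤ 2048 ℕ.* (k ℕ.* k) ℕ.* μ)
  where
  open Events {n} x 0≤x x≤1

  private
    t m : ℕ
    t = sampleSize k l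
    m = minCodegree μ

    1≤k : 1 ℕ.≤ k
    1≤k = ℕ.≤-trans (s≤s z≤n) 2048≤k

    1≤t : 1 ℕ.≤ t
    1≤t = ℕ.*-mono-≤ (ℕ.*-mono-≤ (s≤s (z≤n {3})) 1≤k) (ℕ.*-mono-≤ (s≤s (z≤n {2})) 1≤l)

    1≤μ : 1 ℕ.≤ μ
    1≤μ = ℕ.≤-trans (ℕ.*-mono-≤ (s≤s (z≤n {3})) 1≤l) 4l≤μ

    n^r≤ : ∀ r → n ℕ.^ r ℕ.≤ 2 ℕ.^ (l ℕ.* r)
    n^r≤ r = ℕ.≤-trans (ℕ.^-monoˡ-≤ r n≤2^l) (ℕ.≤-reflexive (ℕ.^-*-assoc 2 l r))

    unique? : Decidable (Unique {A = Fin n})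
    unique? = allPairs? (λ u v → ¬? (u Fin.≟ v))

    -- An event with a failed side condition holds trivially, so the union bounds may run over all
    -- tuples, repetitions included.
    given : ∀ {A : Set} {β P} → Dec A → 0ℚ ≤ β → (A → Rarely¬ β P) → Rarely¬ β (λ E → A → P E)
    given (yes a) _   r = implies (λ _ p _ → p) (r a)
    given (no ¬a) 0≤β _ = weaken 0≤β (certain (λ a → contradiction a ¬a))

    all-tuples : ∀ {β} r {P : List (Fin n) → List (Edge n) → Set} → 0ℚ ≤ β →
      (∀ {S} → Unique S → length S ≡ r → Rarely¬ β (P S)) →
      Rarely¬ (ι (n ℕ.^ r) * β) (λ E → ∀ S → Unique S → length S ≡ r → P S E)
    all-tuples {β} r {P} 0≤β rare = weaken (≤-reflexive (cong (λ N → ι N * β) (length-tuples n r)))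
      (implies (λ { _ h S S! refl → All.lookup h (∈-tuples S) (S! , refl) })
        (all (tuples n r) (λ S → given (unique? S ×-dec (length S ℕ.≟ r)) 0≤β (λ (S! , size) → rare S! size))))

    z : ℚ
    z = ι k * x

    0≤z : 0ℚ ≤ z
    0≤z = *-nonneg (ι-nonneg k) 0≤x

    z≤½ : z ≤ ½
    z≤½ = begin
      z                          ≡⟨ solve 2 (λ k x → k :* x := con ½ :* (con 2ℚ :* k :* x)) refl (ι k) x ⟩
      ½ * (2ℚ * ι k * x)         ≡⟨ cong (λ w → ½ * (w * x)) (ι-* 2 k) ⟨
      ½ * (ι (2 ℕ.* k) * x)      ≤⟨ *-monoˡ-≤-nonNeg ½ 2kx≤1 ⟩
      ½ * 1ℚ                     ≡⟨⟩
      ½                          ∎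
      where
      open ≤-Reasoning
      open +-*-Solver

    k^r-small : ∀ r → ι (k ℕ.^ suc r) * x ↑ suc r ≤ ½
    k^r-small r = begin
      ι (k ℕ.^ suc r) * x ↑ suc r   ≡⟨ cong (_* x ↑ suc r) (ι-^ k (suc r)) ⟩
      ι k ↑ suc r * x ↑ suc r       ≡⟨ Exp.^-distrib-* (ι k) x (suc r) ⟨
      z * z ↑ r                     ≤⟨ *-mono-≤ 0≤½ (↑-nonneg 0≤z r) z≤½ (↑≤1 0≤z (≤-trans z≤½ (p≤p+q {½} {½} 0≤½)) r) ⟩
      ½ * 1ℚ                        ≡⟨⟩
      ½                             ∎
      where open ≤-Reasoning

  -- `D` pays for the mean, as `(1 + x^(r+1))^n ≤ 2^D`. The excess `b` pays for the `n^(r+1)` tuples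
  -- and leaves `2^(-l)`.
  rarely-large : ∀ r D b → n ℕ.≤ k ℕ.^ suc r ℕ.* D → l ℕ.* suc r ℕ.+ l ℕ.≤ b →
    Rarely¬ (½ ↑ l) (λ E → ∀ S → Unique S → length S ≡ suc r → codegree (graph E) S ℕ.< D ℕ.+ b)
  rarely-large r D b n≤kD l≤b = weaken (union-bound (l ℕ.* suc r) b l (n^r≤ (suc r)) ≤-refl l≤b)
    (all-tuples (suc r) (↑-nonneg 0≤½ b) λ {S} S! size →
      weaken (subst (λ r → ½ ↑ (D ℕ.+ b) * (1ℚ + x ↑ r) ↑ n ≤ ½ ↑ b) (sym size) bound) (codegree-upper S! (D ℕ.+ b)))
    where
    open ≤-Reasoning
    bound : ½ ↑ (D ℕ.+ b) * (1ℚ + x ↑ suc r) ↑ n ≤ ½ ↑ b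
    bound = begin
      ½ ↑ (D ℕ.+ b) * (1ℚ + x ↑ suc r) ↑ n  ≤⟨ *-monoˡ-≤-nonNeg (½ ↑ (D ℕ.+ b)) {{nonNegative (↑-nonneg 0≤½ (D ℕ.+ b))}}
                                                 ([1+y]↑≤2↑ (↑-nonneg 0≤x (suc r)) (↑≤1 0≤x x≤1 (suc r)) {k ℕ.^ suc r} D n≤kD (k^r-small r)) ⟩
      ½ ↑ (D ℕ.+ b) * 2ℚ ↑ D                ≡⟨ *-comm (½ ↑ (D ℕ.+ b)) (2ℚ ↑ D) ⟩
      2ℚ ↑ D * ½ ↑ (D ℕ.+ b)                ≡⟨ 2↑*½↑ D b ⟩
      ½ ↑ b                                 ∎

  rarely-small : Rarely¬ (½ ↑ l) (λ E → ∀ S → Unique S → length S ≡ 2 → m ℕ.≤ codegree (graph E) S)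
  rarely-small = weaken (union-bound (l ℕ.* 2) m l (n^r≤ 2) ≤-refl l≤m)
    (all-tuples 2 (↑-nonneg 0≤½ m) λ {S} S! size → weaken (bound {S} size) (codegree-lower S! m {j ℕ.* (m ℕ.+ m)} (size≤ {S} size)))
    where
    open ≤-Reasoning
    -- Chosen so that `j y ≥ 1` for `y = x²/2`, given `4kx ≥ 1`. Then `2m` blocks of `j` factors
    -- contribute `2^(-2m)`, and the prefactor `2^m` leaves `2^(-m)`.
    j = 2 ℕ.* (4 ℕ.* k ℕ.* (4 ℕ.* k))
    size≤ : ∀ {S : List (Fin n)} → length S ≡ 2 → j ℕ.* (m ℕ.+ m) ℕ.+ length S ℕ.≤ n
    size≤ {S} size = ℕ.≤-trans (ℕ.≤-trans (ℕ.≤-reflexive (cong (j ℕ.* (m ℕ.+ m) ℕ.+_) size)) (ℕ.≤-trans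
      (ℕ.+-monoʳ-≤ (j ℕ.* (m ℕ.+ m)) {2} {512 ℕ.* (k ℕ.* k ℕ.* μ)} (ℕ.*-mono-≤ {2} {512} (s≤s (s≤s z≤n)) (ℕ.*-mono-≤ (ℕ.*-mono-≤ 1≤k 1≤k) 1≤μ)))
      (ℕ.≤-reflexive (solve 2 (λ k μ → con 2 :* (con 4 :* k :* (con 4 :* k)) :* (con 8 :* μ :+ con 8 :* μ) :+ con 512 :* (k :* k :* μ) := con 1024 :* (k :* k) :* μ) refl k μ)))) n≥
      where open ℕ.+-*-Solver
    l≤m : l ℕ.* 2 ℕ.+ l ℕ.≤ m
    l≤m = ℕ.≤-trans (ℕ.≤-trans (ℕ.≤-reflexive (solve 1 (λ l → l :* con 2 :+ l := con 3 :* l) refl l)) (ℕ.*-monoˡ-≤ l (ℕ.n≤1+n 3)))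
      (ℕ.≤-trans 4l≤μ (ℕ.m≤m+n μ (7 ℕ.* μ)))
      where open ℕ.+-*-Solver
    y = ½ * x ↑ 2
    0≤y : 0ℚ ≤ y
    0≤y = *-nonneg 0≤½ (↑-nonneg 0≤x 2)
    y≤1 : y ≤ 1ℚ
    y≤1 = *-mono-≤ 0≤1 (↑-nonneg 0≤x 2) (p≤p+q {½} {½} 0≤½) (↑≤1 0≤x x≤1 2)
    1≤jy : 1ℚ ≤ ι j * y
    1≤jy = begin
      1ℚ * 1ℚ                                              ≤⟨ *-mono-≤ (≤-trans 0≤1 1≤4kx) 0≤1 1≤4kx 1≤4kx ⟩
      (ι (4 ℕ.* k) * x) * (ι (4 ℕ.* k) * x)                ≡⟨ solve 2 (λ c x → (c :* x) :* (c :* x) := con 2ℚ :* (c :* c) :* (con ½ :* (x :* (x :* con 1ℚ)))) refl (ι (4 ℕ.* k)) x ⟩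
      2ℚ * (ι (4 ℕ.* k) * ι (4 ℕ.* k)) * y                 ≡⟨ cong (_* y) (trans (ι-* 2 (4 ℕ.* k ℕ.* (4 ℕ.* k))) (cong (2ℚ *_) (ι-* (4 ℕ.* k) (4 ℕ.* k)))) ⟨
      ι j * y                                              ∎
      where open +-*-Solver
    bound : ∀ {S : List (Fin n)} → length S ≡ 2 → 2ℚ ↑ m * (1ℚ - ½ * x ↑ length S) ↑ (j ℕ.* (m ℕ.+ m)) ≤ ½ ↑ m
    bound {S} size = begin
      2ℚ ↑ m * (1ℚ - ½ * x ↑ length S) ↑ (j ℕ.* (m ℕ.+ m)) ≡⟨ cong (λ r → 2ℚ ↑ m * (1ℚ - ½ * x ↑ r) ↑ (j ℕ.* (m ℕ.+ m))) size ⟩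
      2ℚ ↑ m * (1ℚ - y) ↑ (j ℕ.* (m ℕ.+ m))                ≤⟨ *-monoˡ-≤-nonNeg (2ℚ ↑ m) {{nonNegative (↑-nonneg 0≤2 m)}} ([1-y]↑≤½↑ 0≤y y≤1 {j} (m ℕ.+ m) 1≤jy) ⟩
      2ℚ ↑ m * ½ ↑ (m ℕ.+ m)                               ≡⟨ 2↑*½↑ m m ⟩
      ½ ↑ m                                                ∎

  -- Overlapping pairs of lists are joined by a shared vertex, so the union bound asks for a
  -- crossing edge only when the pair is disjoint.
  rarely-unjoined : Rarely¬ (½ ↑ l) (λ E → Joined (graph E) t)
  rarely-unjoined = weaken (union-bound (l ℕ.* t ℕ.+ l ℕ.* t) (3 ℕ.* l ℕ.* t) l count≤ ≤-refl exponent)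
    (weaken (≤-reflexive (cong (λ N → ι N * ½ ↑ (3 ℕ.* l ℕ.* t)) (trans (length-cartesianProductWith _,_ (tuples n t) (tuples n t)) (cong₂ ℕ._*_ (length-tuples n t) (length-tuples n t)))))
      (implies (λ _ h → joined h) (all (cartesianProduct (tuples n t) (tuples n t)) rare)))
    where
    Disjoint : List (Fin n) → List (Fin n) → Set
    Disjoint as bs = All (λ a → a ∉ˡ bs) as
    Separated : List (Fin n) × List (Fin n) → Set
    Separated (as , bs) = Unique as × Unique bs × length as ≡ t × length bs ≡ t × Disjoint as bs
    disjoint? : ∀ as bs → Dec (Disjoint as bs)
    disjoint? as bs = All.all? (λ a → ¬? (Any.any? (a Fin.≟_) bs)) as
    separated? : ∀ ab → Dec (Separated ab)
    separated? (as , bs) = unique? as ×-dec unique? bs ×-dec (length as ℕ.≟ t) ×-dec (length bs ℕ.≟ t) ×-dec disjoint? as bs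
    Crossing : List (Edge n) → List (Fin n) × List (Fin n) → Set
    Crossing E (as , bs) = Any (λ a → Any (λ b → a ~⟨ E ⟩ b) bs) as
    rare : ∀ ab → Rarely¬ (½ ↑ (3 ℕ.* l ℕ.* t)) (λ E → Separated ab → Crossing E ab)
    rare (as , bs) = given (separated? (as , bs)) (↑-nonneg 0≤½ (3 ℕ.* l ℕ.* t))
      (λ (as! , bs! , as≡t , bs≡t , disjoint) → weaken
        (≤-trans (≤-reflexive (cong₂ (λ i j → (1ℚ - x) ↑ (i ℕ.* j)) bs≡t as≡t))
          (≤-trans (≤-reflexive (cong ((1ℚ - x) ↑_) (ℕ.*-assoc (4 ℕ.* k) (3 ℕ.* l) t)))
            ([1-y]↑≤½↑ 0≤x x≤1 {4 ℕ.* k} (3 ℕ.* l ℕ.* t) 1≤4kx)))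
        (crossing-edge as! bs! (All.lookup disjoint)))
    joined : ∀ {E} → All (λ ab → Separated ab → Crossing E ab) (cartesianProduct (tuples n t) (tuples n t)) → Joined (graph E) t
    joined {E} h as bs as! bs! as≡t bs≡t with disjoint? as bs
    ... | yes disjoint =
      let a , a∈ , any = find (All.lookup h (∈-cartesianProduct⁺ (subst (λ r → as ∈ˡ tuples n r) as≡t (∈-tuples as)) (subst (λ r → bs ∈ˡ tuples n r) bs≡t (∈-tuples bs)))
                           (as! , bs! , as≡t , bs≡t , disjoint))
          b , b∈ , adj = find any
      in a , b , a∈ , b∈ , inj₂ adj
    ... | no ¬disjoint with find (All.¬All⇒Any¬ (λ a → ¬? (Any.any? (a Fin.≟_) bs)) as ¬disjoint)
    ...   | a , a∈ , ¬¬a∈bs = a , a , a∈ , decidable-stable (Any.any? (a Fin.≟_) bs) ¬¬a∈bs , inj₁ refl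
    count≤ : n ℕ.^ t ℕ.* n ℕ.^ t ℕ.≤ 2 ℕ.^ (l ℕ.* t ℕ.+ l ℕ.* t)
    count≤ = ℕ.≤-trans (ℕ.*-mono-≤ (n^r≤ t) (n^r≤ t)) (ℕ.≤-reflexive (sym (ℕ.^-distribˡ-+-* 2 (l ℕ.* t) (l ℕ.* t))))
    exponent : l ℕ.* t ℕ.+ l ℕ.* t ℕ.+ l ℕ.≤ 3 ℕ.* l ℕ.* t
    exponent = ℕ.≤-trans (ℕ.+-monoʳ-≤ (l ℕ.* t ℕ.+ l ℕ.* t) (subst (ℕ._≤ l ℕ.* t) (ℕ.*-identityʳ l) (ℕ.*-monoʳ-≤ l 1≤t)))
      (ℕ.≤-reflexive (solve 2 (λ l t → l :* t :+ l :* t :+ l :* t := con 3 :* l :* t) refl l t))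
      where open ℕ.+-*-Solver

  rarely-pseudorandom : Rarely¬ (½ ↑ l + (½ ↑ l + (½ ↑ l + (½ ↑ l + ½ ↑ l)))) (λ E → Pseudorandom (graph E) (sampleSize k l) (minCodegree μ) (maxDegree k μ) (maxCodegree μ) (maxTricodegree μ))
  rarely-pseudorandom = implies (λ _ (j , s , d , c , tri) → pseudorandom j s d c tri)
    (both rarely-unjoined (both rarely-small (both
      (rarely-large 0 (2048 ℕ.* (k ℕ.* μ)) (k ℕ.* μ)
        (ℕ.≤-trans n≤ (ℕ.≤-reflexive (regroup₁ 2048))) (ℕ.≤-trans (l*≤ 1 (s≤s z≤n)) (ℕ.≤-trans 4l≤μ (subst (ℕ._≤ k ℕ.* μ) (ℕ.*-identityˡ μ) (ℕ.*-monoˡ-≤ μ 1≤k)))))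
      (both
        (rarely-large 1 (2048 ℕ.* μ) μ (ℕ.≤-trans n≤ (ℕ.≤-reflexive (regroup₂ 2048))) (ℕ.≤-trans (l*≤ 2 (s≤s (s≤s z≤n))) 4l≤μ))
        -- `2048 ≤ k` turns `2048 k² μ` into at most `k³ μ`: here the smallness of `x` makes the
        -- tricodegrees small against `m`.
        (rarely-large 2 μ μ (ℕ.≤-trans n≤ (ℕ.≤-trans (ℕ.*-monoˡ-≤ μ (ℕ.*-monoˡ-≤ (k ℕ.* k) 2048≤k)) (ℕ.≤-reflexive regroup₃))) (ℕ.≤-trans (l*≤ 3 ℕ.≤-refl) 4l≤μ))))))
    where
    open ℕ.+-*-Solver
    regroup₁ : ∀ c → c ℕ.* (k ℕ.* k) ℕ.* μ ≡ k ℕ.* 1 ℕ.* (c ℕ.* (k ℕ.* μ))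
    regroup₁ c = solve 3 (λ c k μ → c :* (k :* k) :* μ := k :* con 1 :* (c :* (k :* μ))) refl c k μ
    regroup₂ : ∀ c → c ℕ.* (k ℕ.* k) ℕ.* μ ≡ k ℕ.* (k ℕ.* 1) ℕ.* (c ℕ.* μ)
    regroup₂ c = solve 3 (λ c k μ → c :* (k :* k) :* μ := k :* (k :* con 1) :* (c :* μ)) refl c k μ
    regroup₃ : k ℕ.* (k ℕ.* k) ℕ.* μ ≡ k ℕ.* (k ℕ.* (k ℕ.* 1)) ℕ.* μ
    regroup₃ = solve 2 (λ k μ → k :* (k :* k) :* μ := k :* (k :* (k :* con 1)) :* μ) refl k μ
    l*≤ : ∀ r → r ℕ.≤ 3 → l ℕ.* r ℕ.+ l ℕ.≤ 4 ℕ.* l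
    l*≤ r r≤3 = ℕ.≤-trans (ℕ.+-monoˡ-≤ l (ℕ.*-monoʳ-≤ l r≤3)) (ℕ.≤-reflexive (solve 1 (λ l → l :* con 3 :+ l := con 4 :* l) refl l))
    2≤n : 2 ℕ.≤ n
    2≤n = ℕ.≤-trans (ℕ.*-mono-≤ {2} {1024 ℕ.* (k ℕ.* k)} {1} (ℕ.*-mono-≤ {2} {1024} (s≤s (s≤s z≤n)) (ℕ.*-mono-≤ 1≤k 1≤k)) 1≤μ) n≥
    pseudorandom : ∀ {E} → Joined (graph E) t →
      (∀ S → Unique S → length S ≡ 2 → m ℕ.≤ codegree (graph E) S) →
      (∀ S → Unique S → length S ≡ 1 → codegree (graph E) S ℕ.< 2048 ℕ.* (k ℕ.* μ) ℕ.+ k ℕ.* μ) →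
      (∀ S → Unique S → length S ≡ 2 → codegree (graph E) S ℕ.< 2048 ℕ.* μ ℕ.+ μ) →
      (∀ S → Unique S → length S ≡ 3 → codegree (graph E) S ℕ.< μ ℕ.+ μ) →
      Pseudorandom (graph E) (sampleSize k l) (minCodegree μ) (maxDegree k μ) (maxCodegree μ) (maxTricodegree μ)
    pseudorandom {E} j s d c tri = record
      { joined = j
      ; codeg≥ = codeg≥
      ; deg≤ = λ u → ℕ.≤-trans (ℕ.<⇒≤ (d (u ∷ []) ([] ∷ []) refl)) (ℕ.≤-reflexive (ℕ.+-comm (2048 ℕ.* (k ℕ.* μ)) (k ℕ.* μ)))
      ; codeg≤ = λ u v u≢v → ℕ.≤-trans (ℕ.<⇒≤ (c (u ∷ v ∷ []) ((u≢v ∷ []) ∷ [] ∷ []) refl)) (ℕ.≤-reflexive (ℕ.+-comm (2048 ℕ.* μ) μ))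
      ; tricodeg≤ = λ u v w u≢v u≢w v≢w → ℕ.≤-trans (ℕ.<⇒≤ (tri (u ∷ v ∷ w ∷ []) ((u≢v ∷ u≢w ∷ []) ∷ (v≢w ∷ []) ∷ [] ∷ []) refl))
          (ℕ.≤-reflexive (cong (μ ℕ.+_) (sym (ℕ.+-identityʳ μ))))
      }
      where
      codeg≥ : ∀ u v → m ℕ.≤ codegree (graph E) (u ∷ v ∷ [])
      codeg≥ u v with u Fin.≟ v
      ... | no u≢v = s (u ∷ v ∷ []) ((u≢v ∷ []) ∷ [] ∷ []) refl
      -- At `u ≡ v` the codegree is the degree of `u`, which is at least its codegree with any other
      -- vertex.
      ... | yes refl =
        let w , u≢w = another 2≤n u
        in ℕ.≤-trans (s (u ∷ w ∷ []) ((u≢w ∷ []) ∷ [] ∷ []) refl)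
             (count-mono (CommonNeighbour? (graph E) (u ∷ w ∷ [])) (CommonNeighbour? (graph E) (u ∷ u ∷ [])) (λ { (p ∷ _) → p ∷ p ∷ [] }) (allFin n))

-- Choice of scales

binary-length : ∀ n → ∃ λ l → suc n ℕ.≤ 2 ℕ.^ l × 2 ℕ.^ l ℕ.≤ 2 ℕ.* suc n
binary-length zero = 0 , s≤s z≤n , s≤s z≤n
binary-length (suc n) with binary-length n
... | l , n≤ , ≤2n with suc (suc n) ℕ.≤? 2 ℕ.^ l
...   | yes n+1≤ = l , n+1≤ , ℕ.≤-trans ≤2n (ℕ.*-monoʳ-≤ 2 (ℕ.n≤1+n (suc n)))
...   | no n+1≰  = suc l
                 , ℕ.≤-trans (ℕ.≤-trans (ℕ.+-monoʳ-≤ 1 n≤) (ℕ.+-monoˡ-≤ (2 ℕ.^ l) (ℕ.≤-trans (s≤s z≤n) n≤)))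
                             (ℕ.≤-reflexive (cong (2 ℕ.^ l ℕ.+_) (sym (ℕ.+-identityʳ (2 ℕ.^ l)))))
                 , ℕ.*-monoʳ-≤ 2 (ℕ.<⇒≤ (ℕ.≰⇒> n+1≰))

suc≤2^ : ∀ j → suc j ℕ.≤ 2 ℕ.^ j
suc≤2^ zero    = s≤s z≤n
suc≤2^ (suc j) = ℕ.≤-trans (ℕ.+-mono-≤ (ℕ.≤-trans (s≤s z≤n) (suc≤2^ j)) (suc≤2^ j))
  (ℕ.≤-reflexive (cong (2 ℕ.^ j ℕ.+_) (sym (ℕ.+-identityʳ (2 ℕ.^ j)))))

-- With `j = l / 8` one has `l ≤ 8 (j + 1) ≤ 8 * 2^j`, so the left side is at most `2^(13 + 4j)`;
-- `32 ≤ l` gives `j ≥ 4`, whence `13 ≤ 4j`.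
2l⁴≤2^l : ∀ l → 32 ℕ.≤ l → 2 ℕ.* l ℕ.^ 4 ℕ.≤ 2 ℕ.^ l
2l⁴≤2^l l 32≤l = begin
  2 ℕ.* l ℕ.^ 4                         ≤⟨ ℕ.*-monoʳ-≤ 2 (ℕ.^-monoˡ-≤ 4 l≤) ⟩
  2 ℕ.* (8 ℕ.* 2 ℕ.^ j) ℕ.^ 4           ≡⟨ solve 1 (λ a → con 2 :* (con 8 :* a) :^ 4 := con 8192 :* a :^ 4) refl (2 ℕ.^ j) ⟩
  2 ℕ.^ 13 ℕ.* (2 ℕ.^ j) ℕ.^ 4          ≡⟨ cong (2 ℕ.^ 13 ℕ.*_) (ℕ.^-*-assoc 2 j 4) ⟩
  2 ℕ.^ 13 ℕ.* 2 ℕ.^ (j ℕ.* 4)          ≡⟨ ℕ.^-distribˡ-+-* 2 13 (j ℕ.* 4) ⟨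
  2 ℕ.^ (13 ℕ.+ j ℕ.* 4)                ≤⟨ ℕ.^-monoʳ-≤ 2 exponent ⟩
  2 ℕ.^ l                               ∎
  where
  open ℕ.≤-Reasoning
  open ℕ.+-*-Solver
  j = l ℕ./ 8
  l≡ : l ≡ l ℕ.% 8 ℕ.+ j ℕ.* 8
  l≡ = ℕ.m≡m%n+[m/n]*n l 8
  l≤ : l ℕ.≤ 8 ℕ.* 2 ℕ.^ j
  l≤ = begin
    l                           ≡⟨ l≡ ⟩
    l ℕ.% 8 ℕ.+ j ℕ.* 8         ≤⟨ ℕ.+-monoˡ-≤ (j ℕ.* 8) (ℕ.<⇒≤ (ℕ.m%n<n l 8)) ⟩
    suc j ℕ.* 8                 ≡⟨ ℕ.*-comm (suc j) 8 ⟩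
    8 ℕ.* suc j                 ≤⟨ ℕ.*-monoʳ-≤ 8 (suc≤2^ j) ⟩
    8 ℕ.* 2 ℕ.^ j               ∎
  exponent : 13 ℕ.+ j ℕ.* 4 ℕ.≤ l
  exponent = begin
    13 ℕ.+ j ℕ.* 4              ≤⟨ ℕ.+-monoˡ-≤ (j ℕ.* 4) (ℕ.≤-trans (ℕ.m≤m+n 13 3) (ℕ.*-monoˡ-≤ 4 {4} {j} (ℕ./-monoˡ-≤ 8 32≤l))) ⟩
    j ℕ.* 4 ℕ.+ j ℕ.* 4         ≡⟨ ℕ.*-distribˡ-+ j 4 4 ⟨
    j ℕ.* 8                     ≤⟨ ℕ.m≤n+m (j ℕ.* 8) (l ℕ.% 8) ⟩
    l ℕ.% 8 ℕ.+ j ℕ.* 8         ≡⟨ l≡ ⟨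
    l                           ∎

transition : {P : Pred ℕ 0ℓ} → Decidable P → ¬ P 0 → ∀ n → P n → ∃ λ j → ¬ P j × P (suc j)
transition P? ¬P0 zero    P0 = contradiction P0 ¬P0
transition P? ¬P0 (suc n) Pn with P? n
... | yes p = transition P? ¬P0 n p
... | no ¬p = n , ¬p , Pn

-- `k` is a point where `4kx` crosses 1, which gives `1/(4k) ≤ x`. From `4(k-1)x < 1` and
-- `2k ≤ 4(k-1)` follows `x ≤ 1/(2k)`. The constant is `32768 = 4 * 8192`, with `8192` the lower
-- bound wanted for `k`.
module Scale {n : ℕ} {x : ℚ} (0<x : 0ℚ < x) (x-small : ι 32768 * x < 1ℚ) (dense : 1ℚ ≤ ι n * x ↑ 10) where
  private
    0≤x : 0ℚ ≤ x
    0≤x = <⇒≤ 0<x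

  x≤1 : x ≤ 1ℚ
  x≤1 = begin
    x             ≡⟨ *-identityˡ x ⟨
    1ℚ * x        ≤⟨ *-monoʳ-≤-nonNeg x {{nonNegative 0≤x}} (ι-mono (s≤s (z≤n {32767}))) ⟩
    ι 32768 * x   ≤⟨ <⇒≤ x-small ⟩
    1ℚ            ∎
    where open ≤-Reasoning

  private
    Large : Pred ℕ 0ℓ
    Large k = 1ℚ ≤ ι (4 ℕ.* k) * x

    crossover : ∃ λ j → ¬ Large j × Large (suc j)
    crossover = transition (λ k → 1ℚ ≤? ι (4 ℕ.* k) * x) (λ 1≤0 → contradiction (subst (1ℚ ≤_) (*-zeroˡ x) 1≤0) (<⇒≱ (positive⁻¹ 1ℚ))) n (begin
      1ℚ                   ≤⟨ dense ⟩
      ι n * (x * x ↑ 9)    ≤⟨ *-monoˡ-≤-nonNeg (ι n) {{nonNegative (ι-nonneg n)}} (*-monoˡ-≤-nonNeg x {{nonNegative 0≤x}} (↑≤1 0≤x x≤1 9)) ⟩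
      ι n * (x * 1ℚ)       ≡⟨ cong (ι n *_) (*-identityʳ x) ⟩
      ι n * x              ≤⟨ *-monoʳ-≤-nonNeg x {{nonNegative 0≤x}} (ι-mono (ℕ.m≤m+n n (3 ℕ.* n))) ⟩
      ι (4 ℕ.* n) * x      ∎)
      where open ≤-Reasoning

  k : ℕ
  k = suc (proj₁ crossover)

  1≤4kx : 1ℚ ≤ ι (4 ℕ.* k) * x
  1≤4kx = proj₂ (proj₂ crossover)

  8192≤k : 8192 ℕ.≤ k
  8192≤k = ℕ.≮⇒≥ λ k< → <⇒≱ x-small (≤-trans 1≤4kx
    (*-monoʳ-≤-nonNeg x {{nonNegative 0≤x}} (ι-mono {4 ℕ.* k} {32768} (ℕ.*-monoʳ-≤ 4 (ℕ.<⇒≤ k<)))))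

  2kx≤1 : ι (2 ℕ.* k) * x ≤ 1ℚ
  2kx≤1 = ≤-trans (*-monoʳ-≤-nonNeg x {{nonNegative 0≤x}} (ι-mono 2k≤4j)) (<⇒≤ (≰⇒> (proj₁ (proj₂ crossover))))
    where
    j = proj₁ crossover
    2k≤4j : 2 ℕ.* suc j ℕ.≤ 4 ℕ.* j
    2k≤4j = ℕ.≤-trans (ℕ.*-monoʳ-≤ 2 (ℕ.+-monoˡ-≤ j (ℕ.≤-trans (s≤s z≤n) (ℕ.s≤s⁻¹ 8192≤k))))
      (ℕ.≤-reflexive (solve 1 (λ j → con 2 :* (j :+ j) := con 4 :* j) refl j))
      where open ℕ.+-*-Solver

  [2k]^10≤n : (2 ℕ.* k) ℕ.^ 10 ℕ.≤ n
  [2k]^10≤n = ι-cancel (begin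
    ι ((2 ℕ.* k) ℕ.^ 10)                    ≡⟨ trans (ι-^ (2 ℕ.* k) 10) (sym (*-identityʳ (ι (2 ℕ.* k) ↑ 10))) ⟩
    ι (2 ℕ.* k) ↑ 10 * 1ℚ                   ≤⟨ *-monoˡ-≤-nonNeg (ι (2 ℕ.* k) ↑ 10) {{nonNegative (↑-nonneg (ι-nonneg (2 ℕ.* k)) 10)}} dense ⟩
    ι (2 ℕ.* k) ↑ 10 * (ι n * x ↑ 10)       ≡⟨ swap (ι (2 ℕ.* k) ↑ 10) (ι n) (x ↑ 10) ⟩
    ι n * (ι (2 ℕ.* k) ↑ 10 * x ↑ 10)       ≡⟨ cong (ι n *_) (Exp.^-distrib-* (ι (2 ℕ.* k)) x 10) ⟨
    ι n * (ι (2 ℕ.* k) * x) ↑ 10            ≤⟨ *-monoˡ-≤-nonNeg (ι n) {{nonNegative (ι-nonneg n)}} (↑≤1 (*-nonneg (ι-nonneg (2 ℕ.* k)) 0≤x) 2kx≤1 10) ⟩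
    ι n * 1ℚ                                ≡⟨ *-identityʳ (ι n) ⟩
    ι n                                     ∎)
    where
    open ≤-Reasoning
    swap : ∀ a b c → a * (b * c) ≡ b * (a * c)
    swap = solve 3 (λ a b c → a :* (b :* c) := b :* (a :* c)) refl
      where open +-*-Solver

-- The coefficients are variables because large literals would unfold to unary.
private
  module _ where
    open ℕ.+-*-Solver

    rearrange₁ : ∀ a b k u → a ℕ.* (k ℕ.* k) ℕ.* (b ℕ.* u) ≡ a ℕ.* b ℕ.* (u ℕ.* (k ℕ.* k))
    rearrange₁ = solve 4 (λ a b k u → a :* (k :* k) :* (b :* u) := a :* b :* (u :* (k :* k))) refl

    rearrange₂ : ∀ a k u → a ℕ.* k ℕ.* (u ℕ.* (k ℕ.* k)) ≡ a ℕ.* (k ℕ.* u ℕ.* (k ℕ.* k))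
    rearrange₂ = solve 3 (λ a k u → a :* k :* (u :* (k :* k)) := a :* (k :* u :* (k :* k))) refl

    rearrange₃ : ∀ a kk μ → a ℕ.* kk ℕ.* (μ ℕ.+ μ) ≡ (a ℕ.+ a) ℕ.* kk ℕ.* μ
    rearrange₃ = solve 3 (λ a kk μ → a :* kk :* (μ :+ μ) := (a :+ a) :* kk :* μ) refl

    rearrange₄ : ∀ c e k μ → c ℕ.* μ ℕ.* (e ℕ.* (k ℕ.* μ)) ℕ.+ 2 ℕ.* (c ℕ.* μ ℕ.* (c ℕ.* (k ℕ.* μ))) ≡
                             (c ℕ.* e ℕ.+ 2 ℕ.* (c ℕ.* c)) ℕ.* (k ℕ.* μ ℕ.* μ)
    rearrange₄ = solve 4 (λ c e k μ → c :* μ :* (e :* (k :* μ)) :+ con 2 :* (c :* μ :* (c :* (k :* μ))) := (c :* e :+ con 2 :* (c :* c)) :* (k :* μ :* μ)) refl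

    rearrange₅ : ∀ a e k μ → a ℕ.* e ℕ.* k ℕ.* (k ℕ.* μ ℕ.* μ) ≡ a ℕ.* (k ℕ.* k) ℕ.* μ ℕ.* (e ℕ.* μ)
    rearrange₅ = solve 4 (λ a e k μ → a :* e :* k :* (k :* μ :* μ) := a :* (k :* k) :* μ :* (e :* μ)) refl

module Sizes {n k l : ℕ} (8192≤k : 8192 ℕ.≤ k) (1≤l : 1 ℕ.≤ l) ([2k]^10≤n : (2 ℕ.* k) ℕ.^ 10 ℕ.≤ n) (l⁴≤n : l ℕ.^ 4 ℕ.≤ n) where
  private
    1≤k : 1 ℕ.≤ k
    1≤k = ℕ.≤-trans (s≤s z≤n) 8192≤k

    q : ℕ
    q = 1024 ℕ.* (k ℕ.* k)

    1≤q : 1 ℕ.≤ q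
    1≤q = ℕ.*-mono-≤ {1} {1024} (s≤s z≤n) (ℕ.*-mono-≤ 1≤k 1≤k)

    instance
      q≢0 : ℕ.NonZero q
      q≢0 = ℕ.>-nonZero 1≤q

  μ : ℕ
  μ = n ℕ./ q

  n≥ : q ℕ.* μ ℕ.≤ n
  n≥ = ℕ.≤-trans (ℕ.≤-reflexive (ℕ.*-comm q μ)) (ℕ.m/n*n≤m n q)

  private
    kkll : ℕ
    kkll = k ℕ.* k ℕ.* (l ℕ.* l)

    -- The geometric mean of `(2k)^10 ≤ n` and `l^4 ≤ n`: the square of `32 k^5 l²` is
    -- `(2k)^10 l^4`.
    n≥32k⁵l² : 32 ℕ.* (k ℕ.* kkll ℕ.* (k ℕ.* k)) ℕ.≤ n
    n≥32k⁵l² = ℕ.≮⇒≥ λ n< → ℕ.<-irrefl refl (begin-strict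
      n ℕ.* n                                       <⟨ ℕ.*-mono-< n< n< ⟩
      32 ℕ.* (k ℕ.* kkll ℕ.* (k ℕ.* k)) ℕ.* (32 ℕ.* (k ℕ.* kkll ℕ.* (k ℕ.* k)))
        ≡⟨ solve 2 (λ k l → con 32 :* (k :* (k :* k :* (l :* l)) :* (k :* k)) :* (con 32 :* (k :* (k :* k :* (l :* l)) :* (k :* k))) := (con 2 :* k) :^ 10 :* l :^ 4) refl k l ⟩
      (2 ℕ.* k) ℕ.^ 10 ℕ.* l ℕ.^ 4                   ≤⟨ ℕ.*-mono-≤ [2k]^10≤n l⁴≤n ⟩
      n ℕ.* n                                       ∎)
      where
      open ℕ.≤-Reasoning
      open ℕ.+-*-Solver

    q*216≤n : q ℕ.* (216 ℕ.* kkll) ℕ.≤ n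
    q*216≤n = begin
      q ℕ.* (216 ℕ.* kkll)                    ≡⟨ rearrange₁ 1024 216 k kkll ⟩
      -- The fifth power of `k` is one more than required; the spare factor, at least `8192`,
      -- absorbs the constants.
      1024 ℕ.* 216 ℕ.* (kkll ℕ.* (k ℕ.* k))   ≤⟨ ℕ.*-monoˡ-≤ (kkll ℕ.* (k ℕ.* k)) (ℕ.≤-trans (from-yes (1024 ℕ.* 216 ℕ.≤? 32 ℕ.* 8192)) (ℕ.*-monoʳ-≤ 32 8192≤k)) ⟩
      32 ℕ.* k ℕ.* (kkll ℕ.* (k ℕ.* k))       ≡⟨ rearrange₂ 32 k kkll ⟩
      32 ℕ.* (k ℕ.* kkll ℕ.* (k ℕ.* k))       ≤⟨ n≥32k⁵l² ⟩
      n                                       ∎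
      where
      open ℕ.≤-Reasoning
      open ℕ.+-*-Solver

    n<q[1+μ] : n ℕ.< q ℕ.* suc μ
    n<q[1+μ] = begin-strict
      n                          ≡⟨ ℕ.m≡m%n+[m/n]*n n q ⟩
      n ℕ.% q ℕ.+ μ ℕ.* q        <⟨ ℕ.+-monoˡ-< (μ ℕ.* q) (ℕ.m%n<n n q) ⟩
      suc μ ℕ.* q                ≡⟨ ℕ.*-comm (suc μ) q ⟩
      q ℕ.* suc μ                ∎
      where open ℕ.≤-Reasoning

    216kkll≤μ : 216 ℕ.* kkll ℕ.≤ μ
    216kkll≤μ = ℕ.≮⇒≥ λ μ< → ℕ.<-irrefl refl (ℕ.<-≤-trans n<q[1+μ] (ℕ.≤-trans (ℕ.*-monoʳ-≤ q μ<) q*216≤n))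

    l≤kkll : l ℕ.≤ kkll
    l≤kkll = ℕ.≤-trans (ℕ.≤-reflexive (sym (trans (ℕ.*-identityˡ (1 ℕ.* l)) (ℕ.*-identityˡ l)))) (ℕ.*-mono-≤ {1} {k ℕ.* k} (ℕ.*-mono-≤ 1≤k 1≤k) (ℕ.*-monoˡ-≤ l 1≤l))

  4l≤μ : 4 ℕ.* l ℕ.≤ μ
  4l≤μ = ℕ.≤-trans (ℕ.*-mono-≤ {4} {216} (from-yes (4 ℕ.≤? 216)) l≤kkll) 216kkll≤μ

  1≤μ : 1 ℕ.≤ μ
  1≤μ = ℕ.≤-trans (ℕ.*-mono-≤ {1} {4} (s≤s z≤n) 1≤l) 4l≤μ

  n≤ : n ℕ.≤ 2048 ℕ.* (k ℕ.* k) ℕ.* μ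
  n≤ = begin
    n                             ≤⟨ ℕ.<⇒≤ n<q[1+μ] ⟩
    q ℕ.* suc μ                   ≤⟨ ℕ.*-monoʳ-≤ q (ℕ.+-monoˡ-≤ μ 1≤μ) ⟩
    q ℕ.* (μ ℕ.+ μ)               ≡⟨ rearrange₃ 1024 (k ℕ.* k) μ ⟩
    2048 ℕ.* (k ℕ.* k) ℕ.* μ      ∎
    where
    open ℕ.≤-Reasoning
    open ℕ.+-*-Solver

  large : 4 ℕ.* (sampleSize k l ℕ.* sampleSize k l ℕ.+ (sampleSize k l ℕ.+ sampleSize k l)) ℕ.≤ minCodegree μ
  large = begin
    4 ℕ.* (t ℕ.* t ℕ.+ (t ℕ.+ t))                 ≤⟨ ℕ.*-monoʳ-≤ 4 (ℕ.+-monoʳ-≤ (t ℕ.* t) (ℕ.+-mono-≤ t≤tt t≤tt)) ⟩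
    -- The origin of `216`: `12 t² = 12 * 144 k² l² = 8 * 216 k² l²`.
    4 ℕ.* (t ℕ.* t ℕ.+ (t ℕ.* t ℕ.+ t ℕ.* t))     ≡⟨ solve 2 (λ k l → let t = con 4 :* k :* (con 3 :* l) in con 4 :* (t :* t :+ (t :* t :+ t :* t)) := con 8 :* (con 216 :* (k :* k :* (l :* l)))) refl k l ⟩
    8 ℕ.* (216 ℕ.* kkll)                          ≤⟨ ℕ.*-monoʳ-≤ 8 216kkll≤μ ⟩
    8 ℕ.* μ                                       ∎
    where
    open ℕ.≤-Reasoning
    open ℕ.+-*-Solver
    t = 4 ℕ.* k ℕ.* (3 ℕ.* l)
    1≤t : 1 ℕ.≤ t
    1≤t = ℕ.*-mono-≤ (ℕ.*-mono-≤ (s≤s (z≤n {3})) 1≤k) (ℕ.*-mono-≤ (s≤s (z≤n {2})) 1≤l)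
    t≤tt : t ℕ.≤ t ℕ.* t
    t≤tt = subst (ℕ._≤ t ℕ.* t) (ℕ.*-identityʳ t) (ℕ.*-monoʳ-≤ t 1≤t)

  -- The left side is of order `k μ²`, with leading constant `2 * 2049²`, while the right side is at
  -- least `8192 k² μ²`; the additional `k` outweighs the constants.
  sparse : maxCodegree μ ℕ.* minCodegree μ ℕ.+ 2 ℕ.* (maxCodegree μ ℕ.* maxDegree k μ) ℕ.< n ℕ.* minCodegree μ
  sparse = begin-strict
    c ℕ.* μ ℕ.* (8 ℕ.* μ) ℕ.+ 2 ℕ.* (c ℕ.* μ ℕ.* (c ℕ.* (k ℕ.* μ)))
      ≤⟨ ℕ.+-monoˡ-≤ (2 ℕ.* (c ℕ.* μ ℕ.* (c ℕ.* (k ℕ.* μ)))) (ℕ.*-monoʳ-≤ (c ℕ.* μ) (ℕ.*-monoʳ-≤ 8 μ≤kμ)) ⟩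
    c ℕ.* μ ℕ.* (8 ℕ.* (k ℕ.* μ)) ℕ.+ 2 ℕ.* (c ℕ.* μ ℕ.* (c ℕ.* (k ℕ.* μ)))
      ≡⟨ rearrange₄ c 8 k μ ⟩
    (c ℕ.* 8 ℕ.+ 2 ℕ.* (c ℕ.* c)) ℕ.* (k ℕ.* μ ℕ.* μ)
      <⟨ ℕ.*-monoˡ-< (k ℕ.* μ ℕ.* μ) {{ℕ.>-nonZero (ℕ.*-mono-≤ (ℕ.*-mono-≤ 1≤k 1≤μ) 1≤μ)}} (from-yes (c ℕ.* 8 ℕ.+ 2 ℕ.* (c ℕ.* c) ℕ.<? 1024 ℕ.* 8 ℕ.* 8192)) ⟩
    1024 ℕ.* 8 ℕ.* 8192 ℕ.* (k ℕ.* μ ℕ.* μ)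
      ≤⟨ ℕ.*-monoˡ-≤ (k ℕ.* μ ℕ.* μ) (ℕ.*-monoʳ-≤ (1024 ℕ.* 8) 8192≤k) ⟩
    1024 ℕ.* 8 ℕ.* k ℕ.* (k ℕ.* μ ℕ.* μ)
      ≡⟨ rearrange₅ 1024 8 k μ ⟩
    q ℕ.* μ ℕ.* (8 ℕ.* μ)
      ≤⟨ ℕ.*-monoˡ-≤ (8 ℕ.* μ) n≥ ⟩
    n ℕ.* (8 ℕ.* μ) ∎
    where
    open ℕ.≤-Reasoning
    open ℕ.+-*-Solver
    c = 2049
    μ≤kμ : μ ℕ.≤ k ℕ.* μ
    μ≤kμ = subst (ℕ._≤ k ℕ.* μ) (ℕ.*-identityˡ μ) (ℕ.*-monoˡ-≤ μ 1≤k)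

-- Probabilities as expectations.

sumℚ : List ℚ → ℚ
sumℚ = foldr _+_ 0ℚ

sumℚ-++ : ∀ xs ys → sumℚ (xs ++ ys) ≡ sumℚ xs + sumℚ ys
sumℚ-++ []       ys = sym (+-identityˡ (sumℚ ys))
sumℚ-++ (x ∷ xs) ys = trans (cong (x +_) (sumℚ-++ xs ys)) (sym (+-assoc x (sumℚ xs) (sumℚ ys)))

sumℚ-* : ∀ c xs → sumℚ (map (c *_) xs) ≡ c * sumℚ xs
sumℚ-* c []       = sym (*-zeroʳ c)
sumℚ-* c (x ∷ xs) = trans (cong (c * x +_) (sumℚ-* c xs)) (sym (*-distribˡ-+ c x (sumℚ xs)))

sumℚ-cong : ∀ {A : Set} {f g : A → ℚ} {xs} → All (λ a → f a ≡ g a) xs → sumℚ (map f xs) ≡ sumℚ (map g xs)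
sumℚ-cong []         = refl
sumℚ-cong (eq ∷ eqs) = cong₂ _+_ eq (sumℚ-cong eqs)

approx-sum : ∀ {A : Set} (w : A → ℝ) as i → approx (sumᴿ (map w as)) i ≡ sumℚ (map (λ a → approx (w a) i) as)
approx-sum w []       i = refl
approx-sum w (a ∷ as) i = cong (approx (w a) i +_) (approx-sum w as i)

approx-^ : ∀ x k i → approx (x ^ᴿ k) i ≡ approx x i ↑ k
approx-^ x zero    i = refl
approx-^ x (suc k) i = cong (approx x i *_) (approx-^ x k i)

𝟙 : ∀ {A : Set} → Dec A → ℚ
𝟙 a? = if does a? then 1ℚ else 0ℚ

sumℚ-filter : ∀ {A : Set} {P : A → Set} (P? : ∀ a → Dec (P a)) (w : A → ℚ) as →
              sumℚ (map w (filter P? as)) ≡ sumℚ (map (λ a → w a * 𝟙 (P? a)) as)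
sumℚ-filter P? w [] = refl
sumℚ-filter P? w (a ∷ as) with does (P? a)
... | true  = cong₂ _+_ (sym (*-identityʳ (w a))) (sumℚ-filter P? w as)
... | false = trans (sym (+-identityˡ _)) (cong₂ _+_ (sym (*-zeroʳ (w a))) (sumℚ-filter P? w as))

sublists-length : ∀ {A : Set} (L : List A) → All (λ E → length E ℕ.≤ length L) (sublists L)
sublists-length []      = z≤n ∷ []
sublists-length (e ∷ L) = All.++⁺ (All.map⁺ (All.map s≤s (sublists-length L))) (All.map ℕ.m≤n⇒m≤1+n (sublists-length L))

module _ {n : ℕ} (x : ℚ) where
  open Expectation {n} x

  private
    weight : List (Edge n) → List (Edge n) → ℚ
    weight L E = x ↑ length E * (1ℚ - x) ↑ (length L ℕ.∸ length E)

  -- Sublists with and without `e` split off the factors `x` and `1 - x`. In the second case the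
  -- truncated subtraction in the exponent needs `length E ≤ length L`.
  sum-sublists : ∀ L F → sumℚ (map (λ E → weight L E * F E) (sublists L)) ≡ 𝔼 L F
  sum-sublists []      F = trans (+-identityʳ (1ℚ * 1ℚ * F [])) (*-identityˡ (F []))
  sum-sublists (e ∷ L) F = begin
    sumℚ (map w (map (e ∷_) (sublists L) ++ sublists L))
      ≡⟨ trans (cong sumℚ (map-++ w (map (e ∷_) (sublists L)) (sublists L))) (sumℚ-++ (map w (map (e ∷_) (sublists L))) (map w (sublists L))) ⟩
    sumℚ (map w (map (e ∷_) (sublists L))) + sumℚ (map w (sublists L))
      ≡⟨ cong₂ _+_ present absent ⟩
    x * 𝔼 L (F ∘ (e ∷_)) + (1ℚ - x) * 𝔼 L F ∎
    where
    open ≡-Reasoning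
    w : List (Edge n) → ℚ
    w E = weight (e ∷ L) E * F E
    scaled : ∀ c (G : List (Edge n) → ℚ) → sumℚ (map (λ E → c * (weight L E * G E)) (sublists L)) ≡ c * 𝔼 L G
    scaled c G = trans (cong sumℚ (map-∘ (sublists L)))
      (trans (sumℚ-* c (map (λ E → weight L E * G E) (sublists L))) (cong (c *_) (sum-sublists L G)))
    present : sumℚ (map w (map (e ∷_) (sublists L))) ≡ x * 𝔼 L (F ∘ (e ∷_))
    present = trans (cong sumℚ (sym (map-∘ (sublists L)))) (trans
      (sumℚ-cong (All.universal (λ E → solve 4 (λ x a b c → x :* a :* b :* c := x :* (a :* b :* c)) refl
        x (x ↑ length E) ((1ℚ - x) ↑ (length L ℕ.∸ length E)) (F (e ∷ E))) (sublists L)))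
      (scaled x (F ∘ (e ∷_))))
      where open +-*-Solver
    absent : sumℚ (map w (sublists L)) ≡ (1ℚ - x) * 𝔼 L F
    absent = trans
      (sumℚ-cong (All.map (λ {E} ≤L → trans
        (cong (λ j → x ↑ length E * (1ℚ - x) ↑ j * F E) (ℕ.+-∸-assoc 1 ≤L))
        (solve 4 (λ y a b c → a :* (y :* b) :* c := y :* (a :* b :* c)) refl
          (1ℚ - x) (x ↑ length E) ((1ℚ - x) ↑ (length L ℕ.∸ length E)) (F E))) (sublists-length L)))
      (scaled (1ℚ - x) F)
      where open +-*-Solver

-- Sums, products and powers on `ℝ` act termwise, so each approximation of the probability is
-- exactly the expectation at the rational density `approx p i`, with no error term.
approx-ℙ : ∀ n (p : [0,1]) {A : Pred (Graph n) 0ℓ} (A? : Decidable A) i →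
           approx (ℙ n p A?) i ≡ Expectation.𝔼 (approx (proj₁ p) i) (possibleEdges n) (λ E → 𝟙 (A? (graph E)))
approx-ℙ n (p , p∈) A? i = begin
  approx (ℙ n (p , p∈) A?) i
    ≡⟨ approx-sum (λ E → p ^ᴿ length E *ᴿ (1ᴿ -ᴿ p) ^ᴿ (length (possibleEdges n) ℕ.∸ length E)) (filter (λ E → A? (graph E)) (sublists (possibleEdges n))) i ⟩
  sumℚ (map (λ E → approx (p ^ᴿ length E) i * approx ((1ᴿ -ᴿ p) ^ᴿ (length L ℕ.∸ length E)) i) (filter (λ E → A? (graph E)) (sublists L)))
    ≡⟨ sumℚ-cong (All.universal (λ E → cong₂ _*_ (approx-^ p (length E) i) (approx-^ (1ᴿ -ᴿ p) (length L ℕ.∸ length E) i)) (filter (λ E → A? (graph E)) (sublists L))) ⟩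
  sumℚ (map (λ E → x ↑ length E * (1ℚ - x) ↑ (length L ℕ.∸ length E)) (filter (λ E → A? (graph E)) (sublists L)))
    ≡⟨ sumℚ-filter (λ E → A? (graph E)) (λ E → x ↑ length E * (1ℚ - x) ↑ (length L ℕ.∸ length E)) (sublists L) ⟩
  sumℚ (map (λ E → x ↑ length E * (1ℚ - x) ↑ (length L ℕ.∸ length E) * 𝟙 (A? (graph E))) (sublists L))
    ≡⟨ sum-sublists x L (λ E → 𝟙 (A? (graph E))) ⟩
  Expectation.𝔼 x L (λ E → 𝟙 (A? (graph E))) ∎
  where
  open ≡-Reasoning
  L = possibleEdges n
  x = approx p i

-- Failure probability at a fixed rational density.

5× : ℚ → ℚ
5× h = h + (h + (h + (h + h)))

module _ {n : ℕ} {x : ℚ} (0<x : 0ℚ < x) (x-small : ι 32768 * x < 1ℚ) (dense : 1ℚ ≤ ι n * x ↑ 10) (2^32≤n : 2 ℕ.^ 32 ℕ.≤ n) where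
  open Scale {n} 0<x x-small dense
  open Expectation {n} x

  private
    0≤x : 0ℚ ≤ x
    0≤x = <⇒≤ 0<x

  open Events {n} x 0≤x x≤1

  𝔼-𝟙≤1 : ∀ {A : List (Edge n) → Set} (A? : ∀ E → Dec (A E)) → 𝔼 (possibleEdges n) (𝟙 ∘ A?) ≤ 1ℚ
  𝔼-𝟙≤1 A? = subst (𝔼 (possibleEdges n) (𝟙 ∘ A?) ≤_) (𝔼-const (possibleEdges n) 1ℚ)
    (𝔼-mono 0≤x x≤1 possibleEdges-ordered (λ E _ → 𝟙≤1 (A? E)))
    where
    𝟙≤1 : ∀ {A : Set} (a? : Dec A) → 𝟙 a? ≤ 1ℚ
    𝟙≤1 (yes _) = ≤-refl
    𝟙≤1 (no _)  = 0≤1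

  -- Pointwise the indicator plus the test is at least 1: where the event fails, the test is not
  -- below 1.
  markov : ∀ {A : List (Edge n) → Set} {β} (A? : ∀ E → Dec (A E)) → Rarely¬ β A → 1ℚ ≤ 𝔼 (possibleEdges n) (𝟙 ∘ A?) + β
  markov {β = β} A? r = begin
    1ℚ                                                      ≡⟨ 𝔼-const L 1ℚ ⟨
    𝔼 L (λ _ → 1ℚ)                                          ≤⟨ 𝔼-mono 0≤x x≤1 possibleEdges-ordered (λ E o → cover o (A? E)) ⟩
    𝔼 L (λ E → 𝟙 (A? E) + test E)                           ≡⟨ 𝔼-+ L (𝟙 ∘ A?) test ⟩
    𝔼 L (𝟙 ∘ A?) + 𝔼 L test                                 ≤⟨ +-monoʳ-≤ (𝔼 L (𝟙 ∘ A?)) expectation ⟩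
    𝔼 L (𝟙 ∘ A?) + β                                        ∎
    where
    open ≤-Reasoning
    open Rarely¬ r
    L = possibleEdges n
    cover : ∀ {E} → All Ordered E → (a? : Dec _) → 1ℚ ≤ 𝟙 a? + test E
    cover {E} o (yes _) = p≤p+q (nonneg o)
    cover {E} o (no ¬a) = subst (1ℚ ≤_) (sym (+-identityˡ (test E))) (≮⇒≥ (¬a ∘ holds o))

  Agreement : List (Edge n) → Set
  Agreement E = κ[ 1 ,𝔽₂] (graph E) ≡ δ[ 1 ] (graph E)

  agreement? : ∀ E → Dec (Agreement E)
  agreement? E = κ[ 1 ,𝔽₂] (graph E) ≟⁺ δ[ 1 ] (graph E)

  -- `h` bounds each of the five failure probabilities; the estimate `n h ≤ 1` is the form in which
  -- the limit uses it.
  Likely : ℚ → Set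
  Likely h = ι n * h ≤ 1ℚ × 1ℚ ≤ 𝔼 (possibleEdges n) (𝟙 ∘ agreement?) + 5× h

  private
    likely : ∀ k l μ → ι (2 ℕ.* k) * x ≤ 1ℚ → 1ℚ ≤ ι (4 ℕ.* k) * x → n ℕ.≤ 2 ℕ.^ l → 1 ℕ.≤ l → 8192 ℕ.≤ k → 4 ℕ.* l ℕ.≤ μ →
      1024 ℕ.* (k ℕ.* k) ℕ.* μ ℕ.≤ n → n ℕ.≤ 2048 ℕ.* (k ℕ.* k) ℕ.* μ →
      4 ℕ.* (sampleSize k l ℕ.* sampleSize k l ℕ.+ (sampleSize k l ℕ.+ sampleSize k l)) ℕ.≤ minCodegree μ →
      maxCodegree μ ℕ.* minCodegree μ ℕ.+ 2 ℕ.* (maxCodegree μ ℕ.* maxDegree k μ) ℕ.< n ℕ.* minCodegree μ → Likely (½ ↑ l)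
    likely k l μ 2kx≤1 1≤4kx n≤2^l 1≤l 8192≤k 4l≤μ n≥ n≤ large sparse =
      union-bound l l 0 n≤2^l ≤-refl (ℕ.≤-reflexive (ℕ.+-identityʳ l)) ,
      markov {Agreement} agreement? (implies {Q = Agreement} agreement rarely-pseudorandom)
      where
      open Typical {n} x 0≤x x≤1 k l μ 2kx≤1 1≤4kx n≤2^l 1≤l (ℕ.≤-trans (ℕ.m≤m+n 2048 6144) 8192≤k) 4l≤μ n≥ n≤
      1≤t : 1 ℕ.≤ sampleSize k l
      1≤t = ℕ.*-mono-≤ (ℕ.*-mono-≤ (s≤s (z≤n {3})) (ℕ.≤-trans (s≤s z≤n) 8192≤k)) (ℕ.*-mono-≤ (s≤s (z≤n {2})) 1≤l)
      agreement : ∀ {E} → All Ordered E →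
        Pseudorandom (graph E) (sampleSize k l) (minCodegree μ) (maxDegree k μ) (maxCodegree μ) (maxTricodegree μ) → Agreement E
      agreement {E} _ R = κ≡δ {Γ = graph E} {sampleSize k l} {minCodegree μ} {maxDegree k μ} {maxCodegree μ} {maxTricodegree μ} (λ v → ∈⊤) R 1≤t (ℕ.≤-reflexive (sym (ℕ.*-assoc 4 2 μ))) large sparse

    length-of : ∀ n → 2 ℕ.^ 32 ℕ.≤ n → ∃ λ l → n ℕ.≤ 2 ℕ.^ l × 2 ℕ.^ l ℕ.≤ 2 ℕ.* n
    length-of (suc n) _ = binary-length n

  κ≡δ-likely : ∃ Likely
  κ≡δ-likely = ½ ↑ l , likely k l μ 2kx≤1 1≤4kx n≤2^l 1≤l 8192≤k 4l≤μ n≥ n≤ large sparse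
    where
    l = proj₁ (length-of n 2^32≤n)
    n≤2^l : n ℕ.≤ 2 ℕ.^ l
    n≤2^l = proj₁ (proj₂ (length-of n 2^32≤n))
    32≤l : 32 ℕ.≤ l
    32≤l = ℕ.≮⇒≥ λ l<32 → ℕ.<⇒≱ (ℕ.^-monoʳ-< 2 (s≤s (s≤s z≤n)) l<32) (ℕ.≤-trans 2^32≤n n≤2^l)
    1≤l : 1 ℕ.≤ l
    1≤l = ℕ.≤-trans (s≤s z≤n) 32≤l
    l⁴≤n : l ℕ.^ 4 ℕ.≤ n
    l⁴≤n = ℕ.*-cancelˡ-≤ 2 (ℕ.≤-trans (2l⁴≤2^l l 32≤l) (proj₂ (proj₂ (length-of n 2^32≤n))))
    open Sizes {n} {k} {l} 8192≤k 1≤l [2k]^10≤n l⁴≤n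

-- Passage to the reals

reciprocal : ∀ j → ∃ λ r → 0ℚ < r × ι (suc j) * r ≡ 1ℚ
reciprocal j = r , positive⁻¹ r {{1/pos⇒pos (ι (suc j)) {{ι>0}}}} , *-inverseʳ (ι (suc j)) {{ι≢0}}
  where
  ι>0 : Positive (ι (suc j))
  ι>0 = normalize-pos (suc j) 1
  ι≢0 : NonZero (ι (suc j))
  ι≢0 = pos⇒nonZero (ι (suc j)) {{ι>0}}
  r = (1/ ι (suc j)) {{ι≢0}}

archimedean : ∀ {ε} → 0ℚ < ε → ∃ λ N → 1ℚ ≤ ι N * ε
archimedean {mkℚ (ℤ.+ zero) _ _}    0<ε = contradiction (drop-*<* 0<ε) (ℤ.<-irrefl refl)
archimedean {mkℚ -[1+ _ ] _ _}      0<ε with drop-*<* 0<ε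
... | ()
-- The denominator itself works: `suc d * ε` equals the numerator `suc a`.
archimedean {ε@(mkℚ (ℤ.+ suc a) d _)} 0<ε = suc d , toℚᵘ-cancel-≤ (ℚᵘ.≤-respʳ-≃ (ℚᵘ.≃-sym (ℚᵘ.≃-trans (toℚᵘ-homo-* (ι (suc d)) ε)
  (ℚᵘ.*-congʳ (toℚᵘ-fromℚᵘ (ℚᵘ.mkℚᵘ (ℤ.+ suc d) 0))))) (ℚᵘ.*≤* (ℤ.+≤+ bound)))
  where
  bound : 1 ℕ.* (1 ℕ.* suc d) ℕ.≤ suc d ℕ.* suc a ℕ.* 1
  bound = ℕ.≤-trans (ℕ.≤-reflexive (trans (ℕ.*-identityˡ (1 ℕ.* suc d)) (trans (ℕ.*-identityˡ (suc d)) (sym (ℕ.*-identityʳ (suc d))))))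
    (ℕ.≤-trans (ℕ.*-monoʳ-≤ (suc d) (s≤s z≤n)) (ℕ.≤-reflexive (sym (ℕ.*-identityʳ (suc d ℕ.* suc a)))))

p≤∣p∣ : ∀ p → p ≤ ∣ p ∣
p≤∣p∣ p with ≤-total 0ℚ p
... | inj₁ 0≤p = ≤-reflexive (sym (0≤p⇒∣p∣≡p 0≤p))
... | inj₂ p≤0 = ≤-trans p≤0 (0≤∣p∣ p)

∣↑∣ : ∀ p k → ∣ p ↑ k ∣ ≡ ∣ p ∣ ↑ k
∣↑∣ p zero    = refl
∣↑∣ p (suc k) = trans (∣p*q∣≡∣p∣*∣q∣ p (p ↑ k)) (cong (∣ p ∣ *_) (∣↑∣ p k))

-- As `y ≤ 1` and `10a ≤ b`, the hypothesis gives `1 < (n y^10)^a`, which excludes `n y^10 < 1`.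
dense-enough : ∀ {n y a b} → 0ℚ ≤ y → y ≤ 1ℚ → 10 ℕ.* a ℕ.≤ b → 1ℚ < y ↑ b * ι (n ℕ.^ a) → 1ℚ ≤ ι n * y ↑ 10
dense-enough {n} {y} {a} {b} 0≤y y≤1 10a≤b 1< = ≮⇒≥ λ small → <-irrefl refl (begin-strict
  1ℚ                              <⟨ 1< ⟩
  y ↑ b * ι (n ℕ.^ a)             ≤⟨ *-monoʳ-≤-nonNeg (ι (n ℕ.^ a)) {{nonNegative (ι-nonneg (n ℕ.^ a))}} (↑-antimonoʳ 0≤y y≤1 10a≤b) ⟩
  y ↑ (10 ℕ.* a) * ι (n ℕ.^ a)    ≡⟨ cong₂ _*_ (SExp.^-assocʳ y 10 a) (sym (ι-^ n a)) ⟨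
  (y ↑ 10) ↑ a * ι n ↑ a          ≡⟨ Exp.^-distrib-* (y ↑ 10) (ι n) a ⟨
  (y ↑ 10 * ι n) ↑ a              ≡⟨ cong (_↑ a) (*-comm (y ↑ 10) (ι n)) ⟩
  (ι n * y ↑ 10) ↑ a              ≤⟨ ↑≤1 (*-nonneg (ι-nonneg n) (↑-nonneg 0≤y 10)) (<⇒≤ small) a ⟩
  1ℚ                              ∎)
  where open ≤-Reasoning

-- A term of a sequence representing a nonnegative real may be slightly negative.
positive-approximation : ∀ {n x e a b} → ι (suc n) * e ≡ 1ℚ → 0ℚ < e → e ≤ 1ℚ → 0ℚ ≤ x + e → x ≤ 1ℚ → 10 ℕ.* a ℕ.≤ b →
  1ℚ < x ↑ b * ι (n ℕ.^ a) → 0ℚ < x × 1ℚ ≤ ι n * x ↑ 10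
positive-approximation {n} {x} {e} {a} {b} e-inv 0<e e≤1 0≤x+e x≤1 10a≤b 1< = 0<x , subst (λ y → 1ℚ ≤ ι n * y ↑ 10) (0≤p⇒∣p∣≡p (<⇒≤ 0<x)) dense
  where
  open ≤-Reasoning
  -x≤e : - x ≤ e
  -x≤e = begin
    - x                ≡⟨ +-identityʳ (- x) ⟨
    - x + 0ℚ           ≤⟨ +-monoʳ-≤ (- x) 0≤x+e ⟩
    - x + (x + e)      ≡⟨ solve 2 (λ x e → :- x :+ (x :+ e) := e) refl x e ⟩
    e                  ∎
    where open +-*-Solver
  ∣x∣≤1 : ∣ x ∣ ≤ 1ℚ
  ∣x∣≤1 = [ (λ eq → subst (_≤ 1ℚ) (sym eq) x≤1) , (λ eq → subst (_≤ 1ℚ) (sym eq) (≤-trans -x≤e e≤1)) ]′ (∣p∣≡p∨∣p∣≡-p x)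
  dense : 1ℚ ≤ ι n * ∣ x ∣ ↑ 10
  dense = dense-enough {n} {∣ x ∣} {a} {b} (0≤∣p∣ x) ∣x∣≤1 10a≤b (<-≤-trans 1<
    (*-monoʳ-≤-nonNeg (ι (n ℕ.^ a)) {{nonNegative (ι-nonneg (n ℕ.^ a))}} (≤-trans (p≤∣p∣ (x ↑ b)) (≤-reflexive (∣↑∣ x b)))))
  -- Otherwise `|x| ≤ e = 1/(n+1)`, hence `n |x|^10 ≤ n/(n+1) < 1`, contradicting `dense`.
  0<x : 0ℚ < x
  0<x = ≰⇒> λ x≤0 → <-irrefl refl (begin-strict
    1ℚ                         ≤⟨ dense ⟩
    ι n * (∣ x ∣ * ∣ x ∣ ↑ 9)  ≤⟨ *-monoˡ-≤-nonNeg (ι n) {{nonNegative (ι-nonneg n)}} (*-mono-≤ (<⇒≤ 0<e) (↑-nonneg (0≤∣p∣ x) 9) (∣x∣≤e x≤0) (↑≤1 (0≤∣p∣ x) ∣x∣≤1 9)) ⟩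
    ι n * (e * 1ℚ)             ≡⟨ trans (cong (ι n *_) (*-identityʳ e)) (sym (+-identityˡ (ι n * e))) ⟩
    0ℚ + ι n * e               <⟨ +-monoˡ-< (ι n * e) 0<e ⟩
    e + ι n * e                ≡⟨ solve 2 (λ e i → e :+ i :* e := (con 1ℚ :+ i) :* e) refl e (ι n) ⟩
    (1ℚ + ι n) * e             ≡⟨ cong (_* e) (ι-suc n) ⟨
    ι (suc n) * e              ≡⟨ e-inv ⟩
    1ℚ                         ∎)
    where
    open +-*-Solver
    ∣x∣≤e : x ≤ 0ℚ → ∣ x ∣ ≤ e
    ∣x∣≤e x≤0 = [ (λ eq → ≤-trans (subst (_≤ 0ℚ) (sym eq) x≤0) (<⇒≤ 0<e)) , (λ eq → subst (_≤ e) (sym eq) -x≤e) ]′ (∣p∣≡p∨∣p∣≡-p x)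

p<p+ε : ∀ {p ε} → 0ℚ < ε → p < p + ε
p<p+ε {p} {ε} 0<ε = subst (_< p + ε) (+-identityʳ p) (+-monoʳ-< p 0<ε)

-- For a nonnegative `r` the cut already yields `1 < x^b`, recorded with `a = 0`. For `r = -a/b` the
-- condition `-1/10 < r` says `10a < b`.
log-bound : ∀ {n} → 1 ℕ.≤ n → (p : [0,1]) → ∀ r → - (ℤ.+ 1 / 10) < r → log n p r →
  ∃₂ λ a b → 10 ℕ.* a ℕ.≤ b × ∃ λ K → ∀ i → K ℕ.≤ i → 1ℚ < approx (proj₁ p) i ↑ b * ι (n ℕ.^ a)
log-bound {n} 1≤n (x , _) (mkℚ (ℤ.+ a) d c) _ (ε , 0<ε , K , h) = 0 , suc d , z≤n , K , λ i K≤i → begin-strict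
  1ℚ                                  ≤⟨ ι-mono (ℕ.m^n>0 n {{ℕ.>-nonZero 1≤n}} a) ⟩
  ι (n ℕ.^ a)                         <⟨ p<p+ε 0<ε ⟩
  ι (n ℕ.^ a) + ε                     ≤⟨ h i K≤i ⟩
  approx (x ^ᴿ suc d) i               ≡⟨ approx-^ x (suc d) i ⟩
  approx x i ↑ suc d                  ≡⟨ *-identityʳ (approx x i ↑ suc d) ⟨
  approx x i ↑ suc d * 1ℚ             ∎
  where open ≤-Reasoning
log-bound {n} 1≤n (x , _) (mkℚ -[1+ a ] d c) -1/10<r (ε , 0<ε , K , h) = suc a , suc d , ℕ.<⇒≤ 10a<b , K , λ i K≤i → begin-strict
  1ℚ                                            <⟨ p<p+ε 0<ε ⟩
  1ℚ + ε                                        ≤⟨ h i K≤i ⟩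
  approx (x ^ᴿ suc d) i * ι (n ℕ.^ suc a)       ≡⟨ cong (_* ι (n ℕ.^ suc a)) (approx-^ x (suc d) i) ⟩
  approx x i ↑ suc d * ι (n ℕ.^ suc a)          ∎
  where
  open ≤-Reasoning
  10a<b : 10 ℕ.* suc a ℕ.< suc d
  10a<b = subst₂ ℕ._<_ (ℕ.*-comm (suc a) 10) (ℕ.+-identityʳ (suc d)) (ℤ.drop‿+<+ (ℤ.neg-cancel-< (drop-*<* -1/10<r)))

theorem1p4 : (p : ℕ → [0,1]) → Middling 10 p →
    (λ n → ℙ n (p n) (λ Γ → κ[ 1 ,𝔽₂] Γ ≟⁺ δ[ 1 ] Γ)) ⟶ 1ᴿ
theorem1p4 p ((N₀ , r , -1/10<r , log>r) , p→0) ε 0<ε =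
  N , λ n N≤n →
    let open At n N≤n in
    -- The strict order on `ℝ` asks for a positive gap: one half of `ε` is the gap, the other half
    -- covers the failure probability.
    (½ * ε , 0<½ε , K , λ i K≤i → lower i K≤i) , (ε , 0<ε , K , λ i K≤i → upper i K≤i)
  where
  0<½ε : 0ℚ < ½ * ε
  0<½ε = subst (_< ½ * ε) (*-zeroʳ ½) (*-monoʳ-<-pos ½ 0<ε)
  halves : ½ * ε + ½ * ε ≡ ε
  halves = trans (sym (*-distribʳ-+ ε ½ ½)) (*-identityˡ ε)
  -- `1/32768`, the bound on the density that `Scale` requires.
  η = proj₁ (reciprocal 32767)
  0<η = proj₁ (proj₂ (reciprocal 32767))
  η-inv = proj₂ (proj₂ (reciprocal 32767))
  N₁ = proj₁ (p→0 η 0<η)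
  N₂ = proj₁ (archimedean 0<ε)
  -- `10 * N₂` with `1 ≤ N₂ ε` turns `n h ≤ 1` into `5h ≤ ε/2`; `2^32` ensures `32 ≤ l`.
  N = N₀ ℕ.⊔ (N₁ ℕ.⊔ (10 ℕ.* N₂ ℕ.⊔ 2 ℕ.^ 32))
  module At (n : ℕ) (N≤n : N ℕ.≤ n) where
    N₀≤n : N₀ ℕ.≤ n
    N₀≤n = ℕ.≤-trans (ℕ.m≤m⊔n N₀ _) N≤n
    rest₁ : N₁ ℕ.⊔ (10 ℕ.* N₂ ℕ.⊔ 2 ℕ.^ 32) ℕ.≤ n
    rest₁ = ℕ.≤-trans (ℕ.m≤n⊔m N₀ _) N≤n
    N₁≤n : N₁ ℕ.≤ n
    N₁≤n = ℕ.≤-trans (ℕ.m≤m⊔n N₁ _) rest₁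
    rest₂ : 10 ℕ.* N₂ ℕ.⊔ 2 ℕ.^ 32 ℕ.≤ n
    rest₂ = ℕ.≤-trans (ℕ.m≤n⊔m N₁ _) rest₁
    10N₂≤n : 10 ℕ.* N₂ ℕ.≤ n
    10N₂≤n = ℕ.≤-trans (ℕ.m≤m⊔n (10 ℕ.* N₂) _) rest₂
    2^32≤n : 2 ℕ.^ 32 ℕ.≤ n
    2^32≤n = ℕ.≤-trans (ℕ.m≤n⊔m (10 ℕ.* N₂) _) rest₂
    1≤n : 1 ℕ.≤ n
    1≤n = ℕ.≤-trans (ℕ.m^n>0 2 32) 2^32≤n
    x : ℕ → ℚ
    x = approx (proj₁ (p n))
    P : ℕ → ℚ
    P = approx (ℙ n (p n) (λ Γ → κ[ 1 ,𝔽₂] Γ ≟⁺ δ[ 1 ] Γ))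
    e = proj₁ (reciprocal n)
    0<e = proj₁ (proj₂ (reciprocal n))
    e-inv = proj₂ (proj₂ (reciprocal n))
    e≤1 : e ≤ 1ℚ
    e≤1 = begin
      e                ≡⟨ *-identityˡ e ⟨
      1ℚ * e           ≤⟨ *-monoʳ-≤-nonNeg e {{nonNegative (<⇒≤ 0<e)}} (ι-mono {1} {suc n} (s≤s z≤n)) ⟩
      ι (suc n) * e    ≡⟨ e-inv ⟩
      1ℚ               ∎
      where open ≤-Reasoning
    small = proj₂ (proj₂ (p→0 η 0<η) n N₁≤n)
    nonneg = proj₁ (proj₂ (p n)) e 0<e
    dense = log-bound 1≤n (p n) r -1/10<r (log>r n N₀≤n)
    K₁ = proj₁ (proj₂ (proj₂ small))
    K₂ = proj₁ nonneg
    K₃ = proj₁ (proj₂ (proj₂ (proj₂ dense)))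
    K = K₁ ℕ.⊔ (K₂ ℕ.⊔ K₃)
    module _ (i : ℕ) (K≤i : K ℕ.≤ i) where
      x<η : x i < η
      x<η = begin-strict
        x i                      <⟨ p<p+ε (proj₁ (proj₂ small)) ⟩
        x i + proj₁ small        ≤⟨ proj₂ (proj₂ (proj₂ small)) i (ℕ.≤-trans (ℕ.m≤m⊔n K₁ _) K≤i) ⟩
        0ℚ + η                   ≡⟨ +-identityˡ η ⟩
        η                        ∎
        where open ≤-Reasoning
      x-small : ι 32768 * x i < 1ℚ
      x-small = subst (ι 32768 * x i <_) η-inv (*-monoʳ-<-pos (ι 32768) {{normalize-pos 32768 1}} x<η)
      η≤1 : η ≤ 1ℚ
      η≤1 = begin
        η                ≡⟨ *-identityˡ η ⟨
        1ℚ * η           ≤⟨ *-monoʳ-≤-nonNeg η {{nonNegative (<⇒≤ 0<η)}} (ι-mono {1} {32768} (s≤s z≤n)) ⟩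
        ι 32768 * η      ≡⟨ η-inv ⟩
        1ℚ               ∎
        where open ≤-Reasoning
      0<x×dense : 0ℚ < x i × 1ℚ ≤ ι n * x i ↑ 10
      0<x×dense = positive-approximation {n} {x i} {e} {proj₁ dense} {proj₁ (proj₂ dense)} e-inv 0<e e≤1
        (proj₂ nonneg i (ℕ.≤-trans (ℕ.m≤m⊔n K₂ K₃) (ℕ.≤-trans (ℕ.m≤n⊔m K₁ _) K≤i)))
        (<⇒≤ (<-≤-trans x<η η≤1)) (proj₁ (proj₂ (proj₂ dense)))
        (proj₂ (proj₂ (proj₂ (proj₂ dense))) i (ℕ.≤-trans (ℕ.m≤n⊔m K₂ K₃) (ℕ.≤-trans (ℕ.m≤n⊔m K₁ _) K≤i)))
      P≡ = approx-ℙ n (p n) (λ Γ → κ[ 1 ,𝔽₂] Γ ≟⁺ δ[ 1 ] Γ) i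
      likely = κ≡δ-likely {n} {x i} (proj₁ 0<x×dense) x-small (proj₂ 0<x×dense) 2^32≤n
      h = proj₁ likely
      5h≤½ε : 5× h ≤ ½ * ε
      5h≤½ε = *-cancelˡ-≤-pos (ι n) {{ι>0 1≤n}} (begin
        ι n * 5× h                   ≡⟨ solve 2 (λ i h → i :* (h :+ (h :+ (h :+ (h :+ h)))) := con (ι 5) :* (i :* h)) refl (ι n) h ⟩
        ι 5 * (ι n * h)              ≤⟨ *-monoˡ-≤-nonNeg (ι 5) (proj₁ (proj₂ likely)) ⟩
        ι 5 * 1ℚ                     ≤⟨ *-monoˡ-≤-nonNeg (ι 5) (proj₂ (archimedean 0<ε)) ⟩
        ι 5 * (ι N₂ * ε)             ≡⟨ solve 2 (λ m ε → con (ι 5) :* (m :* ε) := con (ι 10) :* m :* (con ½ :* ε)) refl (ι N₂) ε ⟩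
        ι 10 * ι N₂ * (½ * ε)        ≡⟨ cong (_* (½ * ε)) (ι-* 10 N₂) ⟨
        ι (10 ℕ.* N₂) * (½ * ε)      ≤⟨ *-monoʳ-≤-nonNeg (½ * ε) {{nonNegative (<⇒≤ 0<½ε)}} (ι-mono 10N₂≤n) ⟩
        ι n * (½ * ε)                ∎)
        where
        open ≤-Reasoning
        open +-*-Solver
        ι>0 : ∀ {n} → 1 ℕ.≤ n → Positive (ι n)
        ι>0 {suc n} _ = normalize-pos (suc n) 1
      lower : 1ℚ + ½ * ε ≤ P i + ε
      lower = begin
        1ℚ + ½ * ε                   ≤⟨ +-monoˡ-≤ (½ * ε) (≤-trans (proj₂ (proj₂ likely)) (+-mono-≤ (≤-reflexive (sym P≡)) 5h≤½ε)) ⟩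
        P i + ½ * ε + ½ * ε          ≡⟨ trans (+-assoc (P i) (½ * ε) (½ * ε)) (cong (P i +_) halves) ⟩
        P i + ε                      ∎
        where open ≤-Reasoning
      upper : P i + ε ≤ 1ℚ + ε
      upper = +-monoˡ-≤ ε (subst (_≤ 1ℚ) (sym P≡) (𝔼-𝟙≤1 (proj₁ 0<x×dense) x-small (proj₂ 0<x×dense) 2^32≤n (λ E → κ[ 1 ,𝔽₂] (graph E) ≟⁺ δ[ 1 ] (graph E))))
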